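{- For every integer $n\geq 2$, $$K_n\leq \frac{R_n}{n+1},$$ and in particular $$\log_2 K_n\leq n^2-1-\log_2(n+1).$$
   Context: Write $[n+1]=\{1,\dots,n+1\}$, let $e_1,\dots,e_{n+1}$ be the standard basis of $\mathbb{R}^{n+1}$, and $V_\emptyset=\{\mathbf{x}\in\mathbb{R}^{n+1}:\sum_i x_i=0\}$. Resonance arrangement: $\mathcal{R}_n$ is the arrangement in $V_\emptyset$ of the hyperplanes $\{\mathbf{x}\in V_\emptyset:\sum_{i\in S}x_i=0\}$ for $\emptyset\neq S\subsetneq[n+1]$. $R_n$ is the number of its chambers (connected components of the complement in $V_\emptyset$ of the union of the hyperplanes). A positive alternating tree on $[n+1]$ is a directed graph on vertex set $[n+1]$ whose underlying undirected graph is a tree, all of whose arcs $(i,j)$ satisfy $i<j$, and in which each vertex is either a source (all incident arcs outgoing) or a sink (all incident arcs incoming). Its root cone is $\mathcal{C}(T)=\{\sum_{(i,j)\in E(T)}f(i,j)(e_i-e_j): f(i,j)\geq0\}\subset V_\emptyset$. Kostant chambers: given a collection of cones whose intersection is full-dimensional in $V_\emptyset$, the interior (in $V_\emptyset$) of the intersection is called a refined chamber; a maximally refined chamber is a refined chamber that does not contain any other refined chamber. The Kostant chambers are the maximally refined chambers obtained from intersections of root cones $\mathcal{C}(T)$ of positive alternating trees $T$ on $[n+1]$. (Equivalently, they are the full-dimensional cones in the common refinement of all triangulations of the positive root cone of type $A_n$; they are the domains of polynomiality of the Kostant partition function of type $A_n$.) $K_n$ is the number of Kostant chambers. -}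

module Defs where

open import Algebra.Bundles.Raw using (RawMonoid)
import Algebra.Definitions.RawMonoid as Summation
open import Data.Bool using (Bool; T; if_then_else_)
open import Data.Fin as Fin using (Fin; inject₁; fromℕ)
import Data.Fin.Properties as Fin
open import Data.Fin.Subset using (Subset; Nonempty; ⊤; _⊂_)
open import Data.Integer as ℤ using (+_; +[1+_]; -[1+_])
import Data.Integer.Properties as ℤ
open import Data.List.NonEmpty using (List⁺; toList)
open import Data.List.Relation.Unary.All using (All)
open import Data.Nat as ℕ using (ℕ; zero; suc; _⊔_)
open import Data.Nat.Induction using (<-rec)
open import Data.Nat.Logarithm using (⌊log₂_⌋; ⌊log₂⌋-mono-≤; ⌊log₂⌊n/2⌋⌋≡⌊log₂n⌋∸1)
import Data.Nat.Properties as ℕ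
open import Data.Product using (Σ; Σ-syntax; ∃-syntax; _×_; _,_; proj₁; proj₂)
open import Data.Rational as ℚ using (ℚ; mkℚ; 0ℚ; ½; ∣_∣; *<*; toℚᵘ; fromℚᵘ)
import Data.Rational.Properties as ℚ
open import Data.Rational.Solver using (module +-*-Solver)
open import Data.Rational.Unnormalised as ℚᵘ using (mkℚᵘ; *≡*; *≤*)
import Data.Rational.Unnormalised.Properties as ℚᵘ
open import Data.Sum using (_⊎_; inj₁; inj₂; [_,_]′)
open import Data.Vec using (lookup)
open import Data.Vec.Functional using (Vector)
open import Function using (Bijection; Injective; _on_; _∘_)
open import Level using (Level; 0ℓ) renaming (suc to lsuc; _⊔_ to _⊔ˡ_)
open import Relation.Binary using (Setoid; Rel)
open import Relation.Binary.Construct.Closure.ReflexiveTransitive using (Star)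
open import Relation.Binary.PropositionalEquality
  using (_≡_; refl; sym; trans; cong; cong₂; subst; setoid)
open import Relation.Nullary using (¬_; does; yes; no)
open import Relation.Unary using (Pred; _∈_; _⊆_; _∪_; _∩_; _≬_; _≐_; Satisfiable)
import Relation.Unary.Properties as Unary

------------------------------------------------------------------------
-- Real numbers: Cauchy sequences of rationals, with Cauchy moduli.  A real
-- is a representative, so equality is the relation _≈_.

IsCauchy : (ℕ → ℚ) → Set
IsCauchy s = ∀ ε → 0ℚ ℚ.< ε →
  ∃[ N ] ∀ i j → N ℕ.≤ i → N ℕ.≤ j → ∣ s i ℚ.- s j ∣ ℚ.< ε

record ℝ : Set where
  constructor mkℝ
  field
    seq    : ℕ → ℚ
    cauchy : IsCauchy seq

open ℝ public

infix 4 _<_ _≤_ _≈_ _#_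

_<_ : Rel ℝ 0ℓ
x < y = ∃[ ε ] 0ℚ ℚ.< ε × (∃[ N ] ∀ i → N ℕ.≤ i → seq x i ℚ.+ ε ℚ.≤ seq y i)

_≤_ : Rel ℝ 0ℓ
x ≤ y = ¬ (y < x)

_≈_ : Rel ℝ 0ℓ
x ≈ y = ∀ ε → 0ℚ ℚ.< ε → ∃[ N ] ∀ i → N ℕ.≤ i → ∣ seq x i ℚ.- seq y i ∣ ℚ.< ε

-- Apartness, the constructive form of inequality; classically it is ¬ (x ≈ y).
_#_ : Rel ℝ 0ℓ
x # y = x < y ⊎ y < x

fromℚ : ℚ → ℝ
fromℚ q = mkℝ (λ _ → q) λ ε 0<ε → 0 , λ _ _ _ _ →
  subst (ℚ._< ε) (sym (cong ∣_∣ (ℚ.+-inverseʳ q))) 0<ε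

fromℕ′ : ℕ → ℝ
fromℕ′ k = fromℚ (+ k ℚ./ 1)

0ℝ 1ℝ : ℝ
0ℝ = fromℕ′ 0
1ℝ = fromℕ′ 1

half-pos : ∀ {ε} → 0ℚ ℚ.< ε → 0ℚ ℚ.< ½ ℚ.* ε
half-pos {ε} 0<ε = subst (ℚ._< ½ ℚ.* ε) (ℚ.*-zeroʳ ½) (ℚ.*-monoʳ-<-pos ½ 0<ε)

halves : ∀ ε → ½ ℚ.* ε ℚ.+ ½ ℚ.* ε ≡ ε
halves ε = trans (sym (ℚ.*-distribʳ-+ ε ½ ½)) (ℚ.*-identityˡ ε)

+-swap : ∀ a b c d → (a ℚ.+ b) ℚ.- (c ℚ.+ d) ≡ (a ℚ.- c) ℚ.+ (b ℚ.- d)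
+-swap = solve 4 (λ a b c d → (a :+ b) :- (c :+ d) := (a :- c) :+ (b :- d)) refl
  where open +-*-Solver

neg-swap : ∀ a b → (ℚ.- a) ℚ.- (ℚ.- b) ≡ ℚ.- (a ℚ.- b)
neg-swap = solve 2 (λ a b → (:- a) :- (:- b) := :- (a :- b)) refl
  where open +-*-Solver

infixl 6 _+_ _-_
infix  8 -_

_+_ : ℝ → ℝ → ℝ
x + y = mkℝ (λ i → seq x i ℚ.+ seq y i) λ ε 0<ε →
  let M , p = cauchy x (½ ℚ.* ε) (half-pos 0<ε)
      N , q = cauchy y (½ ℚ.* ε) (half-pos 0<ε)
      open ℚ.≤-Reasoning
  in M ⊔ N , λ i j M⊔N≤i M⊔N≤j → begin-strict
    ∣ (seq x i ℚ.+ seq y i) ℚ.- (seq x j ℚ.+ seq y j) ∣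
      ≡⟨ cong ∣_∣ (+-swap (seq x i) (seq y i) (seq x j) (seq y j)) ⟩
    ∣ (seq x i ℚ.- seq x j) ℚ.+ (seq y i ℚ.- seq y j) ∣
      ≤⟨ ℚ.∣p+q∣≤∣p∣+∣q∣ (seq x i ℚ.- seq x j) (seq y i ℚ.- seq y j) ⟩
    ∣ seq x i ℚ.- seq x j ∣ ℚ.+ ∣ seq y i ℚ.- seq y j ∣
      <⟨ ℚ.+-mono-< (p i j (ℕ.m⊔n≤o⇒m≤o M N M⊔N≤i) (ℕ.m⊔n≤o⇒m≤o M N M⊔N≤j))
                    (q i j (ℕ.m⊔n≤o⇒n≤o M N M⊔N≤i) (ℕ.m⊔n≤o⇒n≤o M N M⊔N≤j)) ⟩
    ½ ℚ.* ε ℚ.+ ½ ℚ.* ε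
      ≡⟨ halves ε ⟩
    ε ∎

-_ : ℝ → ℝ
- x = mkℝ (λ i → ℚ.- seq x i) λ ε 0<ε →
  let N , p = cauchy x ε 0<ε
  in N , λ i j N≤i N≤j → subst (ℚ._< ε)
       (sym (trans (cong ∣_∣ (neg-swap (seq x i) (seq x j)))
                   (ℚ.∣-p∣≡∣p∣ (seq x i ℚ.- seq x j))))
       (p i j N≤i N≤j)

_-_ : ℝ → ℝ → ℝ
x - y = x + (- y)

+-0-rawMonoid : RawMonoid 0ℓ 0ℓ
+-0-rawMonoid = record { Carrier = ℝ ; _≈_ = _≈_ ; _∙_ = _+_ ; ε = 0ℝ }

open Summation +-0-rawMonoid public using (sum)

------------------------------------------------------------------------
-- The binary logarithm of a positive integer m is the limit of
-- ⌊log₂ (m ^ k)⌋ / k as k → ∞: from 2 ^ a ≤ m ^ k < 2 ^ (a + 1), where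
-- a = ⌊log₂ (m ^ k)⌋, it lies between a / k and (a + 1) / k.

log-lower : ∀ n .{{_ : ℕ.NonZero n}} → 2 ℕ.^ ⌊log₂ n ⌋ ℕ.≤ n
log-upper : ∀ n → n ℕ.< 2 ℕ.^ suc ⌊log₂ n ⌋

2*⌊n/2⌋≤n : ∀ n → 2 ℕ.* ℕ.⌊ n /2⌋ ℕ.≤ n
2*⌊n/2⌋≤n n = subst (2 ℕ.* h ℕ.≤_) (ℕ.⌊n/2⌋+⌈n/2⌉≡n n)
  (ℕ.+-monoʳ-≤ h (subst (ℕ._≤ ℕ.⌈ n /2⌉) (sym (ℕ.+-identityʳ h)) (ℕ.⌊n/2⌋≤⌈n/2⌉ n)))
  where h = ℕ.⌊ n /2⌋

n<2*1+⌊n/2⌋ : ∀ n → n ℕ.< 2 ℕ.* suc ℕ.⌊ n /2⌋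
n<2*1+⌊n/2⌋ zero          = ℕ.z<s
n<2*1+⌊n/2⌋ (suc zero)    = ℕ.s<s ℕ.z<s
n<2*1+⌊n/2⌋ (suc (suc n)) = subst (suc (suc n) ℕ.<_)
  (sym (ℕ.*-suc 2 (suc ℕ.⌊ n /2⌋))) (ℕ.s<s (ℕ.s<s (n<2*1+⌊n/2⌋ n)))

log-step : ∀ n → ⌊log₂ suc (suc n) ⌋ ≡ suc ⌊log₂ ℕ.⌊ suc (suc n) /2⌋ ⌋
log-step n = trans
  (sym (ℕ.m+[n∸m]≡n {1} (⌊log₂⌋-mono-≤ {2} {suc (suc n)} (ℕ.s≤s (ℕ.s≤s ℕ.z≤n)))))
  (cong suc (sym (⌊log₂⌊n/2⌋⌋≡⌊log₂n⌋∸1 (suc (suc n)))))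

log-lower n = <-rec (λ n → 0 ℕ.< n → 2 ℕ.^ ⌊log₂ n ⌋ ℕ.≤ n) go n (ℕ.>-nonZero⁻¹ n)
  where
  go : ∀ n → (∀ {m} → m ℕ.< n → 0 ℕ.< m → 2 ℕ.^ ⌊log₂ m ⌋ ℕ.≤ m) →
       0 ℕ.< n → 2 ℕ.^ ⌊log₂ n ⌋ ℕ.≤ n
  go (suc zero)    _   _ = ℕ.≤-refl
  go (suc (suc n)) rec _ = subst (λ l → 2 ℕ.^ l ℕ.≤ suc (suc n)) (sym (log-step n))
    (ℕ.≤-trans (ℕ.*-monoʳ-≤ 2 (rec (ℕ.⌊n/2⌋<n (suc n)) ℕ.z<s)) (2*⌊n/2⌋≤n (suc (suc n))))

log-upper = <-rec (λ n → n ℕ.< 2 ℕ.^ suc ⌊log₂ n ⌋) go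
  where
  go : ∀ n → (∀ {m} → m ℕ.< n → m ℕ.< 2 ℕ.^ suc ⌊log₂ m ⌋) →
       n ℕ.< 2 ℕ.^ suc ⌊log₂ n ⌋
  go zero          _   = ℕ.z<s
  go (suc zero)    _   = ℕ.s<s ℕ.z<s
  go (suc (suc n)) rec =
    subst (λ l → suc (suc n) ℕ.< 2 ℕ.^ suc l) (sym (log-step n))
      (ℕ.<-≤-trans (n<2*1+⌊n/2⌋ (suc (suc n)))
        (ℕ.*-monoʳ-≤ 2 (rec (ℕ.⌊n/2⌋<n (suc n)))))

-- With a = ⌊log₂ m^i⌋ and b = ⌊log₂ m^j⌋: 2^(aj) ≤ m^(ij) ≤ 2^((b+1)i).
log-compare : ∀ m .{{_ : ℕ.NonZero m}} i j →
  ⌊log₂ m ℕ.^ i ⌋ ℕ.* j ℕ.≤ suc ⌊log₂ m ℕ.^ j ⌋ ℕ.* i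
log-compare m i j = ℕ.≮⇒≥ λ lt → ℕ.<-irrefl refl (ℕ.≤-<-trans bound
  (ℕ.^-monoʳ-< 2 (ℕ.s≤s (ℕ.s≤s ℕ.z≤n)) lt))
  where
  open ℕ.≤-Reasoning
  a = ⌊log₂ m ℕ.^ i ⌋
  b = ⌊log₂ m ℕ.^ j ⌋
  bound : 2 ℕ.^ (a ℕ.* j) ℕ.≤ 2 ℕ.^ (suc b ℕ.* i)
  bound = begin
    2 ℕ.^ (a ℕ.* j)       ≡⟨ ℕ.^-*-assoc 2 a j ⟨
    (2 ℕ.^ a) ℕ.^ j       ≤⟨ ℕ.^-monoˡ-≤ j (log-lower (m ℕ.^ i) {{ℕ.m^n≢0 m i}}) ⟩
    (m ℕ.^ i) ℕ.^ j       ≡⟨ ℕ.^-*-assoc m i j ⟩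
    m ℕ.^ (i ℕ.* j)       ≡⟨ cong (m ℕ.^_) (ℕ.*-comm i j) ⟩
    m ℕ.^ (j ℕ.* i)       ≡⟨ ℕ.^-*-assoc m j i ⟨
    (m ℕ.^ j) ℕ.^ i       ≤⟨ ℕ.^-monoˡ-≤ i (ℕ.<⇒≤ (log-upper (m ℕ.^ j))) ⟩
    (2 ℕ.^ suc b) ℕ.^ i   ≡⟨ ℕ.^-*-assoc 2 (suc b) i ⟩
    2 ℕ.^ (suc b ℕ.* i)   ∎

/-mono : ∀ a i b j → a ℕ.* suc j ℕ.≤ b ℕ.* suc i →
  + a ℚ./ suc i ℚ.≤ + b ℚ./ suc j
/-mono a i b j le = ℚ.toℚᵘ-cancel-≤ (begin
  toℚᵘ (fromℚᵘ (mkℚᵘ (+ a) i)) ≃⟨ ℚ.toℚᵘ-fromℚᵘ (mkℚᵘ (+ a) i) ⟩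
  mkℚᵘ (+ a) i                 ≤⟨ *≤* (ℤ.≤-trans (ℤ.≤-reflexive (sym (ℤ.pos-* a (suc j))))
                                    (ℤ.≤-trans (ℤ.+≤+ le) (ℤ.≤-reflexive (ℤ.pos-* b (suc i))))) ⟩
  mkℚᵘ (+ b) j                 ≃⟨ ℚ.toℚᵘ-fromℚᵘ (mkℚᵘ (+ b) j) ⟨
  toℚᵘ (fromℚᵘ (mkℚᵘ (+ b) j)) ∎)
  where open ℚᵘ.≤-Reasoning

/-suc : ∀ b j → + suc b ℚ./ suc j ≡ + b ℚ./ suc j ℚ.+ + 1 ℚ./ suc j
/-suc b j = ℚ.toℚᵘ-injective (begin
  toℚᵘ (+ suc b ℚ./ suc j)                        ≈⟨ ℚ.toℚᵘ-fromℚᵘ (mkℚᵘ (+ suc b) j) ⟩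
  mkℚᵘ (+ suc b) j                                ≈⟨ *≡* eq ⟩
  mkℚᵘ (+ b) j ℚᵘ.+ mkℚᵘ (+ 1) j                  ≈⟨ ℚᵘ.+-cong (ℚ.toℚᵘ-fromℚᵘ (mkℚᵘ (+ b) j)) (ℚ.toℚᵘ-fromℚᵘ (mkℚᵘ (+ 1) j)) ⟨
  toℚᵘ (+ b ℚ./ suc j) ℚᵘ.+ toℚᵘ (+ 1 ℚ./ suc j)  ≈⟨ ℚ.toℚᵘ-homo-+ (+ b ℚ./ suc j) (+ 1 ℚ./ suc j) ⟨
  toℚᵘ (+ b ℚ./ suc j ℚ.+ + 1 ℚ./ suc j)          ∎)
  where
  open import Relation.Binary.Reasoning.Setoid ℚᵘ.≃-setoid
  D = + suc j
  eq : + suc b ℤ.* + (suc j ℕ.* suc j) ≡ (+ b ℤ.* D ℤ.+ + 1 ℤ.* D) ℤ.* D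
  eq = trans (cong₂ ℤ._*_ (cong +_ (ℕ.+-comm 1 b)) (ℤ.pos-* (suc j) (suc j)))
      (trans (cong (ℤ._* (D ℤ.* D)) (ℤ.pos-+ b 1))
      (trans (sym (ℤ.*-assoc (+ b ℤ.+ + 1) D D))
             (cong (ℤ._* D) (ℤ.*-distribʳ-+ D (+ b) (+ 1)))))

minus-≤ : ∀ p q r → p ℚ.≤ q ℚ.+ r → p ℚ.- q ℚ.≤ r
minus-≤ p q r le = subst (p ℚ.- q ℚ.≤_) (cancel q r) (ℚ.+-monoˡ-≤ (ℚ.- q) le)
  where
  open +-*-Solver
  cancel : ∀ q r → (q ℚ.+ r) ℚ.- q ≡ r
  cancel = solve 2 (λ q r → (q :+ r) :- q := r) refl

abs-< : ∀ p ε → p ℚ.< ε → ℚ.- p ℚ.< ε → ∣ p ∣ ℚ.< ε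
abs-< p ε p<ε -p<ε with ℚ.∣p∣≡p∨∣p∣≡-p p
... | inj₁ eq = subst (ℚ._< ε) (sym eq) p<ε
... | inj₂ eq = subst (ℚ._< ε) (sym eq) -p<ε

archimedean : ∀ ε → 0ℚ ℚ.< ε → ∃[ N ] + 1 ℚ./ suc N ℚ.< ε
archimedean (mkℚ +[1+ p ] d c) _ = suc d , ℚ.toℚᵘ-cancel-< (begin-strict
  toℚᵘ (+ 1 ℚ./ suc (suc d)) ≃⟨ ℚ.toℚᵘ-fromℚᵘ (mkℚᵘ (+ 1) (suc d)) ⟩
  mkℚᵘ (+ 1) (suc d)         <⟨ ℚᵘ.*<* (ℤ.+<+ (ℕ.≤-trans
                                  (ℕ.s≤s (ℕ.s≤s (ℕ.≤-reflexive (ℕ.+-identityʳ d))))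
                                  (ℕ.m≤m+n (suc (suc d)) (p ℕ.* suc (suc d))))) ⟩
  mkℚᵘ +[1+ p ] d            ∎)
  where open ℚᵘ.≤-Reasoning
archimedean (mkℚ (+ 0) d c)    (*<* (ℤ.+<+ ()))
archimedean (mkℚ -[1+ p ] d c) (*<* ())

log₂-approx : ℕ → ℕ → ℚ
log₂-approx m k = + ⌊log₂ m ℕ.^ suc k ⌋ ℚ./ suc k

log₂-cauchy : ∀ m .{{_ : ℕ.NonZero m}} → IsCauchy (log₂-approx m)
log₂-cauchy m ε 0<ε with archimedean ε 0<ε
... | N , 1/N<ε = N , λ i j N≤i N≤j →
  abs-< (s i ℚ.- s j) ε (close i j N≤j)
    (subst (ℚ._< ε) (flip-minus (s j) (s i)) (close j i N≤i))
  where
  s = log₂-approx m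
  flip-minus : ∀ p q → p ℚ.- q ≡ ℚ.- (q ℚ.- p)
  flip-minus = solve 2 (λ p q → p :- q := :- (q :- p)) refl
    where open +-*-Solver
  close : ∀ i j → N ℕ.≤ j → s i ℚ.- s j ℚ.< ε
  close i j N≤j = ℚ.≤-<-trans
    (minus-≤ (s i) (s j) (+ 1 ℚ./ suc j)
      (subst (s i ℚ.≤_) (/-suc b j) (/-mono ⌊log₂ m ℕ.^ suc i ⌋ i (suc b) j
        (log-compare m (suc i) (suc j)))))
    (ℚ.≤-<-trans (/-mono 1 j 1 N (ℕ.*-monoʳ-≤ 1 (ℕ.s≤s N≤j))) 1/N<ε)
    where b = ⌊log₂ m ℕ.^ suc j ⌋

-- The value at 0 is a dummy.
log₂ : ℕ → ℝ
log₂ zero      = 0ℝ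
log₂ m@(suc _) = mkℝ (log₂-approx m) (log₂-cauchy m)

------------------------------------------------------------------------
-- The hyperplane V∅ in ℝ^(n+1), its topology, connected components.
-- Coordinates are indexed by Fin (suc n) in place of {1, …, n+1}.

Point : ℕ → Set
Point n = Vector ℝ (suc n)

module _ {n : ℕ} where

  V∅ : Pred (Point n) 0ℓ
  V∅ x = sum x ≈ 0ℝ

  -- Open balls of the maximum norm.
  Ball : ℚ → Point n → Pred (Point n) 0ℓ
  Ball ε x y = ∀ i → x i - fromℚ ε < y i × y i < x i + fromℚ ε

  -- Topological notions are relative to V∅.
  Interior : Pred (Point n) 0ℓ → Pred (Point n) 0ℓ
  Interior P x = x ∈ V∅ × (∃[ ε ] 0ℚ ℚ.< ε × (∀ y → y ∈ V∅ → y ∈ Ball ε x → y ∈ P))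

  IsOpen : Pred (Point n) 0ℓ → Set
  IsOpen U = ∀ x → x ∈ V∅ → x ∈ U → x ∈ Interior U

  -- No two open sets separate C; P ≬ Q says that P and Q have a common point.
  IsConnected : Pred (Point n) 0ℓ → Set₁
  IsConnected C = (U W : Pred (Point n) 0ℓ) → IsOpen U → IsOpen W →
    C ⊆ U ∪ W → C ≬ U → C ≬ W → C ≬ (U ∩ W)

  InSameComponent : Pred (Point n) 0ℓ → Rel (Point n) (lsuc 0ℓ)
  InSameComponent X x y =
    Σ[ C ∈ Pred (Point n) 0ℓ ] C ⊆ X × IsConnected C × x ∈ C × y ∈ C

  private
    union-connected : {C D : Pred (Point n) 0ℓ} → IsConnected C → IsConnected D →
      C ≬ D → IsConnected (C ∪ D)
    union-connected {C} {D} cC cD (z , z∈C , z∈D) U W oU oW cover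
                    (u , u∈C∪D , u∈U) (w , w∈C∪D , w∈W) =
      [ (λ z∈U → atU z∈U w∈C∪D) , (λ z∈W → atW z∈W u∈C∪D) ]′ (cover (inj₁ z∈C))
      where
      inC : C ≬ U → C ≬ W → (C ∪ D) ≬ (U ∩ W)
      inC p q = let v , v∈C , v∈ = cC U W oU oW (cover ∘ inj₁) p q in v , inj₁ v∈C , v∈
      inD : D ≬ U → D ≬ W → (C ∪ D) ≬ (U ∩ W)
      inD p q = let v , v∈D , v∈ = cD U W oU oW (cover ∘ inj₂) p q in v , inj₂ v∈D , v∈
      atU : z ∈ U → w ∈ C ∪ D → (C ∪ D) ≬ (U ∩ W)
      atU z∈U (inj₁ w∈C) = inC (z , z∈C , z∈U) (w , w∈C , w∈W)
      atU z∈U (inj₂ w∈D) = inD (z , z∈D , z∈U) (w , w∈D , w∈W)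
      atW : z ∈ W → u ∈ C ∪ D → (C ∪ D) ≬ (U ∩ W)
      atW z∈W (inj₁ u∈C) = inC (u , u∈C , u∈U) (z , z∈C , z∈W)
      atW z∈W (inj₂ u∈D) = inD (u , u∈D , u∈U) (z , z∈D , z∈W)

  -- The connected components of X, as the quotient of X by InSameComponent X.
  components : Pred (Point n) 0ℓ → Setoid 0ℓ (lsuc 0ℓ)
  components X = record
    { Carrier       = Σ (Point n) X
    ; _≈_           = InSameComponent X on proj₁
    ; isEquivalence = record
      { refl  = λ {x} → (proj₁ x ≡_)
                , (λ { refl → proj₂ x })
                , (λ { _ _ _ _ _ (_ , refl , u) (_ , refl , w) → proj₁ x , refl , u , w })
                , refl , refl
      ; sym   = λ (C , C⊆X , cC , x∈C , y∈C) → C , C⊆X , cC , y∈C , x∈C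
      ; trans = λ {_} {y} (C , C⊆X , cC , x∈C , y∈C) (D , D⊆X , cD , y∈D , z∈D) →
          C ∪ D , [ C⊆X , D⊆X ]′ , union-connected cC cD (proj₁ y , y∈C , y∈D)
          , inj₁ x∈C , inj₂ z∈D
      }
    }

------------------------------------------------------------------------
-- The resonance arrangement

  sumOver : Subset (suc n) → Point n → ℝ
  sumOver S x = sum λ i → if lookup S i then x i else 0ℝ

  ResonanceComplement : Pred (Point n) 0ℓ
  ResonanceComplement x =
    x ∈ V∅ × (∀ S → Nonempty S → S ⊂ ⊤ → sumOver S x # 0ℝ)

resonanceChambers : ℕ → Setoid 0ℓ (lsuc 0ℓ)
resonanceChambers n = components (ResonanceComplement {n})

------------------------------------------------------------------------
-- Positive alternating trees and their root cones

Digraph : ℕ → Set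
Digraph N = Fin N → Fin N → Bool

module _ {N : ℕ} (G : Digraph N) where

  Arc : Rel (Fin N) 0ℓ
  Arc i j = T (G i j)

  Adjacent : Rel (Fin N) 0ℓ
  Adjacent i j = Arc i j ⊎ Arc j i

  Connected : Set
  Connected = ∀ i j → Star Adjacent i j

  -- There is no cycle c 0, c 1, …, c (k + 2), c 0 with k + 3 distinct vertices.
  Acyclic : Set
  Acyclic = ∀ k (c : Fin (3 ℕ.+ k) → Fin N) → Injective _≡_ _≡_ c →
    (∀ i → Adjacent (c (inject₁ i)) (c (Fin.suc i))) →
    ¬ Adjacent (c (fromℕ (2 ℕ.+ k))) (c Fin.zero)

  IsSource IsSink : Pred (Fin N) 0ℓ
  IsSource v = ∀ u → ¬ Arc u v
  IsSink   v = ∀ w → ¬ Arc v w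

record PositiveAlternatingTree (N : ℕ) : Set where
  field
    graph       : Digraph N
    connected   : Connected graph
    acyclic     : Acyclic graph
    positive    : ∀ {i j} → Arc graph i j → i Fin.< j
    alternating : ∀ v → IsSource graph v ⊎ IsSink graph v

open PositiveAlternatingTree public

module _ {n : ℕ} where

  -- The multiple t e_i of a standard basis vector.
  _·e_ : ℝ → Fin (suc n) → Point n
  (t ·e i) k = if does (i Fin.≟ k) then t else 0ℝ

  RootCone : PositiveAlternatingTree (suc n) → Pred (Point n) 0ℓ
  RootCone t x = Σ[ f ∈ (Fin (suc n) → Fin (suc n) → ℝ) ]
    (∀ i j → Arc (graph t) i j → 0ℝ ≤ f i j) ×
    (∀ k → x k ≈ sum λ i → sum λ j →
      if graph t i j then (f i j ·e i) k - (f i j ·e j) k else 0ℝ)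

------------------------------------------------------------------------
-- Kostant chambers

  ConeIntersection : List⁺ (PositiveAlternatingTree (suc n)) → Pred (Point n) 0ℓ
  ConeIntersection ts x = All (λ t → x ∈ RootCone t) (toList ts)

  -- For a convex set, spanning V∅ amounts to having an interior point in V∅.
  FullDimensional : Pred (Point n) 0ℓ → Set
  FullDimensional P = Satisfiable (Interior P)

  IsRefinedChamber : Pred (Point n) 0ℓ → Set
  IsRefinedChamber P = ∃[ ts ]
    FullDimensional (ConeIntersection ts) × P ≐ Interior (ConeIntersection ts)

  IsKostantChamber : Pred (Point n) 0ℓ → Set₁
  IsKostantChamber P =
    IsRefinedChamber P × (∀ Q → IsRefinedChamber Q → Q ⊆ P → Q ≐ P)

kostantChambers : ℕ → Setoid (lsuc 0ℓ) 0ℓ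
kostantChambers n = record
  { Carrier       = Σ (Pred (Point n) 0ℓ) IsKostantChamber
  ; _≈_           = _≐_ on proj₁
  ; isEquivalence = record
    { refl = Unary.≐-refl ; sym = Unary.≐-sym ; trans = Unary.≐-trans }
  }

------------------------------------------------------------------------

-- The number of elements of S, counted up to its equality, is k.
HasCardinality : {a ℓ : Level} → Setoid a ℓ → ℕ → Set (a ⊔ˡ ℓ)
HasCardinality S k = Bijection (setoid (Fin k)) S

{-# OPTIONS --safe #-}
-- A flow on a tree is determined by the point x that it produces: its value on an arc is the
-- sum of x over one side of the cut at that arc.  Hence whether a generic point lies in a root
-- cone depends only on its resonance chamber, and distinct Kostant chambers contain distinct
-- resonance chambers.  Points of root cones have positive partial sums x₁ + … + xₘ.  The n + 1
-- cyclic rotations of the coordinates permute the resonance chambers, and a generic point has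
-- positive partial sums after at most one rotation, so (n + 1) K ≤ R.
--
-- For R ≤ 2^(n² - 1), a chamber is determined by its Chow parameters
-- cᵢ = #{A ⊆ [n] : i ∈ A and x(A) > 0} ≤ 2^(n-1): the pairing ∑ᵢ cᵢ xᵢ = ∑_{A positive} x(A)
-- is maximal exactly at the parameters of the chamber of x.
--
-- All computations take place in ℚ, at a common index of the Cauchy sequences of the coordinates.
module Submission where

open import Defs
open import Algebra.Bundles using (CommutativeRing)
open import Data.Bool using (Bool; true; false; not; _∧_; if_then_else_; T)
import Data.Bool.Properties as Bool
open import Data.Empty using (⊥; ⊥-elim)
open import Data.Fin as Fin using (Fin; zero; suc; toℕ)
open import Data.Fin.Permutation using (permutation)
import Data.Fin.Properties as Fin
open import Data.Fin.Subset as Subset using (Subset)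
import Data.Fin.Subset.Properties as Subset
open import Data.Integer using (+_)
open import Data.List as List using (List; []; _∷_; _++_)
open import Data.List.Membership.Propositional using () renaming (_∈_ to _∈ₗ_)
open import Data.List.Membership.Propositional.Properties using (∈-++⁺ˡ; ∈-++⁺ʳ; ∈-map⁺)
open import Data.List.NonEmpty using (List⁺; _∷_; _⁺++⁺_)
open import Data.List.Relation.Unary.All as All using (All; []; _∷_)
import Data.List.Relation.Unary.All.Properties as All
open import Data.List.Relation.Unary.Any using (here)
open import Data.Nat as ℕ using (ℕ; zero; suc; _^_; _⊔_)
open import Data.Nat.DivMod using (_%_; m%n<n; %-distribˡ-+; m%n%n≡m%n; [m+n]%n≡m%n; m<n⇒m%n≡m)
open import Data.Nat.Logarithm using (⌊log₂_⌋)
import Data.Nat.Properties as ℕ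
open import Data.Nat.Tactic.RingSolver using (solve-∀)
open import Data.Product using (Σ-syntax; ∃; ∃-syntax; _×_; _,_; proj₁; proj₂)
open import Data.Rational as ℚ using (ℚ; 0ℚ; 1ℚ; ½; ∣_∣)
import Data.Rational.Properties as ℚ
open import Data.Rational.Solver using (module +-*-Solver)
open import Data.Sum as Sum using (_⊎_; inj₁; inj₂; [_,_]′)
open import Data.Unit using (⊤; tt)
open import Data.Vec using ([]; _∷_; lookup; tabulate)
import Data.Vec.Properties as Vec
open import Function using (Bijection; Injective; _∘_; id; mk⇔)
open import Level using (0ℓ)
open import Relation.Binary using (Rel; Setoid; tri<; tri≈; tri>)
open import Relation.Binary.Construct.Closure.ReflexiveTransitive
  using (Star; _◅_; _◅◅_) renaming (ε to nil)
open import Relation.Binary.PropositionalEquality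
  using (_≡_; _≢_; _≗_; refl; sym; trans; cong; cong₂; subst; subst₂; module ≡-Reasoning)
open import Relation.Nullary using (¬_; Dec; yes; no; does; _×-dec_)
open import Relation.Nullary.Decidable using (¬?; dec-true; dec-false; does-⇔; ¬¬-excluded-middle)
open import Relation.Unary using (Pred; _∈_; _⊆_; _≐_)
open import Relation.Unary.Properties using (≐-sym; ≐-trans)
open import Algebra.Definitions.RawMonoid ℚ.+-0-rawMonoid
  using () renaming (_×_ to infixr 8 _·_)
open import Algebra.Properties.Monoid.Mult (CommutativeRing.+-monoid ℚ.+-*-commutativeRing)
  using (×-homo-+)
open import Algebra.Properties.Semiring.Sum
  (CommutativeRing.semiring ℚ.+-*-commutativeRing)
  using (∑-distrib-+; ∑-comm; sum-permute; sum-cong-≗; sum-replicate-zero; *-distribˡ-sum)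
  renaming (sum to ∑)

-- The order on the reals is undecidable and `_≤_` is a negation, so points are handled through
-- positivity alone: a negative subset sum is a positive sum over the complement. Chambers are
-- connected components, and both halves of their comparison with sign vectors are needed. Points of
-- one component share their signs, which serves the bound on K; points with the same signs share a
-- component, which serves the bound on R. The second half needs connectedness of convex sets in the
-- strong form that exhibits a common point of two open sets; bisection of a segment finds it. A
-- Kostant chamber is represented by a rational point off all hyperplanes, with decidable signs. At
-- most one rotation has positive partial sums because, for two different rotations, the same
-- interval of positions is a prefix of one and a suffix of the other, and a suffix sum is minus a
-- prefix sum. The Chow parameters give R ≤ (2^(n-1) + 1)^n. For n ≥ 3 this is at most 2^(n² - 1);
-- for n = 2 the signs are counted directly.

-- Inequalities between rationals

-- Linear arithmetic by certificate: `p ≤ q` collects the hypotheses, usually as a sum of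
-- inequalities, and the equation, which the ring solver can check, says that s - r = q - p.
≤-by : ∀ {p q r s} → p ℚ.≤ q → r ℚ.+ q ≡ s ℚ.+ p → r ℚ.≤ s
≤-by {p} {q} {r} {s} p≤q eq = begin
  r                     ≡⟨ solve 2 (λ r p → r := (r :+ p) :- p) refl r p ⟩
  (r ℚ.+ p) ℚ.- p       ≤⟨ ℚ.+-monoˡ-≤ (ℚ.- p) (ℚ.+-monoʳ-≤ r p≤q) ⟩
  (r ℚ.+ q) ℚ.- p       ≡⟨ cong (ℚ._- p) eq ⟩
  (s ℚ.+ p) ℚ.- p       ≡⟨ solve 2 (λ s p → (s :+ p) :- p := s) refl s p ⟩
  s                     ∎
  where
  open ℚ.≤-Reasoning
  open +-*-Solver

<-by : ∀ {p q r s} → p ℚ.< q → r ℚ.+ q ≡ s ℚ.+ p → r ℚ.< s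
<-by {p} {q} {r} {s} p<q eq = begin-strict
  r                     ≡⟨ solve 2 (λ r p → r := (r :+ p) :- p) refl r p ⟩
  (r ℚ.+ p) ℚ.- p       <⟨ ℚ.+-monoˡ-< (ℚ.- p) (ℚ.+-monoʳ-< r p<q) ⟩
  (r ℚ.+ q) ℚ.- p       ≡⟨ cong (ℚ._- p) eq ⟩
  (s ℚ.+ p) ℚ.- p       ≡⟨ solve 2 (λ s p → (s :+ p) :- p := s) refl s p ⟩
  s                     ∎
  where
  open ℚ.≤-Reasoning
  open +-*-Solver

abs-≤ : ∀ {p ε} → p ℚ.≤ ε → ℚ.- p ℚ.≤ ε → ∣ p ∣ ℚ.≤ ε
abs-≤ {p} {ε} p≤ε -p≤ε with ℚ.∣p∣≡p∨∣p∣≡-p p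
... | inj₁ eq = subst (ℚ._≤ ε) (sym eq) p≤ε
... | inj₂ eq = subst (ℚ._≤ ε) (sym eq) -p≤ε

p≤∣p∣ : ∀ p → p ℚ.≤ ∣ p ∣
p≤∣p∣ p with ℚ.≤-total 0ℚ p
... | inj₁ 0≤p = ℚ.≤-reflexive (sym (ℚ.0≤p⇒∣p∣≡p 0≤p))
... | inj₂ p≤0 = ℚ.≤-trans p≤0 (ℚ.0≤∣p∣ p)

-p≤∣p∣ : ∀ p → ℚ.- p ℚ.≤ ∣ p ∣
-p≤∣p∣ p = subst (ℚ.- p ℚ.≤_) (ℚ.∣-p∣≡∣p∣ p) (p≤∣p∣ (ℚ.- p))

half-< : ∀ {ε} → 0ℚ ℚ.< ε → ½ ℚ.* ε ℚ.< ε
half-< {ε} 0<ε = <-by (half-pos 0<ε) (trans (halves ε) (sym (ℚ.+-identityʳ ε)))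

-- Halving `n` times stands in for division by `n`: since n ≤ 2^n, `n` copies of the result fit into
-- `ε`. Applied to `1ℚ` it is the length of the intervals in a bisection.
shrink : ℕ → ℚ → ℚ
shrink zero    ε = ε
shrink (suc n) ε = ½ ℚ.* shrink n ε

shrink-pos : ∀ n {ε} → 0ℚ ℚ.< ε → 0ℚ ℚ.< shrink n ε
shrink-pos zero    0<ε = 0<ε
shrink-pos (suc n) 0<ε = half-pos (shrink-pos n 0<ε)

shrink-≤ : ∀ n {ε} → 0ℚ ℚ.≤ ε → (0ℚ ℚ.≤ shrink n ε) × (shrink n ε ℚ.≤ ε)
shrink-≤ zero    0≤ε = 0≤ε , ℚ.≤-refl
shrink-≤ (suc n) {ε} 0≤ε with shrink-≤ n 0≤ε
... | 0≤s , s≤ε = 0≤½s , ℚ.≤-trans ½s≤s s≤ε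
  where
  0≤½s : 0ℚ ℚ.≤ ½ ℚ.* shrink n ε
  0≤½s = subst (ℚ._≤ ½ ℚ.* shrink n ε) (ℚ.*-zeroʳ ½) (ℚ.*-monoˡ-≤-nonNeg ½ 0≤s)
  ½s≤s : ½ ℚ.* shrink n ε ℚ.≤ shrink n ε
  ½s≤s = ≤-by 0≤½s (trans (halves (shrink n ε)) (sym (ℚ.+-identityʳ (shrink n ε))))

·-half : ∀ n p → n · (½ ℚ.* p) ≡ ½ ℚ.* (n · p)
·-half zero    p = sym (ℚ.*-zeroʳ ½)
·-half (suc n) p = trans (cong (½ ℚ.* p ℚ.+_) (·-half n p)) (sym (ℚ.*-distribˡ-+ ½ p (n · p)))

·-shrink : ∀ n {ε} → 0ℚ ℚ.≤ ε → n · shrink n ε ℚ.≤ ε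
·-shrink zero    0≤ε = 0≤ε
·-shrink (suc n) {ε} 0≤ε = begin
  ½ ℚ.* s ℚ.+ n · (½ ℚ.* s)    ≡⟨ cong (½ ℚ.* s ℚ.+_) (·-half n s) ⟩
  ½ ℚ.* s ℚ.+ ½ ℚ.* (n · s)    ≤⟨ ℚ.+-mono-≤ (ℚ.*-monoˡ-≤-nonNeg ½ (proj₂ (shrink-≤ n 0≤ε)))
                                    (ℚ.*-monoˡ-≤-nonNeg ½ (·-shrink n 0≤ε)) ⟩
  ½ ℚ.* ε ℚ.+ ½ ℚ.* ε          ≡⟨ halves ε ⟩
  ε                            ∎
  where
  open ℚ.≤-Reasoning
  s = shrink n ε

·-mono-≤ : ∀ n {p q} → p ℚ.≤ q → n · p ℚ.≤ n · q
·-mono-≤ zero    p≤q = ℚ.≤-refl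
·-mono-≤ (suc n) p≤q = ℚ.+-mono-≤ p≤q (·-mono-≤ n p≤q)

·-mono-< : ∀ n {p q} → p ℚ.< q → suc n · p ℚ.< suc n · q
·-mono-< n p<q = ℚ.+-mono-<-≤ p<q (·-mono-≤ n (ℚ.<⇒≤ p<q))

·-/ : ∀ k j → k · (+ 1 ℚ./ suc j) ≡ + k ℚ./ suc j
·-/ zero    j = ℚ.≤-antisym (/-mono 0 0 0 j ℕ.z≤n) (/-mono 0 j 0 0 ℕ.z≤n)
·-/ (suc k) j = trans (cong (+ 1 ℚ./ suc j ℚ.+_) (·-/ k j))
  (trans (ℚ.+-comm (+ 1 ℚ./ suc j) (+ k ℚ./ suc j)) (sym (/-suc k j)))

·-* : ∀ n p q → (n · p) ℚ.* q ≡ n · (p ℚ.* q)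
·-* zero    p q = ℚ.*-zeroˡ q
·-* (suc n) p q = trans (ℚ.*-distribʳ-+ q p (n · p)) (cong (p ℚ.* q ℚ.+_) (·-* n p q))

archimedean-1 : ∀ ε → 0ℚ ℚ.< ε → ∃[ n ] 1ℚ ℚ.≤ suc n · ε
archimedean-1 ε 0<ε with archimedean ε 0<ε
... | N , 1/N<ε = N , (begin
  + 1 ℚ./ 1                   ≤⟨ /-mono 1 0 (suc N) N (ℕ.≤-reflexive (ℕ.*-comm 1 (suc N))) ⟩
  + suc N ℚ./ suc N           ≡⟨ ·-/ (suc N) N ⟨
  suc N · (+ 1 ℚ./ suc N)     ≤⟨ ·-mono-≤ (suc N) (ℚ.<⇒≤ 1/N<ε) ⟩
  suc N · ε                   ∎)
  where open ℚ.≤-Reasoning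

divide : ∀ {ε b} → 0ℚ ℚ.< ε → 0ℚ ℚ.< b → ∃[ δ ] 0ℚ ℚ.< δ × δ ℚ.* b ≡ ε
divide {ε} {b} 0<ε 0<b = ε ℚ.* 1/b , 0<ε/b , trans (ℚ.*-assoc ε 1/b b)
  (trans (cong (ε ℚ.*_) (ℚ.*-inverseˡ b)) (ℚ.*-identityʳ ε))
  where
  instance
    b-pos = ℚ.positive 0<b
    b≢0 = ℚ.pos⇒nonZero b
  1/b = ℚ.1/ b
  0<ε/b : 0ℚ ℚ.< ε ℚ.* 1/b
  0<ε/b = subst (ℚ._< ε ℚ.* 1/b) (ℚ.*-zeroˡ 1/b)
    (ℚ.*-monoˡ-<-pos 1/b {{ℚ.1/pos⇒pos b}} 0<ε)

archimedean-· : ∀ {ε b} → 0ℚ ℚ.< ε → 0ℚ ℚ.< b → ∃[ n ] b ℚ.≤ suc n · ε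
archimedean-· {ε} {b} 0<ε 0<b =
  let δ , 0<δ , δb≡ε = divide {ε} {b} 0<ε 0<b
      n , 1≤nδ = archimedean-1 δ 0<δ
  in n , bound δ δb≡ε n 1≤nδ
  where
  open ℚ.≤-Reasoning
  bound : ∀ δ → δ ℚ.* b ≡ ε → ∀ n → 1ℚ ℚ.≤ suc n · δ → b ℚ.≤ suc n · ε
  bound δ δb≡ε n 1≤nδ = begin
    b                      ≡⟨ ℚ.*-identityˡ b ⟨
    1ℚ ℚ.* b               ≤⟨ ℚ.*-monoʳ-≤-nonNeg b {{ℚ.nonNegative (ℚ.<⇒≤ 0<b)}} 1≤nδ ⟩
    (suc n · δ) ℚ.* b      ≡⟨ ·-* (suc n) δ b ⟩
    suc n · (δ ℚ.* b)      ≡⟨ cong (suc n ·_) δb≡ε ⟩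
    suc n · ε              ∎

shrink-small : ∀ {ε b} → 0ℚ ℚ.< ε → 0ℚ ℚ.< b → ∃[ n ] shrink n b ℚ.≤ ε
shrink-small {ε} {b} 0<ε 0<b =
  let n , b≤nε = archimedean-· {ε} {b} 0<ε 0<b in suc n , small n b≤nε
  where
  open ℚ.≤-Reasoning
  small : ∀ n → b ℚ.≤ suc n · ε → shrink (suc n) b ℚ.≤ ε
  small n b≤nε = ℚ.≮⇒≥ λ ε<s → ℚ.<-irrefl {b} refl (begin-strict
    b                             ≤⟨ b≤nε ⟩
    suc n · ε                     <⟨ ·-mono-< n {ε} {shrink (suc n) b} ε<s ⟩
    suc n · shrink (suc n) b      ≤⟨ ·-shrink (suc n) {b} (ℚ.<⇒≤ 0<b) ⟩
    b                             ∎)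

shrink-antitone : ∀ {b} → 0ℚ ℚ.≤ b → ∀ {m n} → m ℕ.≤ n → shrink n b ℚ.≤ shrink m b
shrink-antitone {b} 0≤b {m} {n} m≤n = go (ℕ.≤⇒≤′ m≤n)
  where
  go : ∀ {n} → m ℕ.≤′ n → shrink n b ℚ.≤ shrink m b
  go (ℕ.≤′-reflexive refl) = ℚ.≤-refl
  go (ℕ.≤′-step {n} m≤n) = ℚ.≤-trans {shrink (suc n) b} {shrink n b}
    (proj₂ (shrink-≤ 1 (proj₁ (shrink-≤ n 0≤b)))) (go m≤n)

common-bound : ∀ {ε δ} → 0ℚ ℚ.< ε → 0ℚ ℚ.< δ → ∃[ γ ] 0ℚ ℚ.< γ × γ ℚ.≤ ε × γ ℚ.≤ δ
common-bound {ε} {δ} 0<ε 0<δ with ℚ.≤-total ε δ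
... | inj₁ ε≤δ = ε , 0<ε , ℚ.≤-refl , ε≤δ
... | inj₂ δ≤ε = δ , 0<δ , δ≤ε , ℚ.≤-refl

abs-*-≤ : ∀ {p q r s} → ∣ p ∣ ℚ.≤ r → ∣ q ∣ ℚ.≤ s → ∣ p ℚ.* q ∣ ℚ.≤ r ℚ.* s
abs-*-≤ {p} {q} {r} {s} p≤r q≤s = begin
  ∣ p ℚ.* q ∣       ≡⟨ ℚ.∣p*q∣≡∣p∣*∣q∣ p q ⟩
  ∣ p ∣ ℚ.* ∣ q ∣   ≤⟨ ℚ.*-monoʳ-≤-nonNeg ∣ q ∣ {{ℚ.∣-∣-nonNeg q}} p≤r ⟩
  r ℚ.* ∣ q ∣       ≤⟨ ℚ.*-monoˡ-≤-nonNeg r {{ℚ.nonNegative (ℚ.≤-trans (ℚ.0≤∣p∣ p) p≤r)}} q≤s ⟩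
  r ℚ.* s           ∎
  where open ℚ.≤-Reasoning

-- Sums of rationals

infix 7 _when_
_when_ : ℚ → Bool → ℚ
p when b = if b then p else 0ℚ

subsum : ∀ {n} → (Fin n → Bool) → (Fin n → ℚ) → ℚ
subsum b v = ∑ λ i → v i when b i

when-∑ : ∀ {n} b (v : Fin n → ℚ) → ∑ v when b ≡ ∑ (λ i → v i when b)
when-∑ true  v = refl
when-∑ {n} false v = sym (sum-replicate-zero n)

∑-zero : ∀ {n} (v : Fin n → ℚ) → (∀ i → v i ≡ 0ℚ) → ∑ v ≡ 0ℚ
∑-zero {n} v eq = trans (sum-cong-≗ eq) (sum-replicate-zero n)

∑-- : ∀ {n} (v w : Fin n → ℚ) → ∑ (λ i → v i ℚ.- w i) ≡ ∑ v ℚ.- ∑ w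
∑-- {zero}  v w = refl
∑-- {suc n} v w = trans (cong (v zero ℚ.- w zero ℚ.+_) (∑-- (v ∘ suc) (w ∘ suc)))
  (sym (+-swap (v zero) (∑ (v ∘ suc)) (w zero) (∑ (w ∘ suc))))

∑-abs-≤ : ∀ {n} (v : Fin n → ℚ) ε → (∀ i → ∣ v i ∣ ℚ.≤ ε) → ∣ ∑ v ∣ ℚ.≤ n · ε
∑-abs-≤ {zero}  v ε le = ℚ.≤-refl
∑-abs-≤ {suc n} v ε le = ℚ.≤-trans (ℚ.∣p+q∣≤∣p∣+∣q∣ (v zero) (∑ (v ∘ suc)))
  (ℚ.+-mono-≤ (le zero) (∑-abs-≤ (v ∘ suc) ε (le ∘ suc)))

when-- : ∀ b p q → (p ℚ.- q) when b ≡ p when b ℚ.- q when b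
when-- true  p q = refl
when-- false p q = refl

subsum-≗ : ∀ {n} {b c : Fin n → Bool} {v w : Fin n → ℚ} → b ≗ c → v ≗ w → subsum b v ≡ subsum c w
subsum-≗ b≗c v≗w = sum-cong-≗ λ i → cong₂ _when_ (v≗w i) (b≗c i)

subsum-- : ∀ {n} b (v w : Fin n → ℚ) →
  subsum b (λ i → v i ℚ.- w i) ≡ subsum b v ℚ.- subsum b w
subsum-- b v w = trans (sum-cong-≗ λ i → when-- (b i) (v i) (w i))
  (∑-- (λ i → v i when b i) (λ i → w i when b i))

subsum-abs-≤ : ∀ {n} b (v w : Fin n → ℚ) ε → 0ℚ ℚ.≤ ε → (∀ i → ∣ v i ℚ.- w i ∣ ℚ.≤ ε) →
  ∣ subsum b v ℚ.- subsum b w ∣ ℚ.≤ n · ε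
subsum-abs-≤ {n} b v w ε 0≤ε le = subst (λ p → ∣ p ∣ ℚ.≤ n · ε) (subsum-- b v w)
  (∑-abs-≤ _ ε λ i → bound (b i) (le i))
  where
  bound : ∀ c {p} → ∣ p ∣ ℚ.≤ ε → ∣ p when c ∣ ℚ.≤ ε
  bound true  le = le
  bound false _  = 0≤ε

subsum-not : ∀ {n} b (v : Fin n → ℚ) → subsum b v ℚ.+ subsum (not ∘ b) v ≡ ∑ v
subsum-not b v = trans (sym (∑-distrib-+ (λ i → v i when b i) (λ i → v i when not (b i))))
  (sum-cong-≗ λ i → split (b i) (v i))
  where
  split : ∀ c p → p when c ℚ.+ p when not c ≡ p
  split true  p = ℚ.+-identityʳ p
  split false p = ℚ.+-identityˡ p

subsum-* : ∀ {n} b c (v : Fin n → ℚ) → subsum b (λ i → c ℚ.* v i) ≡ c ℚ.* subsum b v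
subsum-* b c v = trans (sum-cong-≗ λ i → when-* (b i) (v i))
  (sym (*-distribˡ-sum c (λ i → v i when b i)))
  where
  when-* : ∀ d p → (c ℚ.* p) when d ≡ c ℚ.* (p when d)
  when-* true  p = refl
  when-* false p = sym (ℚ.*-zeroʳ c)

subsum-+ : ∀ {n} b (v w : Fin n → ℚ) →
  subsum b (λ i → v i ℚ.+ w i) ≡ subsum b v ℚ.+ subsum b w
subsum-+ b v w = trans (sum-cong-≗ λ i → when-+ (b i) (v i) (w i))
  (∑-distrib-+ (λ i → v i when b i) (λ i → w i when b i))
  where
  when-+ : ∀ d p q → (p ℚ.+ q) when d ≡ p when d ℚ.+ q when d
  when-+ true  p q = refl
  when-+ false p q = refl

-- Filters: late indices, small balls, double negation

-- Three notions share these closure properties: `Eventually`, `Near x` and, over a one-point type,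
-- double negation. Each inherits conjunctions over all indices and over all subsets, which are
-- finite in number.
record IsFilter {X : Set} (F : (X → Set) → Set) : Set₁ where
  field
    always : ∀ {P} → (∀ x → P x) → F P
    zip    : ∀ {P Q R : X → Set} → (∀ x → P x → Q x → R x) → F P → F Q → F R

  map : ∀ {P Q : X → Set} → (∀ x → P x → Q x) → F P → F Q
  map f p = zip (λ x px _ → f x px) p p

  all-Fin : ∀ {n} {P : Fin n → X → Set} → (∀ i → F (P i)) → F (λ x → ∀ i → P i x)
  all-Fin {zero}  p = always λ _ ()
  all-Fin {suc n} p = zip (λ { x p₀ pₛ zero → p₀ ; x p₀ pₛ (suc i) → pₛ i })
    (p zero) (all-Fin (p ∘ suc))

  all-Subset : ∀ {n} {P : Subset n → X → Set} → (∀ S → F (P S)) → F (λ x → ∀ S → P S x)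
  all-Subset {zero}  p = map (λ { x p[] [] → p[] }) (p [])
  all-Subset {suc n} p =
    zip (λ { x pᵢ pₒ (true ∷ S) → pᵢ S ; x pᵢ pₒ (false ∷ S) → pₒ S })
      (all-Subset (p ∘ (true ∷_))) (all-Subset (p ∘ (false ∷_)))

Eventually : (ℕ → Set) → Set
Eventually P = ∃[ N ] ∀ k → N ℕ.≤ k → P k

eventually-isFilter : IsFilter Eventually
eventually-isFilter = record
  { always = λ p → 0 , λ k _ → p k
  ; zip    = λ f (M , p) (N , q) → M ⊔ N , λ k M⊔N≤k →
      f k (p k (ℕ.m⊔n≤o⇒m≤o M N M⊔N≤k)) (q k (ℕ.m⊔n≤o⇒n≤o M N M⊔N≤k))
  }

open IsFilter eventually-isFilter using ()
  renaming (always to ev-always; zip to ev-zip; map to ev-map; all-Fin to ev-all; all-Subset to ev-all-Subset)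

ev-× : ∀ {P Q} → Eventually P → Eventually Q → Eventually (λ k → P k × Q k)
ev-× = ev-zip λ _ → _,_

witness : ∀ {P} → Eventually P → ∃ P
witness (N , p) = N , p N ℕ.≤-refl

-- Sums of reals, index by index

slice : ∀ {n} → Point n → ℕ → Fin (suc n) → ℚ
slice x k i = seq (x i) k

seq-sum : ∀ {n} (v : Fin n → ℝ) k → seq (sum v) k ≡ ∑ (λ i → seq (v i) k)
seq-sum {zero}  v k = refl
seq-sum {suc n} v k = cong (seq (v zero) k ℚ.+_) (seq-sum (v ∘ suc) k)

seq-if : ∀ b x k → seq (if b then x else 0ℝ) k ≡ seq x k when b
seq-if true  x k = refl
seq-if false x k = refl

seq-sumOver : ∀ {n} S (x : Point n) k → seq (sumOver S x) k ≡ subsum (lookup S) (slice x k)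
seq-sumOver S x k = trans (seq-sum (λ i → if lookup S i then x i else 0ℝ) k) (sum-cong-≗ λ i → seq-if (lookup S i) (x i) k)

∉⇒false : ∀ {n} (S : Subset n) j → ¬ (j Subset.∈ S) → lookup S j ≡ false
∉⇒false S j j∉S with lookup S j in eq
... | true  = ⊥-elim (j∉S (Vec.lookup⇒[]= j S eq))
... | false = refl

p-0≡p : ∀ p → p ℚ.- 0ℚ ≡ p
p-0≡p = ℚ.+-identityʳ

-- Signs of subset sums and generic points

module _ {n : ℕ} where

  -- The equation of `V∅` holds only in the limit. At a single index the coordinates need not sum to
  -- 0, so every passage from a set to its complement costs an `ε`.
  V∅⇒small : (x : Point n) → x ∈ V∅ → ∀ ε → 0ℚ ℚ.< ε → Eventually λ k → ∣ ∑ (slice x k) ∣ ℚ.≤ ε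
  V∅⇒small x x∈V ε 0<ε = ev-map
    (λ k lt → ℚ.<⇒≤ (subst (λ p → ∣ p ∣ ℚ.< ε) (trans (p-0≡p (seq (sum x) k)) (seq-sum x k)) lt)) (x∈V ε 0<ε)

  zero⇒V∅ : (x : Point n) → (∀ k → ∑ (slice x k) ≡ 0ℚ) → x ∈ V∅
  zero⇒V∅ x eq ε 0<ε = ev-always λ k →
    subst (λ p → ∣ p ∣ ℚ.< ε) (sym (trans (p-0≡p (seq (sum x) k)) (trans (seq-sum x k) (eq k)))) 0<ε

  small⇒V∅ : (x : Point n) → (∀ ε → 0ℚ ℚ.< ε → Eventually λ k → ∣ ∑ (slice x k) ∣ ℚ.≤ ε) → x ∈ V∅
  small⇒V∅ x small ε 0<ε = ev-map
    (λ k le → subst (λ p → ∣ p ∣ ℚ.< ε) (sym (trans (p-0≡p (seq (sum x) k)) (seq-sum x k)))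
      (ℚ.≤-<-trans le (half-< 0<ε)))
    (small (½ ℚ.* ε) (half-pos 0<ε))

  -- This unfolds `0ℝ < sumOver S x`, with a Boolean function in place of `S`: complements and
  -- rotations of sets then become the compositions `not ∘ b` and `b ∘ unrotate a`.
  Positive : Point n → (Fin (suc n) → Bool) → Set
  Positive x b = ∃[ ε ] 0ℚ ℚ.< ε × Eventually λ k → ε ℚ.≤ subsum b (slice x k)

  Negative : Point n → (Fin (suc n) → Bool) → Set
  Negative x b = ∃[ ε ] 0ℚ ℚ.< ε × Eventually λ k → subsum b (slice x k) ℚ.+ ε ℚ.≤ 0ℚ

  positive-≗ : ∀ x {b c} → b ≗ c → Positive x b → Positive x c
  positive-≗ x b≗c (ε , 0<ε , p) = ε , 0<ε ,
    ev-map (λ k → subst (ε ℚ.≤_) (subsum-≗ {v = slice x k} b≗c λ _ → refl)) p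

  negative⇒positive-not : ∀ x b → x ∈ V∅ → Negative x b → Positive x (not ∘ b)
  negative⇒positive-not x b x∈V (ε , 0<ε , p) = ½ ℚ.* ε , half-pos 0<ε ,
    ev-zip step p (V∅⇒small x x∈V (½ ℚ.* ε) (half-pos 0<ε))
    where
    open +-*-Solver
    step : ∀ k → subsum b (slice x k) ℚ.+ ε ℚ.≤ 0ℚ → ∣ ∑ (slice x k) ∣ ℚ.≤ ½ ℚ.* ε →
      ½ ℚ.* ε ℚ.≤ subsum (not ∘ b) (slice x k)
    step k neg small = ≤-by (ℚ.+-mono-≤ neg (ℚ.≤-trans (-p≤∣p∣ (∑ (slice x k))) small))
      (trans (solve 3 (λ s t ε → con ½ :* ε :+ (con 0ℚ :+ con ½ :* ε)
                              := t :+ ((s :+ ε) :+ (:- (s :+ t))))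
                refl (subsum b (slice x k)) (subsum (not ∘ b) (slice x k)) ε)
             (cong (λ p → subsum (not ∘ b) (slice x k) ℚ.+ ((subsum b (slice x k) ℚ.+ ε) ℚ.- p))
               (subsum-not b (slice x k))))

  positive-not⇒negative : ∀ x b → x ∈ V∅ → Positive x (not ∘ b) → Negative x b
  positive-not⇒negative x b x∈V (ε , 0<ε , p) = ½ ℚ.* ε , half-pos 0<ε ,
    ev-zip step p (V∅⇒small x x∈V (½ ℚ.* ε) (half-pos 0<ε))
    where
    open +-*-Solver
    step : ∀ k → ε ℚ.≤ subsum (not ∘ b) (slice x k) → ∣ ∑ (slice x k) ∣ ℚ.≤ ½ ℚ.* ε →
      subsum b (slice x k) ℚ.+ ½ ℚ.* ε ℚ.≤ 0ℚ
    step k pos small = ≤-by (ℚ.+-mono-≤ pos (ℚ.≤-trans (p≤∣p∣ (∑ (slice x k))) small))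
      (trans (solve 3 (λ s t ε → (s :+ con ½ :* ε) :+ (t :+ con ½ :* ε)
                              := con 0ℚ :+ (ε :+ (s :+ t)))
                refl (subsum b (slice x k)) (subsum (not ∘ b) (slice x k)) ε)
             (cong (λ p → 0ℚ ℚ.+ (ε ℚ.+ p)) (subsum-not b (slice x k))))

  positive-negative : ∀ x b → Positive x b → Negative x b → ⊥
  positive-negative x b (ε , 0<ε , p) (δ , 0<δ , q) with witness (ev-zip (λ _ → _,_) p q)
  ... | k , ε≤s , s+δ≤0 = ℚ.<-irrefl {0ℚ} refl (begin-strict
    0ℚ                              ≡⟨ ℚ.+-identityˡ 0ℚ ⟨
    0ℚ ℚ.+ 0ℚ                       <⟨ ℚ.+-mono-< 0<ε 0<δ ⟩
    ε ℚ.+ δ                         ≤⟨ ℚ.+-monoˡ-≤ δ ε≤s ⟩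
    subsum b (slice x k) ℚ.+ δ      ≤⟨ s+δ≤0 ⟩
    0ℚ                              ∎)
    where open ℚ.≤-Reasoning

  positive-asym : ∀ x b → x ∈ V∅ → Positive x b → Positive x (not ∘ b) → ⊥
  positive-asym x b x∈V p q = positive-negative x b p (positive-not⇒negative x b x∈V q)

  -- The nonempty proper subsets, in a form symmetric under complement.
  Mixed : (Fin (suc n) → Bool) → Set
  Mixed b = (∃[ i ] b i ≡ true) × (∃[ j ] b j ≡ false)

  mixed-not : ∀ {b} → Mixed b → Mixed (not ∘ b)
  mixed-not ((i , bi) , (j , bj)) = (j , cong not bj) , (i , cong not bi)

  -- The complement of the arrangement, with a negative sum read as a positive sum over the
  -- complementary set, so that only positivity has to be transported between points.
  Generic : Point n → Set
  Generic x = x ∈ V∅ × (∀ b → Mixed b → Positive x b ⊎ Positive x (not ∘ b))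

  positive⇒0< : ∀ x S → Positive x (lookup S) → 0ℝ < sumOver S x
  positive⇒0< x S (ε , 0<ε , p) = ε , 0<ε , ev-map
    (λ k → subst₂ ℚ._≤_ (sym (ℚ.+-identityˡ ε)) (sym (seq-sumOver S x k))) p

  0<⇒positive : ∀ x S → 0ℝ < sumOver S x → Positive x (lookup S)
  0<⇒positive x S (ε , 0<ε , p) = ε , 0<ε , ev-map
    (λ k → subst₂ ℚ._≤_ (ℚ.+-identityˡ ε) (seq-sumOver S x k)) p

  negative⇒<0 : ∀ x S → Negative x (lookup S) → sumOver S x < 0ℝ
  negative⇒<0 x S (ε , 0<ε , p) = ε , 0<ε , ev-map
    (λ k → subst (λ s → s ℚ.+ ε ℚ.≤ 0ℚ) (sym (seq-sumOver S x k))) p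

  <0⇒negative : ∀ x S → sumOver S x < 0ℝ → Negative x (lookup S)
  <0⇒negative x S (ε , 0<ε , p) = ε , 0<ε , ev-map
    (λ k → subst (λ s → s ℚ.+ ε ℚ.≤ 0ℚ) (seq-sumOver S x k)) p

  complement⇒generic : ∀ x → ResonanceComplement x → Generic x
  complement⇒generic x (x∈V , apart) = x∈V , sign
    where
    sign : ∀ b → Mixed b → Positive x b ⊎ Positive x (not ∘ b)
    sign b ((i , bi) , (j , bj)) = [ neg , pos ]′ (apart S (i , i∈S) (Subset.⊆-max S , j , Subset.∈⊤ , j∉S))
      where
      S = tabulate b
      S≗b : lookup S ≗ b
      S≗b = Vec.lookup∘tabulate b
      i∈S = Vec.lookup⇒[]= i S (trans (S≗b i) bi)
      j∉S : ¬ (j Subset.∈ S)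
      j∉S j∈S with trans (sym (Vec.[]=⇒lookup j∈S)) (trans (S≗b j) bj)
      ... | ()
      neg : sumOver S x < 0ℝ → Positive x b ⊎ Positive x (not ∘ b)
      neg lt = inj₂ (positive-≗ x {not ∘ lookup S} {not ∘ b} (cong not ∘ S≗b)
        (negative⇒positive-not x (lookup S) x∈V (<0⇒negative x S lt)))
      pos : 0ℝ < sumOver S x → Positive x b ⊎ Positive x (not ∘ b)
      pos lt = inj₁ (positive-≗ x {lookup S} {b} S≗b (0<⇒positive x S lt))

  generic⇒complement : ∀ x → Generic x → ResonanceComplement x
  generic⇒complement x (x∈V , sign) = x∈V , apart
    where
    decide : ∀ S → Positive x (lookup S) ⊎ Positive x (not ∘ lookup S) → sumOver S x # 0ℝ
    decide S (inj₁ p) = inj₂ (positive⇒0< x S p)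
    decide S (inj₂ p) = inj₁ (negative⇒<0 x S (positive-not⇒negative x (lookup S) x∈V p))
    apart : ∀ S → Subset.Nonempty S → S Subset.⊂ Subset.⊤ → sumOver S x # 0ℝ
    apart S (i , i∈S) (_ , j , _ , j∉S) =
      decide S (sign (lookup S) ((i , Vec.[]=⇒lookup i∈S) , (j , ∉⇒false S j j∉S)))

-- Neighbourhoods

module _ {n : ℕ} where

  Near : Point n → (Point n → Set) → Set
  Near x P = ∃[ ε ] 0ℚ ℚ.< ε × (∀ y → y ∈ Ball ε x → P y)

  Ball-mono : ∀ {ε δ} x {y : Point n} → ε ℚ.≤ δ → y ∈ Ball ε x → y ∈ Ball δ x
  Ball-mono {ε} {δ} x {y} ε≤δ y∈ i with y∈ i
  ... | (α , 0<α , p) , (β , 0<β , q) =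
    (α , 0<α , ev-map (λ k → ℚ.≤-trans (ℚ.+-monoˡ-≤ α
                 (ℚ.+-monoʳ-≤ (seq (x i) k) (ℚ.neg-antimono-≤ ε≤δ)))) p) ,
    (β , 0<β , ev-map (λ k le → ℚ.≤-trans le (ℚ.+-monoʳ-≤ (seq (x i) k) ε≤δ)) q)

  near-isFilter : ∀ x → IsFilter (Near x)
  near-isFilter x = record
    { always = λ p → 1ℚ , ℚ.positive⁻¹ 1ℚ , λ y _ → p y
    ; zip    = λ f (ε , 0<ε , p) (δ , 0<δ , q) →
        let γ , 0<γ , γ≤ε , γ≤δ = common-bound 0<ε 0<δ in
        γ , 0<γ , λ y y∈ → f y (p y (Ball-mono x {y} γ≤ε y∈)) (q y (Ball-mono x {y} γ≤δ y∈))
    }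

  Ball⇒close : ∀ {ε} x {y : Point n} → y ∈ Ball ε x →
    Eventually λ k → ∀ i → ∣ slice y k i ℚ.- slice x k i ∣ ℚ.≤ ε
  Ball⇒close {ε} x {y} y∈ = ev-all λ i → close i (y∈ i)
    where
    open +-*-Solver
    close : ∀ i → (x i - fromℚ ε < y i) × (y i < x i + fromℚ ε) →
      Eventually λ k → ∣ slice y k i ℚ.- slice x k i ∣ ℚ.≤ ε
    close i ((α , 0<α , p) , (β , 0<β , q)) = ev-zip (λ k lo hi → abs-≤
      (≤-by (ℚ.+-mono-≤ (ℚ.<⇒≤ 0<β) hi)
        (solve 4 (λ x y β ε → (y :- x) :+ (β :+ (x :+ ε)) := ε :+ (con 0ℚ :+ (y :+ β)))
          refl (seq (x i) k) (seq (y i) k) β ε))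
      (≤-by (ℚ.+-mono-≤ (ℚ.<⇒≤ 0<α) lo)
        (solve 4 (λ x y α ε → (:- (y :- x)) :+ (α :+ y) := ε :+ (con 0ℚ :+ ((x :- ε) :+ α)))
          refl (seq (x i) k) (seq (y i) k) α ε)))
      p q

  close⇒Ball : ∀ {δ ε} x (y : Point n) → δ ℚ.< ε →
    (∀ i → Eventually λ k → ∣ slice y k i ℚ.- slice x k i ∣ ℚ.≤ δ) → y ∈ Ball ε x
  close⇒Ball {δ} {ε} x y δ<ε close i =
    (ε ℚ.- δ , 0<ε-δ , ev-map lower (close i)) ,
    (ε ℚ.- δ , 0<ε-δ , ev-map upper (close i))
    where
    open +-*-Solver
    0<ε-δ : 0ℚ ℚ.< ε ℚ.- δ
    0<ε-δ = <-by δ<ε (solve 2 (λ δ ε → con 0ℚ :+ ε := (ε :- δ) :+ δ) refl δ ε)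
    lower : ∀ k → ∣ slice y k i ℚ.- slice x k i ∣ ℚ.≤ δ →
      (seq (x i) k ℚ.- ε) ℚ.+ (ε ℚ.- δ) ℚ.≤ seq (y i) k
    lower k le = ≤-by (ℚ.≤-trans (-p≤∣p∣ (slice y k i ℚ.- slice x k i)) le)
      (solve 4 (λ x y δ ε → ((x :- ε) :+ (ε :- δ)) :+ δ := y :+ (:- (y :- x)))
        refl (seq (x i) k) (seq (y i) k) δ ε)
    upper : ∀ k → ∣ slice y k i ℚ.- slice x k i ∣ ℚ.≤ δ →
      seq (y i) k ℚ.+ (ε ℚ.- δ) ℚ.≤ seq (x i) k ℚ.+ ε
    upper k le = ≤-by (ℚ.≤-trans (p≤∣p∣ (slice y k i ℚ.- slice x k i)) le)
      (solve 4 (λ x y δ ε → (y :+ (ε :- δ)) :+ δ := (x :+ ε) :+ (y :- x))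
        refl (seq (x i) k) (seq (y i) k) δ ε)

  positive-near : ∀ x b → Positive x b → Near x λ y → Positive y b
  positive-near x b (ε , 0<ε , p) = θ , shrink-pos (suc n) (half-pos 0<ε) ,
    λ y y∈ → ½ ℚ.* ε , half-pos 0<ε , ev-zip (step y) p (Ball⇒close x {y} y∈)
    where
    open +-*-Solver
    -- Moving each of the n + 1 coordinates by at most `θ` changes a subset sum by at most ½ ε.
    θ = shrink (suc n) (½ ℚ.* ε)
    step : ∀ (y : Point n) k → ε ℚ.≤ subsum b (slice x k) →
      (∀ i → ∣ slice y k i ℚ.- slice x k i ∣ ℚ.≤ θ) → ½ ℚ.* ε ℚ.≤ subsum b (slice y k)
    step y k ε≤ close = ≤-by (ℚ.+-mono-≤ ε≤ (ℚ.≤-trans (-p≤∣p∣ (s ℚ.- r)) (ℚ.≤-trans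
        (subsum-abs-≤ b (slice y k) (slice x k) θ (ℚ.<⇒≤ (shrink-pos (suc n) (half-pos 0<ε))) close)
        (·-shrink (suc n) {½ ℚ.* ε} (ℚ.<⇒≤ (half-pos 0<ε))))))
      (solve 3 (λ s r ε → con ½ :* ε :+ (r :+ con ½ :* ε) := s :+ (ε :+ (:- (s :- r)))) refl s r ε)
      where
      s = subsum b (slice y k)
      r = subsum b (slice x k)

  infix 4 _≼_
  -- For generic `x` and `y` in `V∅` this is equality of chambers, in spite of the one-sided form: a
  -- negative sum of `x` is a positive one over the complement, so all signs of `y` are fixed.
  _≼_ : Point n → Point n → Set
  x ≼ y = ∀ b → Mixed b → Positive x b → Positive y b

  mixed? : (b : Fin (suc n) → Bool) → Dec (Mixed b)
  mixed? b = Fin.any? (λ i → b i Bool.≟ true) ×-dec Fin.any? (λ i → b i Bool.≟ false)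

  ≼-near : ∀ x → Generic x → Near x (x ≼_)
  ≼-near x (x∈V , sign) = map extend (all-Subset λ S → near (lookup S) (mixed? (lookup S)))
    where
    open IsFilter (near-isFilter x)
    Q : (Fin (suc n) → Bool) → Point n → Set
    Q b y = Mixed b → Positive x b → Positive y b
    near′ : ∀ b → Positive x b ⊎ Positive x (not ∘ b) → Near x (Q b)
    near′ b (inj₁ p) = map {λ y → Positive y b} {Q b} (λ _ q _ _ → q) (positive-near x b p)
    near′ b (inj₂ q) = always {Q b} λ _ _ p → ⊥-elim (positive-asym x b x∈V p q)
    near : ∀ b → Dec (Mixed b) → Near x (Q b)
    near b (yes m) = near′ b (sign b m)
    near b (no ¬m) = always {Q b} λ _ m → ⊥-elim (¬m m)
    -- The filter runs through all values of `Subset`; Boolean functions are finite in number only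
    -- up to `_≗_`, hence the detour through `tabulate`.
    extend : ∀ y → (∀ S → Q (lookup S) y) → x ≼ y
    extend y q b ((i , bi) , (j , bj)) p = positive-≗ y {lookup S} {b} S≗b
      (q S ((i , trans (S≗b i) bi) , (j , trans (S≗b j) bj))
        (positive-≗ x {b} {lookup S} (sym ∘ S≗b) p))
      where
      S = tabulate b
      S≗b : lookup S ≗ b
      S≗b = Vec.lookup∘tabulate b

  -- The points where `b` has a positive sum and those where its complement has one form two open
  -- sets, disjoint within `V∅`, that cover the complement of the arrangement. A connected set
  -- cannot meet both.
  component⇒≼ : ∀ x y → InSameComponent ResonanceComplement x y → x ≼ y
  component⇒≼ x y (C , C⊆ , connected , x∈C , y∈C) b mixed p =
    decide (proj₂ (generic y y∈C) b mixed)
    where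
    generic : ∀ z → z ∈ C → Generic z
    generic z z∈C = complement⇒generic z (C⊆ z∈C)
    isOpen : ∀ c → IsOpen (λ z → Positive z c)
    isOpen c z z∈V p =
      let ε , 0<ε , near = positive-near z c p in z∈V , ε , 0<ε , λ w _ → near w
    decide : Positive y b ⊎ Positive y (not ∘ b) → Positive y b
    decide (inj₁ q) = q
    decide (inj₂ q) = ⊥-elim (absurd (connected (λ z → Positive z b) (λ z → Positive z (not ∘ b))
      (isOpen b) (isOpen (not ∘ b)) (λ {z} z∈C → proj₂ (generic z z∈C) b mixed)
      (x , x∈C , p) (y , y∈C , q)))
      where
      absurd : ¬ (∃[ z ] z ∈ C × (Positive z b × Positive z (not ∘ b)))
      absurd (z , z∈C , p , q) = positive-asym z b (proj₁ (generic z z∈C)) p q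

-- Products of reals and segments

bounded : ∀ s → IsCauchy s → ∃[ b ] 0ℚ ℚ.< b × Eventually λ k → ∣ s k ∣ ℚ.≤ b
bounded s c with c 1ℚ (ℚ.positive⁻¹ 1ℚ)
... | N , close = ∣ s N ∣ ℚ.+ 1ℚ ,
  ℚ.+-mono-≤-< (ℚ.0≤∣p∣ (s N)) (ℚ.positive⁻¹ 1ℚ) ,
  N , λ k N≤k → bound k (close k N N≤k ℕ.≤-refl)
  where
  open ℚ.≤-Reasoning
  open +-*-Solver
  bound : ∀ k → ∣ s k ℚ.- s N ∣ ℚ.< 1ℚ → ∣ s k ∣ ℚ.≤ ∣ s N ∣ ℚ.+ 1ℚ
  bound k lt = begin
    ∣ s k ∣                        ≡⟨ cong ∣_∣ (solve 2 (λ a b → a := b :+ (a :- b)) refl (s k) (s N)) ⟩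
    ∣ s N ℚ.+ (s k ℚ.- s N) ∣      ≤⟨ ℚ.∣p+q∣≤∣p∣+∣q∣ (s N) (s k ℚ.- s N) ⟩
    ∣ s N ∣ ℚ.+ ∣ s k ℚ.- s N ∣    ≤⟨ ℚ.+-monoʳ-≤ ∣ s N ∣ (ℚ.<⇒≤ lt) ⟩
    ∣ s N ∣ ℚ.+ 1ℚ                 ∎

*-cauchy : ∀ s t → IsCauchy s → IsCauchy t → IsCauchy (λ k → s k ℚ.* t k)
*-cauchy s t s-cauchy t-cauchy ε 0<ε =
  let b , 0<b , K , s≤b = bounded s s-cauchy
      c , 0<c , L , t≤c = bounded t t-cauchy
      δ , 0<δ , δb≡ = divide {½ ℚ.* ε} {b} (half-pos 0<ε) 0<b
      γ , 0<γ , γc≡ = divide {½ ℚ.* ε} {c} (half-pos 0<ε) 0<c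
      β , 0<β , β≤δ , β≤γ = common-bound {½ ℚ.* δ} {½ ℚ.* γ} (half-pos 0<δ) (half-pos 0<γ)
      M , p = s-cauchy γ 0<γ
      -- The estimates of the two products are weak inequalities; the spare factor ½ makes the final
      -- one strict.
      N , q = t-cauchy (½ ℚ.* δ) (half-pos 0<δ)
      threshold = (K ⊔ L) ⊔ (M ⊔ N)
      ≥K : ∀ {k} → threshold ℕ.≤ k → K ℕ.≤ k
      ≥K le = ℕ.m⊔n≤o⇒m≤o K L (ℕ.m⊔n≤o⇒m≤o (K ⊔ L) (M ⊔ N) le)
      ≥L : ∀ {k} → threshold ℕ.≤ k → L ℕ.≤ k
      ≥L le = ℕ.m⊔n≤o⇒n≤o K L (ℕ.m⊔n≤o⇒m≤o (K ⊔ L) (M ⊔ N) le)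
      ≥M : ∀ {k} → threshold ℕ.≤ k → M ℕ.≤ k
      ≥M le = ℕ.m⊔n≤o⇒m≤o M N (ℕ.m⊔n≤o⇒n≤o (K ⊔ L) (M ⊔ N) le)
      ≥N : ∀ {k} → threshold ℕ.≤ k → N ℕ.≤ k
      ≥N le = ℕ.m⊔n≤o⇒n≤o M N (ℕ.m⊔n≤o⇒n≤o (K ⊔ L) (M ⊔ N) le)
  in threshold , λ i j ≤i ≤j →
    step i j b c δ γ δb≡ γc≡ 0<b 0<δ (s≤b i (≥K ≤i)) (t≤c j (≥L ≤j))
      (p i j (≥M ≤i) (≥M ≤j)) (q i j (≥N ≤i) (≥N ≤j))
  where
  open ℚ.≤-Reasoning
  open +-*-Solver
  step : ∀ i j b c δ γ → δ ℚ.* b ≡ ½ ℚ.* ε → γ ℚ.* c ≡ ½ ℚ.* ε → 0ℚ ℚ.< b → 0ℚ ℚ.< δ →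
    ∣ s i ∣ ℚ.≤ b → ∣ t j ∣ ℚ.≤ c → ∣ s i ℚ.- s j ∣ ℚ.< γ → ∣ t i ℚ.- t j ∣ ℚ.< ½ ℚ.* δ →
    ∣ s i ℚ.* t i ℚ.- s j ℚ.* t j ∣ ℚ.< ε
  step i j b c δ γ δb≡ γc≡ 0<b 0<δ s≤b t≤c Δs Δt = begin-strict
    ∣ s i ℚ.* t i ℚ.- s j ℚ.* t j ∣
      ≡⟨ cong ∣_∣ (solve 4 (λ a b c d → a :* c :- b :* d := (c :- d) :* a :+ (a :- b) :* d)
           refl (s i) (s j) (t i) (t j)) ⟩
    ∣ (t i ℚ.- t j) ℚ.* s i ℚ.+ (s i ℚ.- s j) ℚ.* t j ∣
      ≤⟨ ℚ.∣p+q∣≤∣p∣+∣q∣ ((t i ℚ.- t j) ℚ.* s i) ((s i ℚ.- s j) ℚ.* t j) ⟩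
    ∣ (t i ℚ.- t j) ℚ.* s i ∣ ℚ.+ ∣ (s i ℚ.- s j) ℚ.* t j ∣
      ≤⟨ ℚ.+-mono-≤ (abs-*-≤ (ℚ.<⇒≤ Δt) s≤b) (abs-*-≤ (ℚ.<⇒≤ Δs) t≤c) ⟩
    (½ ℚ.* δ) ℚ.* b ℚ.+ γ ℚ.* c
      <⟨ ℚ.+-monoˡ-< (γ ℚ.* c) (ℚ.*-monoˡ-<-pos b {{ℚ.positive 0<b}} (half-< 0<δ)) ⟩
    δ ℚ.* b ℚ.+ γ ℚ.* c
      ≡⟨ cong₂ ℚ._+_ δb≡ γc≡ ⟩
    ½ ℚ.* ε ℚ.+ ½ ℚ.* ε
      ≡⟨ halves ε ⟩
    ε ∎

infixl 7 _*_
_*_ : ℝ → ℝ → ℝ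
x * y = mkℝ (λ k → seq x k ℚ.* seq y k) (*-cauchy (seq x) (seq y) (cauchy x) (cauchy y))

InUnit : ℚ → Set
InUnit q = (0ℚ ℚ.≤ q) × (q ℚ.≤ 1ℚ)

-- A limit of bisection points may satisfy neither predicate. What survives in the limit is that it
-- is approached by rational parameters in [0, 1] that satisfy `P`.
Adherent : (ℚ → Set) → ℝ → Set
Adherent P t = ∀ δ → 0ℚ ℚ.< δ → ∃[ q ] InUnit q × P q × Eventually λ k → ∣ q ℚ.- seq t k ∣ ℚ.≤ δ

0≤-convex : ∀ t {p q} → 0ℚ ℚ.≤ t → t ℚ.≤ 1ℚ → 0ℚ ℚ.≤ p → 0ℚ ℚ.≤ q →
  0ℚ ℚ.≤ p ℚ.+ t ℚ.* (q ℚ.- p)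
0≤-convex t {p} {q} 0≤t t≤1 0≤p 0≤q = begin
  0ℚ                                  ≤⟨ ℚ.+-mono-≤ 0≤[1-t]p 0≤tq ⟩
  (1ℚ ℚ.- t) ℚ.* p ℚ.+ t ℚ.* q        ≡⟨ solve 3 (λ t p q → (con 1ℚ :- t) :* p :+ t :* q
                                              := p :+ t :* (q :- p)) refl t p q ⟩
  p ℚ.+ t ℚ.* (q ℚ.- p)               ∎
  where
  open ℚ.≤-Reasoning
  open +-*-Solver
  0≤1-t : 0ℚ ℚ.≤ 1ℚ ℚ.- t
  0≤1-t = ≤-by t≤1 (solve 1 (λ t → con 0ℚ :+ con 1ℚ := (con 1ℚ :- t) :+ t) refl t)
  0≤[1-t]p : 0ℚ ℚ.≤ (1ℚ ℚ.- t) ℚ.* p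
  0≤[1-t]p = subst (ℚ._≤ (1ℚ ℚ.- t) ℚ.* p) (ℚ.*-zeroʳ (1ℚ ℚ.- t))
    (ℚ.*-monoˡ-≤-nonNeg (1ℚ ℚ.- t) {{ℚ.nonNegative 0≤1-t}} 0≤p)
  0≤tq : 0ℚ ℚ.≤ t ℚ.* q
  0≤tq = subst (ℚ._≤ t ℚ.* q) (ℚ.*-zeroʳ t) (ℚ.*-monoˡ-≤-nonNeg t {{ℚ.nonNegative 0≤t}} 0≤q)

≤-convex : ∀ t {ε p q} → 0ℚ ℚ.≤ t → t ℚ.≤ 1ℚ → ε ℚ.≤ p → ε ℚ.≤ q →
  ε ℚ.≤ p ℚ.+ t ℚ.* (q ℚ.- p)
≤-convex t {ε} {p} {q} 0≤t t≤1 ε≤p ε≤q = ≤-by (0≤-convex t 0≤t t≤1 (0≤- ε≤p) (0≤- ε≤q))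
  (solve 4 (λ ε p q t → ε :+ ((p :- ε) :+ t :* ((q :- ε) :- (p :- ε)))
                     := (p :+ t :* (q :- p)) :+ con 0ℚ) refl ε p q t)
  where
  open +-*-Solver
  0≤- : ∀ {r} → ε ℚ.≤ r → 0ℚ ℚ.≤ r ℚ.- ε
  0≤- {r} le = ≤-by le (solve 2 (λ ε r → con 0ℚ :+ r := (r :- ε) :+ ε) refl ε r)

abs-convex : ∀ t {ε p q} → 0ℚ ℚ.≤ t → t ℚ.≤ 1ℚ → ∣ p ∣ ℚ.≤ ε → ∣ q ∣ ℚ.≤ ε →
  ∣ p ℚ.+ t ℚ.* (q ℚ.- p) ∣ ℚ.≤ ε
abs-convex t {ε} {p} {q} 0≤t t≤1 p≤ε q≤ε = abs-≤
  (≤-by (≤-convex t 0≤t t≤1 (-ε≤- p≤ε) (-ε≤- q≤ε))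
    (solve 4 (λ ε p q t → (p :+ t :* (q :- p)) :+ ((:- p) :+ t :* ((:- q) :- (:- p)))
                       := ε :+ (:- ε)) refl ε p q t))
  (≤-by (≤-convex t 0≤t t≤1 (-ε≤ p≤ε) (-ε≤ q≤ε))
    (solve 4 (λ ε p q t → (:- (p :+ t :* (q :- p))) :+ (p :+ t :* (q :- p)) := ε :+ (:- ε))
      refl ε p q t))
  where
  open +-*-Solver
  -ε≤- : ∀ {r} → ∣ r ∣ ℚ.≤ ε → ℚ.- ε ℚ.≤ ℚ.- r
  -ε≤- {r} le = ℚ.neg-antimono-≤ (ℚ.≤-trans (p≤∣p∣ r) le)
  -ε≤ : ∀ {r} → ∣ r ∣ ℚ.≤ ε → ℚ.- ε ℚ.≤ r
  -ε≤ {r} le = ≤-by (ℚ.≤-trans (-p≤∣p∣ r) le)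
    (solve 2 (λ ε r → (:- ε) :+ ε := r :+ (:- r)) refl ε r)

module _ {n : ℕ} where

  mix : ℝ → Point n → Point n → Point n
  mix t u w i = u i + t * (w i - u i)

  subsum-mix : ∀ b t (u w : Point n) k → subsum b (slice (mix t u w) k) ≡
    subsum b (slice u k) ℚ.+ seq t k ℚ.* (subsum b (slice w k) ℚ.- subsum b (slice u k))
  subsum-mix b t u w k =
    trans (subsum-+ b (slice u k) (λ i → seq t k ℚ.* (slice w k i ℚ.- slice u k i)))
      (cong (subsum b (slice u k) ℚ.+_)
        (trans (subsum-* b (seq t k) (λ i → slice w k i ℚ.- slice u k i))
          (cong (seq t k ℚ.*_) (subsum-- b (slice w k) (slice u k)))))

  mix-V∅ : ∀ t u w → (∀ k → InUnit (seq t k)) → u ∈ V∅ → w ∈ V∅ → mix t u w ∈ V∅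
  mix-V∅ t u w unit u∈V w∈V = small⇒V∅ (mix t u w) λ ε 0<ε → ev-zip
    (λ k p q → subst (λ r → ∣ r ∣ ℚ.≤ ε) (sym (subsum-mix (λ _ → true) t u w k))
      (abs-convex (seq t k) (proj₁ (unit k)) (proj₂ (unit k)) p q))
    (V∅⇒small u u∈V ε 0<ε) (V∅⇒small w w∈V ε 0<ε)

  mix-positive : ∀ t u w b → (∀ k → InUnit (seq t k)) → Positive u b → Positive w b → Positive (mix t u w) b
  mix-positive t u w b unit (ε , 0<ε , p) (δ , 0<δ , q) =
    let γ , 0<γ , γ≤ε , γ≤δ = common-bound {ε} {δ} 0<ε 0<δ in γ , 0<γ , ev-zip
      (λ k ε≤ δ≤ → subst (γ ℚ.≤_) (sym (subsum-mix b t u w k))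
        (≤-convex (seq t k) (proj₁ (unit k)) (proj₂ (unit k))
          (ℚ.≤-trans γ≤ε ε≤) (ℚ.≤-trans γ≤δ δ≤)))
      p q

  -- The parameter is a real all of whose terms lie in [0, 1]. Bisection delivers such parameters,
  -- and with them convexity can be checked index by index.
  Convex : Pred (Point n) 0ℓ → Set
  Convex C = ∀ t u w → (∀ k → InUnit (seq t k)) → u ∈ C → w ∈ C → mix t u w ∈ C

  -- A predicate on representatives need not respect equality, but an open one does, since every
  -- ball around `x` contains `y`. This moves membership to the two ends of a segment, which equal
  -- its endpoints only up to ring identities.
  open-≗ : ∀ (U : Pred (Point n) 0ℓ) x y → IsOpen U → x ∈ V∅ → y ∈ V∅ →
    (∀ k → slice y k ≗ slice x k) → x ∈ U → y ∈ U
  open-≗ U x y open-U x∈V y∈V y≗x x∈U =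
    let _ , ε , 0<ε , near = open-U x x∈V x∈U in
    near y y∈V (close⇒Ball {n} {0ℚ} {ε} x y 0<ε λ i → ev-always λ k → close k i)
    where
    close : ∀ k i → ∣ slice y k i ℚ.- slice x k i ∣ ℚ.≤ 0ℚ
    close k i = ℚ.≤-reflexive (cong ∣_∣ (trans (cong (ℚ._- slice x k i) (y≗x k i))
      (ℚ.+-inverseʳ (slice x k i))))

-- Bisection and the connectedness of convex sets

module Bisection (P Q : ℚ → Set) (P0 : P 0ℚ) (Q1 : Q 1ℚ)
  (cover : ∀ q → InUnit q → P q ⊎ Q q) where

  open +-*-Solver

  size : ℕ → ℚ
  size k = shrink k 1ℚ

  0<size : ∀ k → 0ℚ ℚ.< size k
  0<size k = shrink-pos k (ℚ.positive⁻¹ 1ℚ)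

  record Bracket (k : ℕ) : Set where
    field
      lo    : ℚ
      0≤lo  : 0ℚ ℚ.≤ lo
      hi≤1  : lo ℚ.+ size k ℚ.≤ 1ℚ
      P-lo  : P lo
      Q-hi  : Q (lo ℚ.+ size k)

  open Bracket

  start : Bracket 0
  start = record
    { lo   = 0ℚ
    ; 0≤lo = ℚ.≤-refl
    ; hi≤1 = ℚ.≤-reflexive (ℚ.+-identityˡ 1ℚ)
    ; P-lo = P0
    ; Q-hi = subst Q (sym (ℚ.+-identityˡ 1ℚ)) Q1
    }

  record Step {k} (B : Bracket k) : Set where
    field
      next   : Bracket (suc k)
      lo≤lo  : lo B ℚ.≤ lo next
      hi≤hi  : lo next ℚ.+ size (suc k) ℚ.≤ lo B ℚ.+ size k

  open Step

  bisect : ∀ {k} (B : Bracket k) → Step B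
  bisect {k} B = choose (cover mid (0≤mid , mid≤1))
    where
    mid = lo B ℚ.+ size (suc k)
    mid+ : mid ℚ.+ size (suc k) ≡ lo B ℚ.+ size k
    mid+ = trans (ℚ.+-assoc (lo B) (size (suc k)) (size (suc k)))
      (cong (lo B ℚ.+_) (halves (size k)))
    lo≤mid : lo B ℚ.≤ mid
    lo≤mid = ≤-by (ℚ.<⇒≤ (0<size (suc k)))
      (solve 2 (λ l s → l :+ s := (l :+ s) :+ con 0ℚ) refl (lo B) (size (suc k)))
    mid≤hi : mid ℚ.≤ lo B ℚ.+ size k
    mid≤hi = ℚ.+-monoʳ-≤ (lo B) (ℚ.<⇒≤ (half-< (0<size k)))
    0≤mid = ℚ.≤-trans (0≤lo B) lo≤mid
    mid≤1 = ℚ.≤-trans mid≤hi (hi≤1 B)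
    choose : P mid ⊎ Q mid → Step B
    choose (inj₁ P-mid) = record
      { next  = record
        { lo   = mid
        ; 0≤lo = 0≤mid
        ; hi≤1 = subst (ℚ._≤ 1ℚ) (sym mid+) (hi≤1 B)
        ; P-lo = P-mid
        ; Q-hi = subst Q (sym mid+) (Q-hi B)
        }
      ; lo≤lo = lo≤mid
      ; hi≤hi = ℚ.≤-reflexive mid+
      }
    choose (inj₂ Q-mid) = record
      { next  = record
        { lo   = lo B
        ; 0≤lo = 0≤lo B
        ; hi≤1 = mid≤1
        ; P-lo = P-lo B
        ; Q-hi = Q-mid
        }
      ; lo≤lo = ℚ.≤-refl
      ; hi≤hi = mid≤hi
      }

  bracket : ∀ k → Bracket k
  bracket zero    = start
  bracket (suc k) = next (bisect (bracket k))

  lo[_] : ℕ → ℚ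
  lo[ k ] = lo (bracket k)

  nested : ∀ {k m} → k ℕ.≤′ m →
    lo[ k ] ℚ.≤ lo[ m ] × lo[ m ] ℚ.+ size m ℚ.≤ lo[ k ] ℚ.+ size k
  nested (ℕ.≤′-reflexive refl) = ℚ.≤-refl , ℚ.≤-refl
  nested (ℕ.≤′-step {m} k≤m) =
    let p , q = nested k≤m ; s = bisect (bracket m) in
    ℚ.≤-trans p (lo≤lo s) , ℚ.≤-trans (hi≤hi s) q

  lo-close : ∀ {k m} → k ℕ.≤ m → lo[ k ] ℚ.≤ lo[ m ] × lo[ m ] ℚ.≤ lo[ k ] ℚ.+ size k
  lo-close {k} {m} k≤m = let p , q = nested (ℕ.≤⇒≤′ k≤m) in p , ≤-by
    (ℚ.+-mono-≤ q (ℚ.<⇒≤ (0<size m)))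
    (solve 4 (λ l m s r → m :+ ((l :+ s) :+ r) := (l :+ s) :+ ((m :+ r) :+ con 0ℚ))
      refl lo[ k ] lo[ m ] (size k) (size m))

  lo-cauchy : IsCauchy lo[_]
  lo-cauchy ε 0<ε =
    let N , small = shrink-small {½ ℚ.* ε} {1ℚ} (half-pos 0<ε) (ℚ.positive⁻¹ 1ℚ) in
    N , λ i j N≤i N≤j → ℚ.≤-<-trans (ℚ.≤-trans
      (step N lo[ i ] lo[ j ] (lo-close N≤i) (lo-close N≤j)) small) (half-< 0<ε)
    where
    step : ∀ N p q → lo[ N ] ℚ.≤ p × p ℚ.≤ lo[ N ] ℚ.+ size N →
      lo[ N ] ℚ.≤ q × q ℚ.≤ lo[ N ] ℚ.+ size N → ∣ p ℚ.- q ∣ ℚ.≤ size N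
    step N p q (l≤p , p≤h) (l≤q , q≤h) = abs-≤
      (≤-by (ℚ.+-mono-≤ l≤q p≤h) (solve 4 (λ p q l s → (p :- q) :+ (q :+ (l :+ s))
        := s :+ (l :+ p)) refl p q lo[ N ] (size N)))
      (≤-by (ℚ.+-mono-≤ l≤p q≤h) (solve 4 (λ p q l s → (:- (p :- q)) :+ (p :+ (l :+ s))
        := s :+ (l :+ q)) refl p q lo[ N ] (size N)))

  limit : ℝ
  limit = mkℝ lo[_] lo-cauchy

  lo≤1 : ∀ k → lo[ k ] ℚ.≤ 1ℚ
  lo≤1 k = ℚ.≤-trans
    (≤-by (ℚ.<⇒≤ (0<size k)) (solve 2 (λ l s → l :+ s := (l :+ s) :+ con 0ℚ) refl lo[ k ] (size k)))
    (hi≤1 (bracket k))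

  lo-unit : ∀ k → InUnit lo[ k ]
  lo-unit k = 0≤lo (bracket k) , lo≤1 k

  eventually-close : ∀ q k → (∀ {m} → k ℕ.≤ m → ∣ q ℚ.- lo[ m ] ∣ ℚ.≤ size k) →
    ∀ δ → size k ℚ.≤ δ → Eventually λ m → ∣ q ℚ.- lo[ m ] ∣ ℚ.≤ δ
  eventually-close q k close δ size≤δ = k , λ m k≤m → ℚ.≤-trans (close k≤m) size≤δ

  P-adherent : Adherent P limit
  P-adherent δ 0<δ =
    let k , size≤δ = shrink-small {δ} {1ℚ} 0<δ (ℚ.positive⁻¹ 1ℚ) in
    lo[ k ] , lo-unit k , P-lo (bracket k) , eventually-close lo[ k ] k (close k) δ size≤δ
    where
    close : ∀ k {m} → k ℕ.≤ m → ∣ lo[ k ] ℚ.- lo[ m ] ∣ ℚ.≤ size k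
    close k {m} k≤m = let p , q = lo-close k≤m in abs-≤
      (≤-by (ℚ.+-mono-≤ p (ℚ.<⇒≤ (0<size k)))
        (solve 3 (λ l m s → (l :- m) :+ (m :+ s) := s :+ (l :+ con 0ℚ)) refl lo[ k ] lo[ m ] (size k)))
      (≤-by q (solve 3 (λ l m s → (:- (l :- m)) :+ (l :+ s) := s :+ m) refl lo[ k ] lo[ m ] (size k)))

  Q-adherent : Adherent Q limit
  Q-adherent δ 0<δ =
    let k , size≤δ = shrink-small {δ} {1ℚ} 0<δ (ℚ.positive⁻¹ 1ℚ) in
    lo[ k ] ℚ.+ size k , (0≤hi k , hi≤1 (bracket k)) , Q-hi (bracket k) ,
    eventually-close (lo[ k ] ℚ.+ size k) k (close k) δ size≤δ
    where
    0≤hi : ∀ k → 0ℚ ℚ.≤ lo[ k ] ℚ.+ size k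
    0≤hi k = ℚ.+-mono-≤ (0≤lo (bracket k)) (ℚ.<⇒≤ (0<size k))
    close : ∀ k {m} → k ℕ.≤ m → ∣ (lo[ k ] ℚ.+ size k) ℚ.- lo[ m ] ∣ ℚ.≤ size k
    close k {m} k≤m = let p , q = lo-close k≤m in abs-≤
      (≤-by p (solve 3 (λ l m s → ((l :+ s) :- m) :+ m := s :+ l) refl lo[ k ] lo[ m ] (size k)))
      (≤-by (ℚ.+-mono-≤ q (ℚ.<⇒≤ (0<size k)))
        (solve 3 (λ l m s → (:- ((l :+ s) :- m)) :+ ((l :+ s) :+ s) := s :+ (m :+ con 0ℚ))
          refl lo[ k ] lo[ m ] (size k)))

-- `P` and `Q` may overlap and be undecidable. The answer of `cover` at the midpoint decides which
-- half is kept, so that the left end stays in `P` and the right end in `Q`; both ends converge to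
-- `t`.
bisection : (P Q : ℚ → Set) → P 0ℚ → Q 1ℚ → (∀ q → InUnit q → P q ⊎ Q q) →
  ∃[ t ] (∀ k → InUnit (seq t k)) × Adherent P t × Adherent Q t
bisection P Q P0 Q1 cover = limit , lo-unit , P-adherent , Q-adherent
  where open Bisection P Q P0 Q1 cover

module _ {n : ℕ} where

  adherent-mix : ∀ P t (u w : Point n) → Adherent P t → ∀ ε → 0ℚ ℚ.< ε →
    ∃[ q ] InUnit q × P q × mix (fromℚ q) u w ∈ Ball ε (mix t u w)
  adherent-mix P t u w adherent ε 0<ε =
    let k , close = witness (ev-all small)
        q , unit , Pq , q-close = adherent (shrink k 1ℚ) (shrink-pos k (ℚ.positive⁻¹ 1ℚ))
    in q , unit , Pq , close⇒Ball (mix t u w) (mix (fromℚ q) u w) (half-< 0<ε) (λ i → close i q q-close)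
    where
    open ℚ.≤-Reasoning
    open +-*-Solver
    Close : Fin (suc n) → ℚ → ℕ → Set
    Close i q m = ∣ slice (mix (fromℚ q) u w) m i ℚ.- slice (mix t u w) m i ∣ ℚ.≤ ½ ℚ.* ε
    step : ∀ i q m b δ → δ ℚ.* b ≡ ½ ℚ.* ε → ∣ q ℚ.- seq t m ∣ ℚ.≤ δ →
      ∣ seq (w i - u i) m ∣ ℚ.≤ b → Close i q m
    step i q m b δ δb≡ q≤δ d≤b = begin
      ∣ slice (mix (fromℚ q) u w) m i ℚ.- slice (mix t u w) m i ∣
        ≡⟨ cong ∣_∣ (solve 4 (λ u d q l → (u :+ q :* d) :- (u :+ l :* d) := (q :- l) :* d)
             refl (slice u m i) (seq (w i - u i) m) q (seq t m)) ⟩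
      ∣ (q ℚ.- seq t m) ℚ.* seq (w i - u i) m ∣  ≤⟨ abs-*-≤ q≤δ d≤b ⟩
      δ ℚ.* b                                    ≡⟨ δb≡ ⟩
      ½ ℚ.* ε                                    ∎
    -- The index `k` stands for the precision 2^(-k). It is fixed for all coordinates before `q` is
    -- known, hence the quantifier over `q` inside `Eventually`.
    small : ∀ i → Eventually λ k → ∀ q →
      (Eventually λ m → ∣ q ℚ.- seq t m ∣ ℚ.≤ shrink k 1ℚ) → Eventually (Close i q)
    small i =
      let b , 0<b , bound = bounded (seq (w i - u i)) (cauchy (w i - u i))
          δ , 0<δ , δb≡ = divide {½ ℚ.* ε} {b} (half-pos 0<ε) 0<b
          N , le = shrink-small {δ} {1ℚ} 0<δ (ℚ.positive⁻¹ 1ℚ)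
      in N , λ k N≤k q q-close → ev-zip
        (λ m q≤ d≤ → step i q m b δ δb≡ (ℚ.≤-trans q≤
          (ℚ.≤-trans (shrink-antitone (ℚ.<⇒≤ (ℚ.positive⁻¹ 1ℚ)) N≤k) le)) d≤)
        q-close bound

  Touches : Pred (Point n) 0ℓ → Pred (Point n) 0ℓ → Point n → Set
  Touches C U z = ∀ ε → 0ℚ ℚ.< ε → ∃[ v ] v ∈ C × v ∈ U × v ∈ Ball ε z

  segment-limit : ∀ (C : Pred (Point n) 0ℓ) → Convex C → (P Q : Pred (Point n) 0ℓ) → ∀ u w →
    u ∈ C → w ∈ C → mix (fromℚ 0ℚ) u w ∈ P → mix (fromℚ 1ℚ) u w ∈ Q → (∀ z → z ∈ C → z ∈ P ⊎ z ∈ Q) →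
    ∃[ z ] z ∈ C × Touches C P z × Touches C Q z
  segment-limit C convex P Q u w u∈C w∈C P0 Q1 cover =
    let t , unit , P-adherent , Q-adherent =
          bisection (at P) (at Q) P0 Q1 (λ q unit → cover (mix (fromℚ q) u w) (at∈C q unit))
    in mix t u w , convex t u w unit u∈C w∈C , touches P t P-adherent , touches Q t Q-adherent
    where
    at : Pred (Point n) 0ℓ → ℚ → Set
    at P q = mix (fromℚ q) u w ∈ P
    at∈C : ∀ q → InUnit q → at C q
    at∈C q unit = convex (fromℚ q) u w (λ _ → unit) u∈C w∈C
    touches : ∀ P t → Adherent (at P) t → Touches C P (mix t u w)
    touches P t adherent ε 0<ε =
      let q , unit , Pq , q∈ = adherent-mix (at P) t u w adherent ε 0<ε in
      mix (fromℚ q) u w , at∈C q unit , Pq , q∈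

  -- Bisecting a segment from `U` to `W` yields a point `z` of `C` that is approached by points of
  -- both sets. Whichever of the two open sets contains `z` also contains nearby points of the
  -- other.
  convex⇒connected : (C : Pred (Point n) 0ℓ) → Convex C → C ⊆ V∅ → IsConnected C
  convex⇒connected C convex C⊆V∅ U W open-U open-W cover (u , u∈C , u∈U) (w , w∈C , w∈W) =
    let z , z∈C , touches-U , touches-W = limits
    in decide z z∈C touches-U touches-W (cover {z} z∈C)
    where
    open +-*-Solver
    0≤1 : 0ℚ ℚ.≤ 1ℚ
    0≤1 = ℚ.<⇒≤ (ℚ.positive⁻¹ 1ℚ)
    0-unit : InUnit 0ℚ
    0-unit = ℚ.≤-refl , 0≤1
    1-unit : InUnit 1ℚ
    1-unit = 0≤1 , ℚ.≤-refl
    endpoint : ∀ (P : Pred (Point n) 0ℓ) v q → IsOpen P → InUnit q →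
      (∀ k → slice (mix (fromℚ q) u w) k ≗ slice v k) → v ∈ C → v ∈ P → mix (fromℚ q) u w ∈ P
    endpoint P v q open-P unit eq v∈C v∈P = open-≗ P v (mix (fromℚ q) u w) open-P (C⊆V∅ v∈C)
      (C⊆V∅ (convex (fromℚ q) u w (λ _ → unit) u∈C w∈C)) eq v∈P
    start∈U : mix (fromℚ 0ℚ) u w ∈ U
    start∈U = endpoint U u 0ℚ open-U 0-unit (λ k i → solve 2 (λ u w → u :+ con 0ℚ :* (w :- u) := u)
      refl (slice u k i) (slice w k i)) u∈C u∈U
    end∈W : mix (fromℚ 1ℚ) u w ∈ W
    end∈W = endpoint W w 1ℚ open-W 1-unit (λ k i → solve 2 (λ u w → u :+ con 1ℚ :* (w :- u) := w)
      refl (slice u k i) (slice w k i)) w∈C w∈W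
    limits : ∃[ z ] z ∈ C × Touches C U z × Touches C W z
    limits = segment-limit C convex U W u w u∈C w∈C start∈U end∈W (λ z → cover {z})
    absorb : ∀ (P Q : Pred (Point n) 0ℓ) z → IsOpen P → z ∈ C → z ∈ P → Touches C Q z →
      ∃[ v ] v ∈ C × v ∈ P × v ∈ Q
    absorb P Q z open-P z∈C z∈P touches =
      let _ , ε , 0<ε , near = open-P z (C⊆V∅ z∈C) z∈P
          v , v∈C , v∈Q , v∈Ball = touches ε 0<ε
      in v , v∈C , near v (C⊆V∅ v∈C) v∈Ball , v∈Q
    decide : ∀ z → z ∈ C → Touches C U z → Touches C W z → z ∈ U ⊎ z ∈ W →
      ∃[ v ] v ∈ C × v ∈ U × v ∈ W
    decide z z∈C tU tW (inj₁ z∈U) = absorb U W z open-U z∈C z∈U tW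
    decide z z∈C tU tW (inj₂ z∈W) =
      let v , v∈C , v∈W , v∈U = absorb W U z open-W z∈C z∈W tU in v , v∈C , v∈U , v∈W

  -- The connected set is the whole chamber of `x`: positivity of a subset sum survives mixing, so
  -- `Cell` is convex.
  ≼⇒component : (x y : Point n) → Generic x → y ∈ V∅ → x ≼ y →
    InSameComponent ResonanceComplement x y
  ≼⇒component x y (x∈V , sign) y∈V x≼y =
    Cell , (λ {z} → cell⊆ z) , convex⇒connected Cell convex proj₁ , (x∈V , λ _ _ p → p) , (y∈V , x≼y)
    where
    Cell : Pred (Point n) 0ℓ
    Cell z = z ∈ V∅ × x ≼ z
    convex : Convex Cell
    convex t u w unit (u∈V , x≼u) (w∈V , x≼w) = mix-V∅ t u w unit u∈V w∈V ,
      λ b mixed p → mix-positive t u w b unit (x≼u b mixed p) (x≼w b mixed p)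
    cell⊆ : ∀ z → z ∈ Cell → z ∈ ResonanceComplement
    cell⊆ z (z∈V , x≼z) = generic⇒complement z (z∈V , λ b mixed →
      Sum.map (x≼z b mixed) (x≼z (not ∘ b) (mixed-not mixed)) (sign b mixed))

-- Flows on a digraph

∑-delta : ∀ {n} (i : Fin n) (v : Fin n → ℚ) → ∑ (λ k → v k when does (i Fin.≟ k)) ≡ v i
∑-delta {suc n} zero    v = trans (cong (v zero ℚ.+_) (sum-replicate-zero n)) (ℚ.+-identityʳ (v zero))
∑-delta {suc n} (suc i) v = trans (ℚ.+-identityˡ _) (∑-delta i (v ∘ suc))

∑-delta′ : ∀ {n} (k : Fin n) (v : Fin n → ℚ) → ∑ (λ i → v i when does (i Fin.≟ k)) ≡ v k
∑-delta′ {suc n} zero    v = trans (cong (v zero ℚ.+_) (sum-replicate-zero n)) (ℚ.+-identityʳ (v zero))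
∑-delta′ {suc n} (suc k) v = trans (ℚ.+-identityˡ _) (∑-delta′ k (v ∘ suc))

∑∑-delta : ∀ {m n} (a : Fin m) (b : Fin n) (v : Fin m → Fin n → ℚ) →
  ∑ (λ i → ∑ λ j → v i j when (does (a Fin.≟ i) ∧ does (b Fin.≟ j))) ≡ v a b
∑∑-delta {m} {n} a b v = trans (sum-cong-≗ λ i → inner (does (a Fin.≟ i)) i) (∑-delta a (λ i → v i b))
  where
  inner : ∀ d i → ∑ (λ j → v i j when (d ∧ does (b Fin.≟ j))) ≡ v i b when d
  inner true  i = ∑-delta b (v i)
  inner false i = sum-replicate-zero n

when-comm : ∀ b c p → (p when b) when c ≡ (p when c) when b
when-comm true  c     p = refl
when-comm false true  p = refl
when-comm false false p = refl

module Flow {N : ℕ} (G : Digraph N) where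

  -- Outflow minus inflow at `k`, that is, the coordinate `k` of the sum of f(i,j)(e_i - e_j) over
  -- the arcs.
  excess : (Fin N → Fin N → ℚ) → Fin N → ℚ
  excess f k = ∑ λ i → ∑ λ j →
    (f i j when does (i Fin.≟ k) ℚ.- f i j when does (j Fin.≟ k)) when G i j

  excess-zero : ∀ k → excess (λ _ _ → 0ℚ) k ≡ 0ℚ
  excess-zero k = ∑-zero _ λ i → ∑-zero _ λ j →
    zeros (does (i Fin.≟ k)) (does (j Fin.≟ k)) (G i j)
    where
    zeros : ∀ b c g → (0ℚ when b ℚ.- 0ℚ when c) when g ≡ 0ℚ
    zeros b     c     false = refl
    zeros true  true  true  = refl
    zeros true  false true  = refl
    zeros false true  true  = refl
    zeros false false true  = refl

  excess-+ : ∀ f g k → excess (λ i j → f i j ℚ.+ g i j) k ≡ excess f k ℚ.+ excess g k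
  excess-+ f g k = trans
    (sum-cong-≗ λ i → trans
      (sum-cong-≗ λ j → distrib (does (i Fin.≟ k)) (does (j Fin.≟ k)) (G i j) (f i j) (g i j))
      (∑-distrib-+ {N} (term f i) (term g i)))
    (∑-distrib-+ {N} (λ i → ∑ (term f i)) (λ i → ∑ (term g i)))
    where
    open +-*-Solver
    term : (Fin N → Fin N → ℚ) → Fin N → Fin N → ℚ
    term f i j = (f i j when does (i Fin.≟ k) ℚ.- f i j when does (j Fin.≟ k)) when G i j
    distrib : ∀ b c g p q → ((p ℚ.+ q) when b ℚ.- (p ℚ.+ q) when c) when g ≡
      (p when b ℚ.- p when c) when g ℚ.+ (q when b ℚ.- q when c) when g
    distrib b     c     false p q = refl
    distrib true  true  true  p q = solve 2 (λ p q → (p :+ q) :- (p :+ q) := (p :- p) :+ (q :- q)) refl p q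
    distrib true  false true  p q = solve 2 (λ p q → (p :+ q) :- con 0ℚ := (p :- con 0ℚ) :+ (q :- con 0ℚ)) refl p q
    distrib false true  true  p q = solve 2 (λ p q → con 0ℚ :- (p :+ q) := (con 0ℚ :- p) :+ (con 0ℚ :- q)) refl p q
    distrib false false true  p q = refl

  excess-∑ : ∀ {m} (f : Fin m → Fin N → Fin N → ℚ) k →
    excess (λ i j → ∑ λ a → f a i j) k ≡ ∑ λ a → excess (f a) k
  excess-∑ {zero}  f k = excess-zero k
  excess-∑ {suc m} f k = trans (excess-+ (f zero) (λ i j → ∑ λ a → f (suc a) i j) k)
    (cong (excess (f zero) k ℚ.+_) (excess-∑ (f ∘ suc) k))

  single : Fin N → Fin N → ℚ → Fin N → Fin N → ℚ
  single a b r i j = r when (does (a Fin.≟ i) ∧ does (b Fin.≟ j))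

  excess-single : ∀ a b r k → G a b ≡ true →
    excess (single a b r) k ≡ r when does (a Fin.≟ k) ℚ.- r when does (b Fin.≟ k)
  excess-single a b r k Gab = trans
    (sum-cong-≗ λ i → sum-cong-≗ λ j → pull (does (a Fin.≟ i) ∧ does (b Fin.≟ j))
      (does (i Fin.≟ k)) (does (j Fin.≟ k)) (G i j))
    (trans (∑∑-delta a b λ i j → (r when does (i Fin.≟ k) ℚ.- r when does (j Fin.≟ k)) when G i j)
      (cong ((r when does (a Fin.≟ k) ℚ.- r when does (b Fin.≟ k)) when_) Gab))
    where
    pull : ∀ d b c g → ((r when d) when b ℚ.- (r when d) when c) when g ≡
      ((r when b ℚ.- r when c) when g) when d
    pull true  b     c     g     = refl
    pull false b     c     false = refl
    pull false true  true  true  = refl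
    pull false true  false true  = refl
    pull false false true  true  = refl
    pull false false false true  = refl

  -- After an exchange of sums an arc counts positively if its tail is in `b` and negatively if its
  -- head is, so only the arcs that cross the boundary of `b` matter.
  subsum-excess : ∀ b f → subsum b (excess f) ≡
    ∑ λ i → ∑ λ j → (f i j when b i ℚ.- f i j when b j) when G i j
  subsum-excess b f = begin
    ∑ (λ k → excess f k when b k)
      ≡⟨ (sum-cong-≗ λ k → trans (when-∑ (b k) (λ i → ∑ (term i k)))
           (sum-cong-≗ λ i → when-∑ (b k) (term i k))) ⟩
    ∑ (λ k → ∑ λ i → ∑ λ j → term i k j when b k)
      ≡⟨ ∑-comm (λ k i → ∑ λ j → term i k j when b k) ⟩
    ∑ (λ i → ∑ λ k → ∑ λ j → term i k j when b k)
      ≡⟨ (sum-cong-≗ λ i → ∑-comm (λ k j → term i k j when b k)) ⟩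
    ∑ (λ i → ∑ λ j → ∑ λ k → term i k j when b k)
      ≡⟨ (sum-cong-≗ λ i → sum-cong-≗ λ j → collapse i j) ⟩
    ∑ (λ i → ∑ λ j → (f i j when b i ℚ.- f i j when b j) when G i j) ∎
    where
    open ≡-Reasoning
    term : Fin N → Fin N → Fin N → ℚ
    term i k j = (f i j when does (i Fin.≟ k) ℚ.- f i j when does (j Fin.≟ k)) when G i j
    pick : ∀ i p → ∑ (λ k → (p when does (i Fin.≟ k)) when b k) ≡ p when b i
    pick i p = trans (sum-cong-≗ λ k → when-comm (does (i Fin.≟ k)) (b k) p)
      (∑-delta i (λ k → p when b k))
    collapse : ∀ i j → ∑ (λ k → term i k j when b k) ≡ (f i j when b i ℚ.- f i j when b j) when G i j
    collapse i j = trans (sum-cong-≗ λ k → when-comm (G i j) (b k) (p when does (i Fin.≟ k) ℚ.- p when does (j Fin.≟ k)))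
      (trans (sym (when-∑ (G i j) (λ k → (p when does (i Fin.≟ k) ℚ.- p when does (j Fin.≟ k)) when b k)))
        (cong (_when G i j)
          (trans (subsum-- b (λ k → p when does (i Fin.≟ k)) (λ k → p when does (j Fin.≟ k)))
            (cong₂ ℚ._-_ (pick i p) (pick j p)))))
      where p = f i j

  -- No arc enters `b` from outside, so a nonnegative flow gives `b` a nonnegative sum. Two kinds of
  -- sets have this property: the tail side of the cut at a tree arc, and every prefix of the
  -- vertices, because arcs increase.
  Closed : (Fin N → Bool) → Set
  Closed b = ∀ i j → G i j ≡ true → b j ≡ true → b i ≡ true

  -- The fundamental cut of a tree arc, given by the side of its tail.
  record Separates (b : Fin N → Bool) (i j : Fin N) : Set where
    field
      tail-in  : b i ≡ true
      head-out : b j ≡ false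
      others   : ∀ k l → G k l ≡ true → ¬ (k ≡ i × l ≡ j) → b k ≡ b l

  open Separates

  separates⇒closed : ∀ {b i j} → Separates b i j → Closed b
  separates⇒closed {b} {i} {j} sep k l Gkl bl = go (k Fin.≟ i) (l Fin.≟ j)
    where
    go : Dec (k ≡ i) → Dec (l ≡ j) → b k ≡ true
    go (yes refl) _          = tail-in sep
    go (no k≢i)   _          = trans (others sep k l Gkl λ (k≡i , _) → k≢i k≡i) bl

  subsum-excess-separates : ∀ {b i j} f → G i j ≡ true → Separates b i j →
    subsum b (excess f) ≡ f i j
  subsum-excess-separates {b} {i} {j} f Gij sep = trans (subsum-excess b f)
    (trans (sum-cong-≗ λ k → sum-cong-≗ λ l → only k l (i Fin.≟ k) (j Fin.≟ l)) (∑∑-delta i j f))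
    where
    same : ∀ c d g p → (g ≡ true → c ≡ d) → (p when c ℚ.- p when d) when g ≡ 0ℚ
    same c d false p _  = refl
    same c d true  p eq = trans (cong (λ e → p when e ℚ.- p when d) (eq refl)) (ℚ.+-inverseʳ (p when d))
    only : ∀ k l (i≟k : Dec (i ≡ k)) (j≟l : Dec (j ≡ l)) →
      (f k l when b k ℚ.- f k l when b l) when G k l ≡ f k l when (does i≟k ∧ does j≟l)
    only k l (yes refl) (yes refl) = trans (cong ((f i j when b i ℚ.- f i j when b j) when_) Gij)
      (trans (cong₂ (λ c d → f i j when c ℚ.- f i j when d) (tail-in sep) (head-out sep))
        (ℚ.+-identityʳ (f i j)))
    only k l (no i≢k)   _          = same (b k) (b l) (G k l) (f k l)
      λ Gkl → others sep k l Gkl λ (k≡i , _) → i≢k (sym k≡i)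
    only k l (yes _)    (no j≢l)   = same (b k) (b l) (G k l) (f k l)
      λ Gkl → others sep k l Gkl λ (_ , l≡j) → j≢l (sym l≡j)

∑-lower : ∀ {n} (v : Fin n → ℚ) p → (∀ i → p ℚ.≤ v i) → n · p ℚ.≤ ∑ v
∑-lower {zero}  v p le = ℚ.≤-refl
∑-lower {suc n} v p le = ℚ.+-mono-≤ (le zero) (∑-lower (v ∘ suc) p (le ∘ suc))

·-neg : ∀ n p → n · (ℚ.- p) ≡ ℚ.- (n · p)
·-neg zero    p = refl
·-neg (suc n) p = trans (cong (ℚ.- p ℚ.+_) (·-neg n p)) (sym (ℚ.neg-distrib-+ p (n · p)))

module _ {N : ℕ} (G : Digraph N) where

  open Flow G

  -- A nonnegative real may have terms slightly below 0, so at a fixed index only the bound by `- ε`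
  -- is available, and the error accumulates over the N² pairs of vertices.
  subsum-excess-closed : ∀ b f ε → Closed b → 0ℚ ℚ.≤ ε → (∀ i j → G i j ≡ true → ℚ.- ε ℚ.≤ f i j) →
    N · (N · (ℚ.- ε)) ℚ.≤ subsum b (excess f)
  subsum-excess-closed b f ε closed 0≤ε le = subst (N · (N · (ℚ.- ε)) ℚ.≤_) (sym (subsum-excess b f))
    (∑-lower _ (N · (ℚ.- ε)) λ i → ∑-lower _ (ℚ.- ε) λ j →
      lower (b i) (b j) (G i j) (f i j) (closed i j) (le i j))
    where
    -ε≤0 : ℚ.- ε ℚ.≤ 0ℚ
    -ε≤0 = ℚ.neg-antimono-≤ 0≤ε
    lower : ∀ c d g p → (g ≡ true → d ≡ true → c ≡ true) → (g ≡ true → ℚ.- ε ℚ.≤ p) →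
      ℚ.- ε ℚ.≤ (p when c ℚ.- p when d) when g
    lower c     d     false p _  _  = -ε≤0
    lower true  true  true  p _  _  = subst (ℚ.- ε ℚ.≤_) (sym (ℚ.+-inverseʳ p)) -ε≤0
    lower true  false true  p _  le = subst (ℚ.- ε ℚ.≤_) (sym (ℚ.+-identityʳ p)) (le refl)
    lower false false true  p _  _  = -ε≤0
    lower false true  true  p cl _ with cl refl refl
    ... | ()

-- Cutting a tree at an arc

-- `Acyclic` excludes cycles with distinct vertices, so a walk has to be freed of repetitions before
-- it can be closed up to a forbidden cycle.
record SimplePath {A : Set} (R : Rel A 0ℓ) (x y : A) : Set where
  field
    length    : ℕ
    vertex    : Fin (suc length) → A
    starts    : vertex zero ≡ x
    ends      : vertex (Fin.fromℕ length) ≡ y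
    injective : Injective _≡_ _≡_ vertex
    steps     : ∀ i → R (vertex (Fin.inject₁ i)) (vertex (suc i))

open SimplePath

module _ {N : ℕ} (R : Rel (Fin N) 0ℓ) where

  suffix : ∀ {m y} (v : Fin (suc m) → Fin N) → v (Fin.fromℕ m) ≡ y → Injective _≡_ _≡_ v →
    (∀ i → R (v (Fin.inject₁ i)) (v (suc i))) → ∀ i → SimplePath R (v i) y
  suffix {m}     v end inj step zero    = record
    { length = m ; vertex = v ; starts = refl ; ends = end ; injective = inj ; steps = step }
  suffix {suc m} v end inj step (suc i) =
    suffix (v ∘ suc) end (Fin.suc-injective ∘ inj) (step ∘ suc) i

  extend : ∀ {x y z} → R x y → SimplePath R y z → SimplePath R x z
  extend {x} {y} {z} xy p = go (Fin.any? λ i → vertex p i Fin.≟ x)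
    where
    go : Dec (∃[ i ] vertex p i ≡ x) → SimplePath R x z
    -- The vertex `x` is already on the path, and what comes before its occurrence is a detour.
    go (yes (i , refl)) = suffix (vertex p) (ends p) (injective p) (steps p) i
    go (no new) = record
      { length = suc (length p)
      ; vertex = v
      ; starts = refl
      ; ends = ends p
      ; injective = v-injective
      ; steps = v-steps
      }
      where
      v : Fin (suc (suc (length p))) → Fin N
      v zero    = x
      v (suc i) = vertex p i
      v-injective : Injective _≡_ _≡_ v
      v-injective {zero}  {zero}  _  = refl
      v-injective {zero}  {suc j} eq = ⊥-elim (new (j , sym eq))
      v-injective {suc i} {zero}  eq = ⊥-elim (new (i , eq))
      v-injective {suc i} {suc j} eq = cong suc (injective p eq)
      v-steps : ∀ i → R (v (Fin.inject₁ i)) (v (suc i))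
      v-steps zero    = subst (R x) (sym (starts p)) xy
      v-steps (suc i) = steps p i

  walk⇒simplePath : ∀ {x y} → Star R x y → SimplePath R x y
  walk⇒simplePath {x} nil   = record
    { length = 0 ; vertex = λ _ → x ; starts = refl ; ends = refl
    ; injective = λ { {zero} {zero} _ → refl } ; steps = λ () }
  walk⇒simplePath (xy ◅ p) = extend xy (walk⇒simplePath p)

-- The side of a cut is a reachability relation, which is needed as a Boolean function. Deciding it
-- up to double negation suffices, because the nonnegativity of a flow that it serves to prove is
-- itself a negation.
¬¬-decidable : ∀ {N} (P : Fin N → Set) → ¬ ¬ (∀ i → Dec (P i))
¬¬-decidable P = IsFilter.all-Fin ¬¬-isFilter {P = λ i _ → Dec (P i)} λ i → ¬¬-excluded-middle
  where
  ¬¬-isFilter : IsFilter {⊤} (λ P → ¬ ¬ P tt)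
  ¬¬-isFilter = record
    { always = λ p k → k (p tt)
    ; zip    = λ f p q k → p λ x → q λ y → k (f tt x y)
    }

T⇒≡ : ∀ {b} → T b → b ≡ true
T⇒≡ {true} _ = refl

≡⇒T : ∀ {b} → b ≡ true → T b
≡⇒T refl = tt

module Tree {N : ℕ} (t : PositiveAlternatingTree N) where

  open Flow (graph t)

  module _ (i j : Fin N) (ij : Arc (graph t) i j) where

    AdjacentOff : Rel (Fin N) 0ℓ
    AdjacentOff k l = Adjacent (graph t) k l × ¬ (k ≡ i × l ≡ j) × ¬ (k ≡ j × l ≡ i)

    i≢j : i ≢ j
    i≢j i≡j = Fin.<-irrefl i≡j (positive t ij)

    -- The arc closes a simple path of length at least 2 to a cycle with at least three vertices.
    -- Length 0 would give i = j, and length 1 would be the removed arc.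
    head-unreachable : ¬ Star AdjacentOff i j
    head-unreachable walk = cycle (walk⇒simplePath AdjacentOff walk)
      where
      cycle : ¬ SimplePath AdjacentOff i j
      cycle record { length = zero ; starts = s ; ends = e } = i≢j (trans (sym s) e)
      cycle record { length = suc zero ; starts = s ; ends = e ; steps = st } =
        proj₁ (proj₂ (st zero)) (s , e)
      cycle record { length = suc (suc k) ; vertex = v ; starts = s ; ends = e ; injective = inj ; steps = st } =
        acyclic t k v inj (λ l → proj₁ (st l)) (inj₂ (subst₂ (Arc (graph t)) (sym s) (sym e) ij))

    -- The set is the component of `i` after the arc is removed: every other arc joins two vertices
    -- that are both reachable from `i` or both not.
    ¬¬-separation : ¬ ¬ (∃[ b ] Separates b i j)
    ¬¬-separation none = ¬¬-decidable (Star AdjacentOff i) λ reach? →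
      none ((λ k → does (reach? k)) , separates reach?)
      where
      separates : (reach? : ∀ k → Dec (Star AdjacentOff i k)) → Separates (λ k → does (reach? k)) i j
      separates reach? = record
        { tail-in  = dec-true (reach? i) nil
        ; head-out = dec-false (reach? j) head-unreachable
        ; others   = λ k l kl off → does-⇔ (mk⇔
            (λ p → p ◅◅ (forward k l kl off ◅ nil)) (λ p → p ◅◅ (backward k l kl off ◅ nil)))
            (reach? k) (reach? l)
        }
        where
        -- The arc (j, i) would contradict i < j.
        reversed : ∀ k l → graph t k l ≡ true → ¬ (k ≡ j × l ≡ i)
        reversed k l kl (refl , refl) = Fin.<-asym (positive t ij) (positive t (≡⇒T kl))
        forward : ∀ k l → graph t k l ≡ true → ¬ (k ≡ i × l ≡ j) → AdjacentOff k l
        forward k l kl off = inj₁ (≡⇒T kl) , off , reversed k l kl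
        backward : ∀ k l → graph t k l ≡ true → ¬ (k ≡ i × l ≡ j) → AdjacentOff l k
        backward k l kl off = inj₂ (≡⇒T kl) ,
          (λ (l≡i , k≡j) → reversed k l kl (k≡j , l≡i)) , (λ (l≡j , k≡i) → off (k≡i , l≡j))

  -- An arc traversed backwards receives `- r`, so the excess telescopes to the two ends of the
  -- walk. Repeated vertices do no harm, since the contributions are added.
  push : ∀ {a c} → ℝ → Star (Adjacent (graph t)) a c → Fin N → Fin N → ℝ
  push r nil i j = 0ℝ
  push r (_◅_ {a} {b} (inj₁ _) p) i j =
    (if does (a Fin.≟ i) ∧ does (b Fin.≟ j) then r else 0ℝ) + push r p i j
  push r (_◅_ {a} {b} (inj₂ _) p) i j =
    (if does (b Fin.≟ i) ∧ does (a Fin.≟ j) then - r else 0ℝ) + push r p i j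

  excess-≗ : ∀ {f g} → (∀ i j → f i j ≡ g i j) → ∀ k → excess f k ≡ excess g k
  excess-≗ eq k = sum-cong-≗ λ i → sum-cong-≗ λ j →
    cong (λ p → (p when does (i Fin.≟ k) ℚ.- p when does (j Fin.≟ k)) when graph t i j) (eq i j)

  excess-push : ∀ {a c} r (p : Star (Adjacent (graph t)) a c) m k →
    excess (λ i j → seq (push r p i j) m) k ≡
    seq r m when does (a Fin.≟ k) ℚ.- seq r m when does (c Fin.≟ k)
  excess-push {a} r nil m k = trans (excess-zero k) (sym (ℚ.+-inverseʳ (seq r m when does (a Fin.≟ k))))
  excess-push {a} {c} r (_◅_ {a} {b} (inj₁ ab) p) m k = begin
    excess (λ i j → seq (push r (inj₁ ab ◅ p) i j) m) k
      ≡⟨ excess-≗ (λ i j → cong (ℚ._+ seq (push r p i j) m)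
           (seq-if (does (a Fin.≟ i) ∧ does (b Fin.≟ j)) r m)) k ⟩
    excess (λ i j → single a b (seq r m) i j ℚ.+ seq (push r p i j) m) k
      ≡⟨ excess-+ (single a b (seq r m)) (λ i j → seq (push r p i j) m) k ⟩
    excess (single a b (seq r m)) k ℚ.+ excess (λ i j → seq (push r p i j) m) k
      ≡⟨ cong₂ ℚ._+_ (excess-single a b (seq r m) k (T⇒≡ ab)) (excess-push r p m k) ⟩
    (at a ℚ.- at b) ℚ.+ (at b ℚ.- at c)
      ≡⟨ solve 3 (λ a b c → (a :- b) :+ (b :- c) := a :- c) refl (at a) (at b) (at c) ⟩
    at a ℚ.- at c ∎
    where
    open ≡-Reasoning
    open +-*-Solver
    at : Fin N → ℚ
    at v = seq r m when does (v Fin.≟ k)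
  excess-push {a} {c} r (_◅_ {a} {b} (inj₂ ba) p) m k = begin
    excess (λ i j → seq (push r (inj₂ ba ◅ p) i j) m) k
      ≡⟨ excess-≗ (λ i j → cong (ℚ._+ seq (push r p i j) m)
           (seq-if (does (b Fin.≟ i) ∧ does (a Fin.≟ j)) (- r) m)) k ⟩
    excess (λ i j → single b a (ℚ.- seq r m) i j ℚ.+ seq (push r p i j) m) k
      ≡⟨ excess-+ (single b a (ℚ.- seq r m)) (λ i j → seq (push r p i j) m) k ⟩
    excess (single b a (ℚ.- seq r m)) k ℚ.+ excess (λ i j → seq (push r p i j) m) k
      ≡⟨ cong₂ ℚ._+_ (excess-single b a (ℚ.- seq r m) k (T⇒≡ ba)) (excess-push r p m k) ⟩
    ((ℚ.- seq r m) when does (b Fin.≟ k) ℚ.- (ℚ.- seq r m) when does (a Fin.≟ k)) ℚ.+ (at b ℚ.- at c)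
      ≡⟨ cong₂ (λ p q → (p ℚ.- q) ℚ.+ (at b ℚ.- at c)) (neg-when (does (b Fin.≟ k))) (neg-when (does (a Fin.≟ k))) ⟩
    (ℚ.- at b ℚ.- ℚ.- at a) ℚ.+ (at b ℚ.- at c)
      ≡⟨ solve 3 (λ a b c → ((:- b) :- (:- a)) :+ (b :- c) := a :- c) refl (at a) (at b) (at c) ⟩
    at a ℚ.- at c ∎
    where
    open ≡-Reasoning
    open +-*-Solver
    at : Fin N → ℚ
    at v = seq r m when does (v Fin.≟ k)
    neg-when : ∀ d → (ℚ.- seq r m) when d ≡ ℚ.- (seq r m when d)
    neg-when true  = refl
    neg-when false = refl

-- Membership in a root cone depends only on the signs of the subset sums

-- The hypothesis is a negation, but a rational term at a late index can be compared with -½ ε. If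
-- it lies below, all later terms stay below -¼ ε, which refutes `0ℝ ≤ x`; otherwise they stay above
-- `- ε`.
0≤⇒eventually : ∀ x → 0ℝ ≤ x → ∀ ε → 0ℚ ℚ.< ε → Eventually λ k → ℚ.- ε ℚ.≤ seq x k
0≤⇒eventually x 0≤x ε 0<ε = cases (cauchy x (½ ℚ.* (½ ℚ.* ε)) 0<¼ε)
  where
  open +-*-Solver
  ¼ε = ½ ℚ.* (½ ℚ.* ε)
  0<¼ε : 0ℚ ℚ.< ¼ε
  0<¼ε = half-pos (half-pos 0<ε)
  cases : (∃[ N ] ∀ i j → N ℕ.≤ i → N ℕ.≤ j → ∣ seq x i ℚ.- seq x j ∣ ℚ.< ¼ε) →
    Eventually λ k → ℚ.- ε ℚ.≤ seq x k
  cases (N , close) = compare (ℚ.≤-total (ℚ.- (½ ℚ.* ε)) (seq x N))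
    where
    compare : ℚ.- (½ ℚ.* ε) ℚ.≤ seq x N ⊎ seq x N ℚ.≤ ℚ.- (½ ℚ.* ε) → Eventually λ k → ℚ.- ε ℚ.≤ seq x k
    compare (inj₁ le) = N , λ k N≤k → ≤-by
      (ℚ.+-mono-≤ le (ℚ.+-mono-≤ (ℚ.≤-trans (-p≤∣p∣ (seq x k ℚ.- seq x N)) (ℚ.<⇒≤ (close k N N≤k ℕ.≤-refl))) (ℚ.<⇒≤ 0<¼ε)))
      (solve 3 (λ a b ε → (:- ε) :+ (b :+ (con ½ :* (con ½ :* ε) :+ con ½ :* (con ½ :* ε)))
          := a :+ ((:- (con ½ :* ε)) :+ ((:- (a :- b)) :+ con 0ℚ)))
        refl (seq x k) (seq x N) ε)
    compare (inj₂ le) = ⊥-elim (0≤x (¼ε , 0<¼ε , N , λ k N≤k → ≤-by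
      (ℚ.+-mono-≤ le (ℚ.≤-trans (p≤∣p∣ (seq x k ℚ.- seq x N)) (ℚ.<⇒≤ (close k N N≤k ℕ.≤-refl))))
      (solve 3 (λ a b ε → (a :+ con ½ :* (con ½ :* ε)) :+ ((:- (con ½ :* ε)) :+ con ½ :* (con ½ :* ε))
          := con 0ℚ :+ (b :+ (a :- b)))
        refl (seq x k) (seq x N) ε)))

seq-difference : ∀ b x y k → seq (if b then x - y else 0ℝ) k ≡ (seq x k ℚ.- seq y k) when b
seq-difference true  x y k = refl
seq-difference false x y k = refl

small-slack : ∀ N ε → 0ℚ ℚ.< ε → ∃[ η ] 0ℚ ℚ.< η × ℚ.- ε ℚ.≤ N · (N · (ℚ.- η))
small-slack N ε 0<ε = η , shrink-pos N (shrink-pos N 0<ε) ,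
  subst (ℚ.- ε ℚ.≤_) (sym NN-η≡) (ℚ.neg-antimono-≤ NNη≤)
  where
  η = shrink N (shrink N ε)
  NNη≤ : N · (N · η) ℚ.≤ ε
  NNη≤ = ℚ.≤-trans (·-mono-≤ N (·-shrink N {shrink N ε} (ℚ.<⇒≤ (shrink-pos N 0<ε))))
    (·-shrink N {ε} (ℚ.<⇒≤ 0<ε))
  NN-η≡ : N · (N · (ℚ.- η)) ≡ ℚ.- (N · (N · η))
  NN-η≡ = trans (cong (N ·_) (·-neg N η)) (·-neg N (N · η))

seq-sum-sum : ∀ {m n} (v : Fin m → Fin n → ℝ) k {w : Fin m → Fin n → ℚ} →
  (∀ i j → seq (v i j) k ≡ w i j) → seq (sum λ i → sum λ j → v i j) k ≡ ∑ λ i → ∑ λ j → w i j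
seq-sum-sum v k eq = trans (seq-sum (λ i → sum λ j → v i j) k)
  (sum-cong-≗ λ i → trans (seq-sum (v i) k) (sum-cong-≗ (eq i)))

module _ {n : ℕ} (t : PositiveAlternatingTree (suc n)) where

  open Flow (graph t)
  open Tree t using (push; excess-push; excess-≗; ¬¬-separation)

  IsFlow : (Fin (suc n) → Fin (suc n) → ℝ) → Pred (Point n) 0ℓ
  IsFlow f x = ∀ k → x k ≈ sum λ i → sum λ j →
    if graph t i j then (f i j ·e i) k - (f i j ·e j) k else 0ℝ

  seq-term : ∀ (f : Fin (suc n) → Fin (suc n) → ℝ) k m i j → seq (if graph t i j then (f i j ·e i) k - (f i j ·e j) k else 0ℝ) m ≡
    (seq (f i j) m when does (i Fin.≟ k) ℚ.- seq (f i j) m when does (j Fin.≟ k)) when graph t i j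
  seq-term f k m i j = trans (seq-difference (graph t i j) ((f i j ·e i) k) ((f i j ·e j) k) m)
    (cong₂ (λ p q → (p ℚ.- q) when graph t i j)
      (seq-if (does (i Fin.≟ k)) (f i j) m) (seq-if (does (j Fin.≟ k)) (f i j) m))

  seq-flow : ∀ (f : Fin (suc n) → Fin (suc n) → ℝ) k m →
    seq (sum λ i → sum λ j → if graph t i j then (f i j ·e i) k - (f i j ·e j) k else 0ℝ) m ≡
    excess (λ i j → seq (f i j) m) k
  seq-flow f k m = seq-sum-sum (λ i j → if graph t i j then (f i j ·e i) k - (f i j ·e j) k else 0ℝ) m
    (seq-term f k m)

  subsum-close : ∀ (x : Point n) f b → IsFlow f x → ∀ ε → 0ℚ ℚ.< ε →
    Eventually λ m → ∣ subsum b (slice x m) ℚ.- subsum b (excess (λ i j → seq (f i j) m)) ∣ ℚ.≤ ε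
  subsum-close x f b x≈f ε 0<ε = ev-map
    (λ m close → ℚ.≤-trans
      (subsum-abs-≤ b (slice x m) (excess (λ i j → seq (f i j) m)) θ (ℚ.<⇒≤ 0<θ)
        λ k → ℚ.<⇒≤ (subst (λ p → ∣ slice x m k ℚ.- p ∣ ℚ.< θ) (seq-flow f k m) (close k)))
      (·-shrink (suc n) {ε} (ℚ.<⇒≤ 0<ε)))
    (ev-all λ k → x≈f k θ 0<θ)
    where
    θ = shrink (suc n) ε
    0<θ : 0ℚ ℚ.< θ
    0<θ = shrink-pos (suc n) 0<ε

  private
    ½ε≤0 : ∀ s e ε → s ℚ.+ ε ℚ.≤ 0ℚ → ∣ s ℚ.- e ∣ ℚ.≤ ½ ℚ.* (½ ℚ.* ε) →
      ℚ.- (½ ℚ.* (½ ℚ.* ε)) ℚ.≤ e → ½ ℚ.* ε ℚ.≤ 0ℚ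
    ½ε≤0 s e ε s+ε≤0 close lower = ≤-by
      (ℚ.+-mono-≤ s+ε≤0 (ℚ.+-mono-≤ (ℚ.≤-trans (-p≤∣p∣ (s ℚ.- e)) close) lower))
      (solve 3 (λ s e ε → con ½ :* ε :+ (con 0ℚ :+ (con ½ :* (con ½ :* ε) :+ e))
        := con 0ℚ :+ ((s :+ ε) :+ ((:- (s :- e)) :+ (:- (con ½ :* (con ½ :* ε)))))) refl s e ε)
      where open +-*-Solver

  closed⇒¬negative : ∀ x b → x ∈ RootCone t → Closed b → ¬ Negative x b
  closed⇒¬negative x b (f , 0≤f , x≈f) closed (ε , 0<ε , neg) =
    contradiction (witness (ev-× {Sum≤} neg (ev-× {Near-flow} (subsum-close x f b x≈f ¼ε 0<¼ε) flows)))
    where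
    ¼ε = ½ ℚ.* (½ ℚ.* ε)
    0<¼ε : 0ℚ ℚ.< ¼ε
    0<¼ε = half-pos (half-pos 0<ε)
    slack : ∃[ η ] 0ℚ ℚ.< η × ℚ.- ¼ε ℚ.≤ suc n · (suc n · (ℚ.- η))
    slack = small-slack (suc n) ¼ε 0<¼ε
    η = proj₁ slack
    0<η : 0ℚ ℚ.< η
    0<η = proj₁ (proj₂ slack)
    flow : ∀ i j g → graph t i j ≡ g → Eventually λ m → graph t i j ≡ true → ℚ.- η ℚ.≤ seq (f i j) m
    flow i j true  eq = ev-map (λ _ le _ → le) (0≤⇒eventually (f i j) (0≤f i j (≡⇒T eq)) η 0<η)
    flow i j false eq = ev-always λ m eq′ → ⊥-elim (case (trans (sym eq) eq′))
      where
      case : false ≢ true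
      case ()
    flows : Eventually λ m → ∀ i j → graph t i j ≡ true → ℚ.- η ℚ.≤ seq (f i j) m
    flows = ev-all λ i → ev-all λ j → flow i j (graph t i j) refl
    Sum≤ Near-flow : ℕ → Set
    Sum≤ m = subsum b (slice x m) ℚ.+ ε ℚ.≤ 0ℚ
    Near-flow m = ∣ subsum b (slice x m) ℚ.- subsum b (excess (λ i j → seq (f i j) m)) ∣ ℚ.≤ ¼ε
    contradiction : ¬ (∃[ m ] Sum≤ m × Near-flow m × (∀ i j → graph t i j ≡ true → ℚ.- η ℚ.≤ seq (f i j) m))
    contradiction (m , s+ε≤0 , close , le) = ℚ.<-irrefl {0ℚ} refl
      (ℚ.<-≤-trans (half-pos 0<ε) (½ε≤0 (subsum b (slice x m)) e ε s+ε≤0 close -¼ε≤e))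
      where
      e = subsum b (excess (λ i j → seq (f i j) m))
      -¼ε≤e : ℚ.- ¼ε ℚ.≤ e
      -¼ε≤e = ℚ.≤-trans {ℚ.- ¼ε} {suc n · (suc n · (ℚ.- η))} {e} (proj₂ (proj₂ slack))
        (subsum-excess-closed (graph t) b (λ i j → seq (f i j) m) η closed (ℚ.<⇒≤ 0<η) le)

  closed⇒positive : ∀ x b → Generic x → x ∈ RootCone t → Mixed b → Closed b → Positive x b
  closed⇒positive x b (x∈V , sign) x∈cone mixed closed = decide (sign b mixed)
    where
    decide : Positive x b ⊎ Positive x (not ∘ b) → Positive x b
    decide (inj₁ p) = p
    decide (inj₂ q) = ⊥-elim (closed⇒¬negative x b x∈cone closed (positive-not⇒negative x b x∈V q))

  -- Sends the coordinate y a along a path from a to the vertex 0.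
  flowTo0 : Point n → Fin (suc n) → Fin (suc n) → ℝ
  flowTo0 y i j = sum λ a → push (y a) (connected t a zero) i j

  -- All that is sent arrives at the vertex 0, so the defect there is the sum of the coordinates,
  -- which tends to 0 on `V∅`.
  excess-flowTo0 : ∀ y m k → excess (λ i j → seq (flowTo0 y i j) m) k ≡
    slice y m k ℚ.- ∑ (slice y m) when does (zero Fin.≟ k)
  excess-flowTo0 y m k = begin
    excess (λ i j → seq (flowTo0 y i j) m) k
      ≡⟨ excess-≗ (λ i j → seq-sum (λ a → path a i j) m) k ⟩
    excess (λ i j → ∑ λ a → seq (path a i j) m) k
      ≡⟨ excess-∑ (λ a i j → seq (path a i j) m) k ⟩
    ∑ (λ a → excess (λ i j → seq (path a i j) m) k)
      ≡⟨ (sum-cong-≗ λ a → excess-push (y a) (connected t a zero) m k) ⟩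
    ∑ (λ a → slice y m a when does (a Fin.≟ k) ℚ.- slice y m a when does (zero Fin.≟ k))
      ≡⟨ ∑-- (λ a → slice y m a when does (a Fin.≟ k)) (λ a → slice y m a when does (zero Fin.≟ k)) ⟩
    ∑ (λ a → slice y m a when does (a Fin.≟ k)) ℚ.- ∑ (λ a → slice y m a when does (zero Fin.≟ k))
      ≡⟨ cong₂ ℚ._-_ (∑-delta′ k (slice y m)) (sym (when-∑ (does (zero Fin.≟ k)) (slice y m))) ⟩
    slice y m k ℚ.- ∑ (slice y m) when does (zero Fin.≟ k) ∎
    where
    open ≡-Reasoning
    path : Fin (suc n) → Fin (suc n) → Fin (suc n) → ℝ
    path a = push (y a) (connected t a zero)

  flowTo0-isFlow : ∀ y → y ∈ V∅ → IsFlow (flowTo0 y) y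
  flowTo0-isFlow y y∈V k ε 0<ε = ev-map
    (λ m small → ℚ.≤-<-trans
      (subst (λ p → ∣ slice y m k ℚ.- p ∣ ℚ.≤ ½ ℚ.* ε)
        (sym (trans (seq-flow (flowTo0 y) k m) (excess-flowTo0 y m k)))
        (bound (does (zero Fin.≟ k)) (slice y m k) (∑ (slice y m)) small))
      (half-< 0<ε))
    (V∅⇒small y y∈V (½ ℚ.* ε) (half-pos 0<ε))
    where
    open +-*-Solver
    bound : ∀ d p s → ∣ s ∣ ℚ.≤ ½ ℚ.* ε → ∣ p ℚ.- (p ℚ.- s when d) ∣ ℚ.≤ ½ ℚ.* ε
    bound true  p s le = subst (λ q → ∣ q ∣ ℚ.≤ ½ ℚ.* ε) (solve 2 (λ p s → s := p :- (p :- s)) refl p s) le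
    bound false p s le = subst (λ q → ∣ q ∣ ℚ.≤ ½ ℚ.* ε) (solve 1 (λ p → con 0ℚ := p :- (p :- con 0ℚ)) refl p)
      (ℚ.<⇒≤ (half-pos 0<ε))

  private
    δ≤0 : ∀ s h δ ε → δ ℚ.≤ s → h ℚ.+ ε ℚ.≤ 0ℚ → ∣ s ℚ.- h ∣ ℚ.≤ ε → δ ℚ.≤ 0ℚ
    δ≤0 s h δ ε δ≤s h+ε≤0 s-h≤ε = ≤-by
      (ℚ.+-mono-≤ δ≤s (ℚ.+-mono-≤ h+ε≤0 (ℚ.≤-trans (p≤∣p∣ (s ℚ.- h)) s-h≤ε)))
      (solve 4 (λ s h δ ε → δ :+ (s :+ (con 0ℚ :+ ε))
        := con 0ℚ :+ (δ :+ ((h :+ ε) :+ (s :- h)))) refl s h δ ε)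
      where open +-*-Solver

  -- The tail side of a cut is closed, so the generic point `x` of the cone has a positive sum
  -- there, and hence so has `y`. In the limit this sum is the value of `flowTo0 y` on the arc,
  -- which therefore cannot be negative.
  rootCone-≼ : ∀ x y → Generic x → x ∈ RootCone t → y ∈ V∅ → x ≼ y → y ∈ RootCone t
  rootCone-≼ x y generic x∈cone y∈V x≼y = flowTo0 y , nonneg , flowTo0-isFlow y y∈V
    where
    nonneg : ∀ i j → Arc (graph t) i j → 0ℝ ≤ flowTo0 y i j
    nonneg i j ij (ε , 0<ε , neg) = ¬¬-separation i j ij λ (b , sep) → separated b sep
      where
      separated : ∀ b → Separates b i j → ⊥
      separated b sep = contradict (x≼y b mixed
          (closed⇒positive x b generic x∈cone mixed (separates⇒closed sep)))
        where
        mixed : Mixed b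
        mixed = (i , Separates.tail-in sep) , (j , Separates.head-out sep)
        contradict : ¬ Positive y b
        contradict (δ , 0<δ , pos) =
          absurd (witness (ev-× {Sum≥} pos (ev-× {Flow≤} neg
            (subsum-close y (flowTo0 y) b (flowTo0-isFlow y y∈V) ε 0<ε))))
          where
          Sum≥ Flow≤ Near-flow : ℕ → Set
          Sum≥ m = δ ℚ.≤ subsum b (slice y m)
          Flow≤ m = seq (flowTo0 y i j) m ℚ.+ ε ℚ.≤ 0ℚ
          Near-flow m = ∣ subsum b (slice y m) ℚ.- subsum b (excess (λ i j → seq (flowTo0 y i j) m)) ∣ ℚ.≤ ε
          absurd : ¬ (∃[ m ] Sum≥ m × Flow≤ m × Near-flow m)
          absurd (m , δ≤s , h+ε≤0 , close) = ℚ.<-irrefl {0ℚ} refl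
            (ℚ.<-≤-trans 0<δ (δ≤0 s h δ ε δ≤s h+ε≤0 s-h≤ε))
            where
            s = subsum b (slice y m)
            h = seq (flowTo0 y i j) m
            s-h≤ε : ∣ s ℚ.- h ∣ ℚ.≤ ε
            s-h≤ε = subst (λ p → ∣ s ℚ.- p ∣ ℚ.≤ ε)
              (subsum-excess-separates (λ i j → seq (flowTo0 y i j) m) (T⇒≡ ij) sep) close

-- Generic rational points

-- For each forbidden value the interval is split at an inner point, and an open part free of that
-- value is kept.
avoid : (L : List ℚ) → ∀ p r → p ℚ.< r → ∃[ q ] p ℚ.< q × q ℚ.< r × All (q ≢_) L
avoid []      p r p<r = let q , p<q , q<r = ℚ.<-dense p<r in q , p<q , q<r , []
avoid (s ∷ L) p r p<r = let m , p<m , m<r = ℚ.<-dense p<r in split m p<m m<r (ℚ.≤-total s m)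
  where
  split : ∀ m → p ℚ.< m → m ℚ.< r → s ℚ.≤ m ⊎ m ℚ.≤ s →
    ∃[ q ] p ℚ.< q × q ℚ.< r × All (q ≢_) (s ∷ L)
  split m p<m m<r (inj₁ s≤m) = let q , m<q , q<r , q∉L = avoid L m r m<r in
    q , ℚ.<-trans p<m m<q , q<r , (λ { refl → ℚ.<-irrefl refl (ℚ.≤-<-trans s≤m m<q) }) ∷ q∉L
  split m p<m m<r (inj₂ m≤s) = let q , p<q , q<m , q∉L = avoid L p m p<m in
    q , p<q , ℚ.<-trans q<m m<r , (λ { refl → ℚ.<-irrefl refl (ℚ.≤-<-trans m≤s q<m) }) ∷ q∉L

subsums : ∀ {n} → (Fin n → ℚ) → List ℚ
subsums {zero}  v = 0ℚ ∷ []
subsums {suc n} v = subsums (v ∘ suc) ++ List.map (v zero ℚ.+_) (subsums (v ∘ suc))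

subsum∈subsums : ∀ {n} b (v : Fin n → ℚ) → subsum b v ∈ₗ subsums v
subsum∈subsums {zero}  b v = here refl
subsum∈subsums {suc n} b v = cases (b zero)
  where
  tail = subsum∈subsums (b ∘ suc) (v ∘ suc)
  cases : ∀ c → (v zero when c ℚ.+ subsum (b ∘ suc) (v ∘ suc)) ∈ₗ subsums v
  cases true  = ∈-++⁺ʳ (subsums (v ∘ suc)) (∈-map⁺ (v zero ℚ.+_) tail)
  cases false = ∈-++⁺ˡ (subst (_∈ₗ subsums (v ∘ suc)) (sym (ℚ.+-identityˡ _)) tail)

-- The coordinates are chosen one by one, each avoiding finitely many values.
generic-near : ∀ {n} (r : Fin n → ℚ) ε → 0ℚ ℚ.< ε →
  ∃[ q ] (∀ i → ∣ q i ℚ.- r i ∣ ℚ.≤ ε) × (∀ b → (∃[ i ] b i ≡ true) → subsum b q ≢ 0ℚ)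
generic-near {zero}  r ε 0<ε = r , (λ ()) , λ { b (() , _) }
generic-near {suc n} r ε 0<ε =
  let q , close , nonzero = generic-near (r ∘ suc) ε 0<ε
      q₀ , lo , hi , fresh = avoid (List.map ℚ.-_ (subsums q)) (r zero) (r zero ℚ.+ ε) r<r+ε
  in cons q₀ q , cons-close q₀ q lo hi close , cons-nonzero q₀ q fresh nonzero
  where
  open +-*-Solver
  cons : ℚ → (Fin n → ℚ) → Fin (suc n) → ℚ
  cons q₀ q zero    = q₀
  cons q₀ q (suc i) = q i
  r<r+ε : r zero ℚ.< r zero ℚ.+ ε
  r<r+ε = <-by 0<ε (solve 2 (λ r ε → r :+ ε := (r :+ ε) :+ con 0ℚ) refl (r zero) ε)
  cons-close : ∀ q₀ q → r zero ℚ.< q₀ → q₀ ℚ.< r zero ℚ.+ ε →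
    (∀ i → ∣ q i ℚ.- r (suc i) ∣ ℚ.≤ ε) → ∀ i → ∣ cons q₀ q i ℚ.- r i ∣ ℚ.≤ ε
  cons-close q₀ q lo hi close zero = abs-≤
    (≤-by (ℚ.<⇒≤ hi) (solve 3 (λ q r ε → (q :- r) :+ (r :+ ε) := ε :+ q) refl q₀ (r zero) ε))
    (≤-by (ℚ.+-mono-≤ (ℚ.<⇒≤ lo) (ℚ.<⇒≤ 0<ε))
      (solve 3 (λ q r ε → (:- (q :- r)) :+ (q :+ ε) := ε :+ (r :+ con 0ℚ)) refl q₀ (r zero) ε))
  cons-close q₀ q lo hi close (suc i) = close i
  cons-nonzero : ∀ q₀ q → All (q₀ ≢_) (List.map ℚ.-_ (subsums q)) →
    (∀ b → (∃[ i ] b i ≡ true) → subsum b q ≢ 0ℚ) →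
    ∀ b → (∃[ i ] b i ≡ true) → subsum b (cons q₀ q) ≢ 0ℚ
  cons-nonzero q₀ q fresh nonzero b (i , bi) = cases (b zero) refl i bi
    where
    s = subsum (b ∘ suc) q
    cases : ∀ c → b zero ≡ c → ∀ i → b i ≡ true → q₀ when b zero ℚ.+ s ≢ 0ℚ
    cases true  b₀ _ _ eq = All.lookup fresh (∈-map⁺ ℚ.-_ (subsum∈subsums (b ∘ suc) q))
      (trans (solve 2 (λ q s → q := (q :+ s) :+ (:- s)) refl q₀ s)
        (trans (cong (ℚ._- s) (trans (cong (λ c → q₀ when c ℚ.+ s) (sym b₀)) eq)) (ℚ.+-identityˡ (ℚ.- s))))
    cases false b₀ zero    bi eq = true≢false (trans (sym bi) b₀)
      where
      true≢false : true ≢ false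
      true≢false ()
    cases false b₀ (suc i) bi eq = nonzero (b ∘ suc) (i , bi)
      (trans (sym (ℚ.+-identityˡ s)) (trans (cong (λ c → q₀ when c ℚ.+ s) (sym b₀)) eq))

module _ {n : ℕ} where

  point : (Fin (suc n) → ℚ) → Point n
  point q i = fromℚ (q i)

  NonDegenerate : (Fin (suc n) → ℚ) → Set
  NonDegenerate q = (∑ q ≡ 0ℚ) × (∀ b → Mixed b → subsum b q ≢ 0ℚ)

  0<⇒positive-point : ∀ q b → 0ℚ ℚ.< subsum b q → Positive (point q) b
  0<⇒positive-point q b 0<s = subsum b q , 0<s , ev-always λ _ → ℚ.≤-refl

  positive-point⇒0< : ∀ q b → Positive (point q) b → 0ℚ ℚ.< subsum b q
  positive-point⇒0< q b (ε , 0<ε , p) = ℚ.<-≤-trans 0<ε (proj₂ (witness p))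

  subsum-not-zero : ∀ q b → ∑ q ≡ 0ℚ → subsum (not ∘ b) q ≡ ℚ.- subsum {suc n} b q
  subsum-not-zero q b ∑q≡0 = trans (solve 2 (λ s t → t := (s :+ t) :+ (:- s)) refl (subsum b q) (subsum (not ∘ b) q))
    (trans (cong (ℚ._- subsum b q) (trans (subsum-not b q) ∑q≡0)) (ℚ.+-identityˡ (ℚ.- subsum b q)))
    where open +-*-Solver

  point-generic : ∀ q → NonDegenerate q → Generic (point q)
  point-generic q (∑q≡0 , nonzero) = zero⇒V∅ (point q) (λ _ → ∑q≡0) , sign
    where
    sign : ∀ b → Mixed b → Positive (point q) b ⊎ Positive (point q) (not ∘ b)
    sign b mixed = cases (ℚ.<-cmp 0ℚ (subsum b q))
      where
      cases : _ → Positive (point q) b ⊎ Positive (point q) (not ∘ b)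
      cases (tri< 0<s _ _) = inj₁ (0<⇒positive-point q b 0<s)
      cases (tri≈ _ 0≡s _) = ⊥-elim (nonzero b mixed (sym 0≡s))
      cases (tri> _ _ s<0) = inj₂ (0<⇒positive-point q (not ∘ b)
        (subst (0ℚ ℚ.<_) (sym (subsum-not-zero q b ∑q≡0)) (ℚ.neg-antimono-< s<0)))

  -- The zero sum determines coordinate 0. A set containing 0 has minus the sum of its complement,
  -- which avoids 0, so genericity of the other coordinates is enough.
  balance : (Fin n → ℚ) → Fin (suc n) → ℚ
  balance q zero    = ℚ.- ∑ q
  balance q (suc i) = q i

  balance-nonDegenerate : ∀ q → (∀ b → (∃[ i ] b i ≡ true) → subsum b q ≢ 0ℚ) → NonDegenerate (balance q)
  balance-nonDegenerate q nonzero = ∑≡0 , λ { b ((i , bi) , (j , bj)) → cases b (b zero) refl i bi j bj }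
    where
    open +-*-Solver
    ∑≡0 : ∑ (balance q) ≡ 0ℚ
    ∑≡0 = ℚ.+-inverseˡ (∑ q)
    true≢false : true ≢ false
    true≢false ()
    cases : ∀ b c → b zero ≡ c → ∀ i → b i ≡ true → ∀ j → b j ≡ false → subsum b (balance q) ≢ 0ℚ
    cases b true  b₀ i bi zero    bj _ = true≢false (trans (sym b₀) bj)
    cases b true  b₀ i bi (suc j) bj eq = nonzero (not ∘ b ∘ suc) (j , cong not bj) (begin
      t                                   ≡⟨ solve 2 (λ s t → t := :- ((:- (s :+ t)) :+ s)) refl s t ⟩
      ℚ.- (ℚ.- (s ℚ.+ t) ℚ.+ s)           ≡⟨ cong (λ p → ℚ.- (ℚ.- p ℚ.+ s)) (subsum-not (b ∘ suc) q) ⟩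
      ℚ.- (ℚ.- ∑ q ℚ.+ s)                 ≡⟨ cong (λ c → ℚ.- ((ℚ.- ∑ q) when c ℚ.+ s)) (sym b₀) ⟩
      ℚ.- ((ℚ.- ∑ q) when b zero ℚ.+ s)   ≡⟨ cong ℚ.-_ eq ⟩
      ℚ.- 0ℚ                              ∎)
      where
      open ≡-Reasoning
      s = subsum (b ∘ suc) q
      t = subsum (not ∘ b ∘ suc) q
    cases b false b₀ zero    bi j bj _  = true≢false (trans (sym bi) b₀)
    cases b false b₀ (suc i) bi j bj eq = nonzero (b ∘ suc) (i , bi)
      (trans (sym (ℚ.+-identityˡ (subsum (b ∘ suc) q)))
        (trans (cong (λ c → (ℚ.- ∑ q) when c ℚ.+ subsum (b ∘ suc) q) (sym b₀)) eq))

  -- The interior point that comes with a refined chamber may lie on resonance hyperplanes. A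
  -- rational point off all of them is found in the ball around it.
  approximate : ∀ (x : Point n) → x ∈ V∅ → ∀ ε → 0ℚ ℚ.< ε →
    ∃[ q ] NonDegenerate q × point q ∈ Ball ε x
  approximate x x∈V ε 0<ε = from-index (witness settled)
    where
    open +-*-Solver
    -- The error at coordinate 0 is at most n θ from the other coordinates plus `θ` from the sum of
    -- the slice, hence at most ½ ε.
    θ = shrink (suc n) (½ ℚ.* ε)
    0<θ : 0ℚ ℚ.< θ
    0<θ = shrink-pos (suc n) (half-pos 0<ε)
    θ≤½ε : θ ℚ.≤ ½ ℚ.* ε
    θ≤½ε = proj₂ (shrink-≤ (suc n) {½ ℚ.* ε} (ℚ.<⇒≤ (half-pos 0<ε)))
    Settled : ℕ → Set
    Settled m = ∀ i k → m ℕ.≤ k → ∣ slice x k i ℚ.- slice x m i ∣ ℚ.≤ ½ ℚ.* θ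
    settled : Eventually Settled
    settled = ev-all λ i → let N , close = cauchy (x i) (½ ℚ.* θ) (half-pos 0<θ) in
      N , λ m N≤m k m≤k → ℚ.<⇒≤ (close k m (ℕ.≤-trans N≤m m≤k) N≤m)
    from-index : ∃ Settled → ∃[ q ] NonDegenerate q × point q ∈ Ball ε x
    from-index (m , close) = finish (generic-near (slice x m ∘ suc) (½ ℚ.* θ) (half-pos 0<θ))
      where
      finish : ∃[ q ] (∀ i → ∣ q i ℚ.- slice x m (suc i) ∣ ℚ.≤ ½ ℚ.* θ) ×
        (∀ b → (∃[ i ] b i ≡ true) → subsum b q ≢ 0ℚ) →
        ∃[ q ] NonDegenerate q × point q ∈ Ball ε x
      finish (q , q-close , nonzero) = balance q , balance-nonDegenerate q nonzero ,
        close⇒Ball x (point (balance q)) (half-< 0<ε) near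
        where
        triangle : ∀ a b c → ∣ a ℚ.- b ∣ ℚ.≤ ½ ℚ.* θ → ∣ c ℚ.- b ∣ ℚ.≤ ½ ℚ.* θ → ∣ a ℚ.- c ∣ ℚ.≤ θ
        triangle a b c ab cb = abs-≤
          (≤-by (ℚ.+-mono-≤ (ℚ.≤-trans (p≤∣p∣ (a ℚ.- b)) ab) (ℚ.≤-trans (-p≤∣p∣ (c ℚ.- b)) cb))
            (trans (cong ((a ℚ.- c) ℚ.+_) (halves θ))
              (solve 4 (λ a b c θ → (a :- c) :+ θ := θ :+ ((a :- b) :+ (:- (c :- b)))) refl a b c θ)))
          (≤-by (ℚ.+-mono-≤ (ℚ.≤-trans (-p≤∣p∣ (a ℚ.- b)) ab) (ℚ.≤-trans (p≤∣p∣ (c ℚ.- b)) cb))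
            (trans (cong ((ℚ.- (a ℚ.- c)) ℚ.+_) (halves θ))
              (solve 4 (λ a b c θ → (:- (a :- c)) :+ θ := θ :+ ((:- (a :- b)) :+ (c :- b))) refl a b c θ)))
        q-near : ∀ k → m ℕ.≤ k → ∀ i → ∣ q i ℚ.- slice x k (suc i) ∣ ℚ.≤ θ
        q-near k m≤k i = triangle (q i) (slice x m (suc i)) (slice x k (suc i)) (q-close i) (close (suc i) k m≤k)
        0-near : ∀ k → m ℕ.≤ k → ∣ ∑ (slice x k) ∣ ℚ.≤ θ → ∣ ℚ.- ∑ q ℚ.- slice x k zero ∣ ℚ.≤ ½ ℚ.* ε
        0-near k m≤k small = begin
          ∣ ℚ.- ∑ q ℚ.- slice x k zero ∣
            ≡⟨ cong ∣_∣ (solve 3 (λ q a r → (:- q) :- a := (:- (q :- r)) :- (a :+ r))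
                 refl (∑ q) (slice x k zero) (∑ (slice x k ∘ suc))) ⟩
          ∣ ℚ.- (∑ q ℚ.- ∑ (slice x k ∘ suc)) ℚ.- ∑ (slice x k) ∣
            ≤⟨ ℚ.∣p-q∣≤∣p∣+∣q∣ (ℚ.- (∑ q ℚ.- ∑ (slice x k ∘ suc))) (∑ (slice x k)) ⟩
          ∣ ℚ.- (∑ q ℚ.- ∑ (slice x k ∘ suc)) ∣ ℚ.+ ∣ ∑ (slice x k) ∣
            ≡⟨ cong (ℚ._+ ∣ ∑ (slice x k) ∣) (trans (ℚ.∣-p∣≡∣p∣ (∑ q ℚ.- ∑ (slice x k ∘ suc)))
                 (cong ∣_∣ (sym (∑-- q (slice x k ∘ suc))))) ⟩
          ∣ ∑ (λ i → q i ℚ.- slice x k (suc i)) ∣ ℚ.+ ∣ ∑ (slice x k) ∣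
            ≤⟨ ℚ.+-mono-≤ (∑-abs-≤ (λ i → q i ℚ.- slice x k (suc i)) θ (q-near k m≤k)) small ⟩
          n · θ ℚ.+ θ
            ≡⟨ ℚ.+-comm (n · θ) θ ⟩
          suc n · θ
            ≤⟨ ·-shrink (suc n) {½ ℚ.* ε} (ℚ.<⇒≤ (half-pos 0<ε)) ⟩
          ½ ℚ.* ε ∎
          where open ℚ.≤-Reasoning
        near : ∀ i → Eventually λ k → ∣ balance q i ℚ.- slice x k i ∣ ℚ.≤ ½ ℚ.* ε
        near zero    = ev-zip (λ k m≤k small → 0-near k m≤k small) (m , λ k m≤k → m≤k) (V∅⇒small x x∈V θ 0<θ)
        near (suc i) = m , λ k m≤k → ℚ.≤-trans (q-near k m≤k i) θ≤½ε

-- Rotations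

prefix : ∀ {N} → ℕ → Fin N → Bool
prefix m i = does (toℕ i ℕ.<? m)

interval : ∀ {N} → ℕ → ℕ → Fin N → Bool
interval a c i = does ((a ℕ.≤? toℕ i) ×-dec (toℕ i ℕ.<? c))

module _ {n : ℕ} where

  private N = suc n

  rotate : ℕ → Fin N → Fin N
  rotate a i = Fin.fromℕ< (m%n<n (toℕ i ℕ.+ a) N)

  toℕ-rotate : ∀ a i → toℕ (rotate a i) ≡ (toℕ i ℕ.+ a) % N
  toℕ-rotate a i = Fin.toℕ-fromℕ< (m%n<n (toℕ i ℕ.+ a) N)

  rotate-rotate : ∀ a c → a ℕ.+ c ≡ N → ∀ i → rotate c (rotate a i) ≡ i
  rotate-rotate a c a+c≡N i = Fin.toℕ-injective (begin
    toℕ (rotate c (rotate a i))                   ≡⟨ toℕ-rotate c (rotate a i) ⟩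
    (toℕ (rotate a i) ℕ.+ c) % N                  ≡⟨ cong (λ k → (k ℕ.+ c) % N) (toℕ-rotate a i) ⟩
    ((toℕ i ℕ.+ a) % N ℕ.+ c) % N                 ≡⟨ %-distribˡ-+ ((toℕ i ℕ.+ a) % N) c N ⟩
    ((toℕ i ℕ.+ a) % N % N ℕ.+ c % N) % N         ≡⟨ cong (λ k → (k ℕ.+ c % N) % N) (m%n%n≡m%n (toℕ i ℕ.+ a) N) ⟩
    ((toℕ i ℕ.+ a) % N ℕ.+ c % N) % N             ≡⟨ %-distribˡ-+ (toℕ i ℕ.+ a) c N ⟨
    (toℕ i ℕ.+ a ℕ.+ c) % N                       ≡⟨ cong (_% N) (trans (ℕ.+-assoc (toℕ i) a c) (cong (toℕ i ℕ.+_) a+c≡N)) ⟩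
    (toℕ i ℕ.+ N) % N                             ≡⟨ [m+n]%n≡m%n (toℕ i) N ⟩
    toℕ i % N                                     ≡⟨ m<n⇒m%n≡m (Fin.toℕ<n i) ⟩
    toℕ i                                         ∎)
    where open ≡-Reasoning

  -- In q ∘ unrotate a, the entry q 0 stands at position a.
  unrotate : Fin N → Fin N → Fin N
  unrotate a = rotate (N ℕ.∸ toℕ a)

  toℕ≤N : ∀ (a : Fin N) → toℕ a ℕ.≤ N
  toℕ≤N a = ℕ.<⇒≤ (Fin.toℕ<n a)

  unrotate-rotate : ∀ a i → unrotate a (rotate (toℕ a) i) ≡ i
  unrotate-rotate a = rotate-rotate (toℕ a) (N ℕ.∸ toℕ a) (ℕ.m+[n∸m]≡n (toℕ≤N a))

  rotate-unrotate : ∀ a i → rotate (toℕ a) (unrotate a i) ≡ i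
  rotate-unrotate a = rotate-rotate (N ℕ.∸ toℕ a) (toℕ a) (ℕ.m∸n+n≡m (toℕ≤N a))

  ∑-unrotate : ∀ a (v : Fin N → ℚ) → ∑ (v ∘ unrotate a) ≡ ∑ v
  ∑-unrotate a v = sym (sum-permute v
    (permutation (unrotate a) (rotate (toℕ a)) (unrotate-rotate a) (rotate-unrotate a)))

  subsum-unrotate : ∀ a b (q : Fin N → ℚ) → subsum (b ∘ unrotate a) (q ∘ unrotate a) ≡ subsum b q
  subsum-unrotate a b q = ∑-unrotate a (λ i → q i when b i)

  toℕ-unrotate-< : ∀ a i → toℕ i ℕ.< toℕ a → toℕ (unrotate a i) ≡ toℕ i ℕ.+ (N ℕ.∸ toℕ a)
  toℕ-unrotate-< a i i<a = trans (toℕ-rotate (N ℕ.∸ toℕ a) i) (m<n⇒m%n≡m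
    (ℕ.<-≤-trans (ℕ.+-monoˡ-< (N ℕ.∸ toℕ a) i<a) (ℕ.≤-reflexive (ℕ.m+[n∸m]≡n (toℕ≤N a)))))

  toℕ-unrotate-≥ : ∀ a i → toℕ a ℕ.≤ toℕ i → toℕ (unrotate a i) ≡ toℕ i ℕ.∸ toℕ a
  toℕ-unrotate-≥ a i a≤i = begin
    toℕ (unrotate a i)                     ≡⟨ toℕ-rotate (N ℕ.∸ toℕ a) i ⟩
    (toℕ i ℕ.+ (N ℕ.∸ toℕ a)) % N          ≡⟨ cong (_% N) eq ⟩
    ((toℕ i ℕ.∸ toℕ a) ℕ.+ N) % N          ≡⟨ [m+n]%n≡m%n (toℕ i ℕ.∸ toℕ a) N ⟩
    (toℕ i ℕ.∸ toℕ a) % N                  ≡⟨ m<n⇒m%n≡m (ℕ.≤-<-trans (ℕ.m∸n≤m (toℕ i) (toℕ a)) (Fin.toℕ<n i)) ⟩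
    toℕ i ℕ.∸ toℕ a                        ∎
    where
    open ≡-Reasoning
    eq : toℕ i ℕ.+ (N ℕ.∸ toℕ a) ≡ (toℕ i ℕ.∸ toℕ a) ℕ.+ N
    eq = trans (cong (ℕ._+ (N ℕ.∸ toℕ a)) (sym (ℕ.m∸n+n≡m a≤i)))
      (trans (ℕ.+-assoc (toℕ i ℕ.∸ toℕ a) (toℕ a) (N ℕ.∸ toℕ a))
        (cong ((toℕ i ℕ.∸ toℕ a) ℕ.+_) (ℕ.m+[n∸m]≡n (toℕ≤N a))))

  interval≗prefix : ∀ (a c : Fin N) → toℕ a ℕ.< toℕ c →
    prefix (toℕ c ℕ.∸ toℕ a) ∘ unrotate a ≗ interval (toℕ a) (toℕ c)
  interval≗prefix a c a<c i = does-⇔ (mk⇔ (to (toℕ i ℕ.<? toℕ a)) from)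
    (toℕ (unrotate a i) ℕ.<? toℕ c ℕ.∸ toℕ a) ((toℕ a ℕ.≤? toℕ i) ×-dec (toℕ i ℕ.<? toℕ c))
    where
    to : Dec (toℕ i ℕ.< toℕ a) → toℕ (unrotate a i) ℕ.< toℕ c ℕ.∸ toℕ a →
      (toℕ a ℕ.≤ toℕ i) × (toℕ i ℕ.< toℕ c)
    to (yes i<a) lt = ⊥-elim (ℕ.<-irrefl refl (ℕ.≤-<-trans
      (ℕ.m≤n+m (N ℕ.∸ toℕ a) (toℕ i))
      (ℕ.<-≤-trans (subst (ℕ._< toℕ c ℕ.∸ toℕ a) (toℕ-unrotate-< a i i<a) lt)
        (ℕ.∸-monoˡ-≤ (toℕ a) (toℕ≤N c)))))
    to (no i≮a)  lt = a≤i , subst₂ ℕ._<_ (ℕ.m∸n+n≡m a≤i) (ℕ.m∸n+n≡m (ℕ.<⇒≤ a<c))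
      (ℕ.+-monoˡ-< (toℕ a) (subst (ℕ._< toℕ c ℕ.∸ toℕ a) (toℕ-unrotate-≥ a i a≤i) lt))
      where a≤i = ℕ.≮⇒≥ i≮a
    from : (toℕ a ℕ.≤ toℕ i) × (toℕ i ℕ.< toℕ c) → toℕ (unrotate a i) ℕ.< toℕ c ℕ.∸ toℕ a
    from (a≤i , i<c) = subst (ℕ._< toℕ c ℕ.∸ toℕ a) (sym (toℕ-unrotate-≥ a i a≤i))
      (ℕ.∸-monoˡ-< i<c a≤i)

  interval≗suffix : ∀ (a c : Fin N) → toℕ a ℕ.< toℕ c →
    not ∘ prefix (N ℕ.∸ (toℕ c ℕ.∸ toℕ a)) ∘ unrotate c ≗ interval (toℕ a) (toℕ c)
  interval≗suffix a c a<c i = does-⇔ (mk⇔ (to (toℕ i ℕ.<? toℕ c)) from)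
    (¬? (toℕ (unrotate c i) ℕ.<? N ℕ.∸ (toℕ c ℕ.∸ toℕ a)))
    ((toℕ a ℕ.≤? toℕ i) ×-dec (toℕ i ℕ.<? toℕ c))
    where
    bound : N ℕ.∸ (toℕ c ℕ.∸ toℕ a) ≡ toℕ a ℕ.+ (N ℕ.∸ toℕ c)
    bound = begin
      N ℕ.∸ (toℕ c ℕ.∸ toℕ a)
        ≡⟨ cong (ℕ._∸ (toℕ c ℕ.∸ toℕ a)) split ⟩
      (toℕ a ℕ.+ (N ℕ.∸ toℕ c)) ℕ.+ (toℕ c ℕ.∸ toℕ a) ℕ.∸ (toℕ c ℕ.∸ toℕ a)
        ≡⟨ ℕ.m+n∸n≡m (toℕ a ℕ.+ (N ℕ.∸ toℕ c)) (toℕ c ℕ.∸ toℕ a) ⟩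
      toℕ a ℕ.+ (N ℕ.∸ toℕ c) ∎
      where
      open ≡-Reasoning
      split : N ≡ (toℕ a ℕ.+ (N ℕ.∸ toℕ c)) ℕ.+ (toℕ c ℕ.∸ toℕ a)
      split = begin
        N                                                        ≡⟨ ℕ.m∸n+n≡m (toℕ≤N c) ⟨
        (N ℕ.∸ toℕ c) ℕ.+ toℕ c                                  ≡⟨ cong ((N ℕ.∸ toℕ c) ℕ.+_) (ℕ.m+[n∸m]≡n (ℕ.<⇒≤ a<c)) ⟨
        (N ℕ.∸ toℕ c) ℕ.+ (toℕ a ℕ.+ (toℕ c ℕ.∸ toℕ a))          ≡⟨ ℕ.+-assoc (N ℕ.∸ toℕ c) (toℕ a) (toℕ c ℕ.∸ toℕ a) ⟨
        ((N ℕ.∸ toℕ c) ℕ.+ toℕ a) ℕ.+ (toℕ c ℕ.∸ toℕ a)          ≡⟨ cong (ℕ._+ (toℕ c ℕ.∸ toℕ a)) (ℕ.+-comm (N ℕ.∸ toℕ c) (toℕ a)) ⟩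
        (toℕ a ℕ.+ (N ℕ.∸ toℕ c)) ℕ.+ (toℕ c ℕ.∸ toℕ a)          ∎
    to : Dec (toℕ i ℕ.< toℕ c) → ¬ (toℕ (unrotate c i) ℕ.< N ℕ.∸ (toℕ c ℕ.∸ toℕ a)) →
      (toℕ a ℕ.≤ toℕ i) × (toℕ i ℕ.< toℕ c)
    to (yes i<c) ≮ = ℕ.≮⇒≥ (λ i<a → ≮ (subst₂ ℕ._<_ (sym (toℕ-unrotate-< c i i<c)) (sym bound)
      (ℕ.+-monoˡ-< (N ℕ.∸ toℕ c) i<a))) , i<c
    to (no i≮c)  ≮ = ⊥-elim (≮ (subst₂ ℕ._<_ (sym (toℕ-unrotate-≥ c i c≤i)) (sym bound)
      (ℕ.<-≤-trans (ℕ.∸-monoˡ-< (Fin.toℕ<n i) c≤i) (ℕ.m≤n+m (N ℕ.∸ toℕ c) (toℕ a)))))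
      where c≤i = ℕ.≮⇒≥ i≮c
    from : (toℕ a ℕ.≤ toℕ i) × (toℕ i ℕ.< toℕ c) →
      ¬ (toℕ (unrotate c i) ℕ.< N ℕ.∸ (toℕ c ℕ.∸ toℕ a))
    from (a≤i , i<c) lt = ℕ.<-irrefl refl (ℕ.<-≤-trans
      (ℕ.+-cancelʳ-< (N ℕ.∸ toℕ c) (toℕ i) (toℕ a) (subst₂ ℕ._<_ (toℕ-unrotate-< c i i<c) bound lt)) a≤i)

  PrefixPositive : (Fin N → ℚ) → Set
  PrefixPositive q = ∀ m → 0 ℕ.< m → m ℕ.< N → 0ℚ ℚ.< subsum (prefix m) q

  unrotate-nonDegenerate : ∀ a q → NonDegenerate {n} q → NonDegenerate {n} (q ∘ unrotate a)
  unrotate-nonDegenerate a q (∑q≡0 , nonzero) = trans (∑-unrotate a q) ∑q≡0 ,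
    λ { b ((i , bi) , (j , bj)) eq → nonzero (b ∘ rotate (toℕ a))
          ( (unrotate a i , trans (cong b (rotate-unrotate a i)) bi)
          , (unrotate a j , trans (cong b (rotate-unrotate a j)) bj))
          (trans (sym (subsum-unrotate a (b ∘ rotate (toℕ a)) q))
            (trans (subsum-≗ {v = q ∘ unrotate a} (λ i → cong b (rotate-unrotate a i)) λ _ → refl) eq)) }

  interval-mixed : ∀ (a c : Fin N) → toℕ a ℕ.< toℕ c → Mixed {n} (interval (toℕ a) (toℕ c))
  interval-mixed a c a<c =
    (a , dec-true ((toℕ a ℕ.≤? toℕ a) ×-dec (toℕ a ℕ.<? toℕ c)) (ℕ.≤-refl , a<c)) ,
    (c , dec-false ((toℕ a ℕ.≤? toℕ c) ×-dec (toℕ c ℕ.<? toℕ c)) λ (_ , c<c) → ℕ.<-irrefl refl c<c)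

  -- The positions from a up to c - 1 carry a prefix of `q` in the first point and a suffix of `r`
  -- in the second. The prefix has a positive sum; the suffix has minus the sum of a prefix, so a
  -- negative one, which `_≼_` forbids.
  unrotate-≼-≮ : ∀ a c q r → NonDegenerate {n} q → NonDegenerate {n} r → PrefixPositive q → PrefixPositive r →
    point (q ∘ unrotate a) ≼ point (r ∘ unrotate c) → ¬ (toℕ a ℕ.< toℕ c)
  unrotate-≼-≮ a c q r (∑q≡0 , _) (∑r≡0 , _) q-pos r-pos ≼ a<c = ℚ.<-irrefl refl
    (ℚ.<-trans 0<suffix (subst (ℚ._< 0ℚ) (sym (subsum-not-zero r (prefix l) ∑r≡0))
      (ℚ.neg-antimono-< (r-pos l 0<l l<N))))
    where
    k = toℕ c ℕ.∸ toℕ a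
    l = N ℕ.∸ k
    I = interval (toℕ a) (toℕ c)
    0<k : 0 ℕ.< k
    0<k = ℕ.m<n⇒0<n∸m a<c
    k<N : k ℕ.< N
    k<N = ℕ.≤-<-trans (ℕ.m∸n≤m (toℕ c) (toℕ a)) (Fin.toℕ<n c)
    0<l : 0 ℕ.< l
    0<l = ℕ.m<n⇒0<n∸m k<N
    l<N : l ℕ.< N
    l<N = ℕ.∸-monoʳ-< 0<k (ℕ.<⇒≤ k<N)
    subsum-I : ∀ d p b → b ∘ unrotate d ≗ I → subsum I (p ∘ unrotate d) ≡ subsum b p
    subsum-I d p b eq = trans (subsum-≗ {v = p ∘ unrotate d} (sym ∘ eq) λ _ → refl) (subsum-unrotate d b p)
    0<prefix : 0ℚ ℚ.< subsum I (q ∘ unrotate a)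
    0<prefix = subst (0ℚ ℚ.<_) (sym (subsum-I a q (prefix k) (interval≗prefix a c a<c))) (q-pos k 0<k k<N)
    0<suffix : 0ℚ ℚ.< subsum (not ∘ prefix l) r
    0<suffix = subst (0ℚ ℚ.<_) (subsum-I c r (not ∘ prefix l) (interval≗suffix a c a<c))
      (positive-point⇒0< (r ∘ unrotate c) I (≼ I (interval-mixed a c a<c)
        (0<⇒positive-point (q ∘ unrotate a) I 0<prefix)))

  unrotate-≼-cancel : ∀ a q r → point (q ∘ unrotate a) ≼ point (r ∘ unrotate a) → point q ≼ point r
  unrotate-≼-cancel a q r ≼ b ((i , bi) , (j , bj)) p = 0<⇒positive-point r b
    (subst (0ℚ ℚ.<_) (subsum-unrotate a b r) (positive-point⇒0< (r ∘ unrotate a) (b ∘ unrotate a)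
      (≼ (b ∘ unrotate a)
        ( (rotate (toℕ a) i , trans (cong b (unrotate-rotate a i)) bi)
        , (rotate (toℕ a) j , trans (cong b (unrotate-rotate a j)) bj))
        (0<⇒positive-point (q ∘ unrotate a) (b ∘ unrotate a)
          (subst (0ℚ ℚ.<_) (sym (subsum-unrotate a b q)) (positive-point⇒0< q b p))))))

  rootCone⇒prefixPositive : ∀ t q → NonDegenerate {n} q → point q ∈ RootCone t → PrefixPositive q
  rootCone⇒prefixPositive t q nd q∈cone (suc m) _ m<N = positive-point⇒0< q (prefix (suc m))
    (closed⇒positive t (point q) (prefix (suc m)) (point-generic q nd) q∈cone mixed closed)
    where
    mixed : Mixed {n} (prefix (suc m))
    mixed = (zero , refl) , (Fin.fromℕ< m<N , dec-false (toℕ (Fin.fromℕ< m<N) ℕ.<? suc m)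
      λ lt → ℕ.<-irrefl (Fin.toℕ-fromℕ< m<N) lt)
    closed : Flow.Closed (graph t) (prefix (suc m))
    closed i j ij j<m = dec-true (toℕ i ℕ.<? suc m)
      (ℕ.<-trans (positive t (≡⇒T ij)) (ℕ.<ᵇ⇒< (toℕ j) (suc m) (≡⇒T j<m)))

-- Kostant chambers and resonance chambers

injective₂⇒≤ : ∀ {m n r} (f : Fin m → Fin n → Fin r) →
  (∀ i a j c → f i a ≡ f j c → a ≡ c) → (∀ i j a → f i a ≡ f j a → i ≡ j) → m ℕ.* n ℕ.≤ r
injective₂⇒≤ {m} {n} f injʳ injˡ = Fin.injective⇒≤ {f = λ i → f (Fin.quotient {m} n i) (Fin.remainder {m} n i)}
  λ {i} {j} eq → let r = injʳ _ _ _ _ eq in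
    trans (sym (Fin.combine-remQuot {m} n i))
      (trans (cong₂ Fin.combine (injˡ _ _ _ (trans eq (cong (f _) (sym r)))) r) (Fin.combine-remQuot {m} n j))

module _ {n : ℕ} where

  interior-mono : {P Q : Pred (Point n) 0ℓ} → (∀ x → P x → Q x) → ∀ x → Interior P x → Interior Q x
  interior-mono P⊆Q x (x∈V , ε , 0<ε , near) = x∈V , ε , 0<ε , λ y y∈V y∈ → P⊆Q y (near y y∈V y∈)

  coneIntersection-≼ : ∀ (ts : List⁺ (PositiveAlternatingTree (suc n))) x y →
    Generic x → ConeIntersection ts x → y ∈ V∅ → x ≼ y → ConeIntersection ts y
  coneIntersection-≼ ts x y generic x∈ y∈V x≼y =
    All.map (λ {t} x∈t → rootCone-≼ t x y generic x∈t y∈V x≼y) x∈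

  ∩-++ : ∀ (ts us : List⁺ (PositiveAlternatingTree (suc n))) x →
    ConeIntersection ts x → ConeIntersection us x → ConeIntersection (ts ⁺++⁺ us) x
  ∩-++ (t ∷ ts) (u ∷ us) x p q = All.++⁺ p q

  ∩-++ˡ : ∀ (ts us : List⁺ (PositiveAlternatingTree (suc n))) x →
    ConeIntersection (ts ⁺++⁺ us) x → ConeIntersection ts x
  ∩-++ˡ (t ∷ ts) (u ∷ us) x p = All.++⁻ˡ (t ∷ ts) p

  ∩-++ʳ : ∀ (ts us : List⁺ (PositiveAlternatingTree (suc n))) x →
    ConeIntersection (ts ⁺++⁺ us) x → ConeIntersection us x
  ∩-++ʳ (t ∷ ts) (u ∷ us) x p = All.++⁻ʳ (t ∷ ts) p

  -- A rational point representing a refined chamber. Membership in the cones is recorded instead of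
  -- membership in their interior, which can be recovered: points near a nondegenerate point lie in
  -- its resonance chamber and so in the same cones.
  Sample : Pred (Point n) 0ℓ → Set
  Sample P = Σ[ ts ∈ List⁺ (PositiveAlternatingTree (suc n)) ] Σ[ q ∈ (Fin (suc n) → ℚ) ]
    (P ≐ Interior (ConeIntersection ts)) × NonDegenerate q × ConeIntersection ts (point q)

  trees : ∀ P → Sample P → List⁺ (PositiveAlternatingTree (suc n))
  trees _ (ts , _) = ts

  coords : ∀ P → Sample P → Fin (suc n) → ℚ
  coords _ (_ , q , _) = q

  chamber : ∀ P (s : Sample P) → P ≐ Interior (ConeIntersection (trees P s))
  chamber _ (_ , _ , c , _) = c

  nonDegenerate : ∀ P (s : Sample P) → NonDegenerate (coords P s)
  nonDegenerate _ (_ , _ , _ , nd , _) = nd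

  in-cones : ∀ P (s : Sample P) → ConeIntersection (trees P s) (point (coords P s))
  in-cones _ (_ , _ , _ , _ , p) = p

  sample : ∀ P → IsRefinedChamber P → Sample P
  sample P (ts , (x , x∈V , ε , 0<ε , near) , P≐) = from (approximate x x∈V ε 0<ε)
    where
    from : ∃[ q ] NonDegenerate q × point q ∈ Ball ε x → Sample P
    from (q , nd , q∈Ball) =
      ts , q , P≐ , nd , near (point q) (proj₁ (point-generic q nd)) q∈Ball

  prefixPositive : ∀ P (s : Sample P) → PrefixPositive (coords P s)
  prefixPositive P s = positive-on (trees P s) (in-cones P s)
    where
    positive-on : ∀ ts → ConeIntersection ts (point (coords P s)) → PrefixPositive (coords P s)
    positive-on (t ∷ _) (q∈t ∷ _) = rootCone⇒prefixPositive t (coords P s) (nonDegenerate P s) q∈t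

  -- Both chambers contain the refined chamber of all their trees together.
  sample-≼⇒≐ : ∀ P Q → IsKostantChamber P → IsKostantChamber Q → (s : Sample P) (r : Sample Q) →
    point (coords Q r) ≼ point (coords P s) → P ≐ Q
  sample-≼⇒≐ P Q (_ , P-minimal) (_ , Q-minimal) s r r≼s =
    ≐-trans (≐-sym (P-minimal M M-refined M⊆P)) (Q-minimal M M-refined M⊆Q)
    where
    x y : Point n
    x = point (coords P s)
    y = point (coords Q r)
    x-generic : Generic x
    x-generic = point-generic (coords P s) (nonDegenerate P s)
    both = trees P s ⁺++⁺ trees Q r
    M : Pred (Point n) 0ℓ
    M = Interior (ConeIntersection both)
    in-both : ∀ z → z ∈ V∅ → x ≼ z → ConeIntersection both z
    in-both z z∈V x≼z = ∩-++ (trees P s) (trees Q r) z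
      (coneIntersection-≼ (trees P s) x z x-generic (in-cones P s) z∈V x≼z)
      (coneIntersection-≼ (trees Q r) y z (point-generic (coords Q r) (nonDegenerate Q r)) (in-cones Q r) z∈V
        (λ b mixed p → x≼z b mixed (r≼s b mixed p)))
    -- Near `x` all points of `V∅` lie in its resonance chamber, hence in the cones of both lists,
    -- so `M` is full-dimensional.
    x∈M : x ∈ M
    x∈M = let ε , 0<ε , near = ≼-near x x-generic in
      proj₁ x-generic , ε , 0<ε , λ z z∈V z∈ → in-both z z∈V (near z z∈)
    M-refined : IsRefinedChamber M
    M-refined = both , (x , x∈M) , id , id
    M⊆P : M ⊆ P
    M⊆P {z} z∈M = proj₂ (chamber P s) (interior-mono (λ w → ∩-++ˡ (trees P s) (trees Q r) w) z z∈M)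
    M⊆Q : M ⊆ Q
    M⊆Q {z} z∈M = proj₂ (chamber Q r) (interior-mono (λ w → ∩-++ʳ (trees P s) (trees Q r) w) z z∈M)

  module _ {K R : ℕ} (kostant : HasCardinality (kostantChambers n) K)
    (resonance : HasCardinality (resonanceChambers n) R) where

    private
      module 𝒦 = Bijection kostant
      module ℛ = Bijection resonance
      module C = Setoid (resonanceChambers n)

      𝒫 : Fin K → Pred (Point n) 0ℓ
      𝒫 j = proj₁ (𝒦.to j)

      sampleOf : ∀ j → Sample (𝒫 j)
      sampleOf j = sample (𝒫 j) (proj₁ (proj₂ (𝒦.to j)))

      rotated : Fin K → Fin (suc n) → Fin (suc n) → ℚ
      rotated j a = coords (𝒫 j) (sampleOf j) ∘ unrotate a

      chamberOf : Fin K → Fin (suc n) → C.Carrier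
      chamberOf j a = point (rotated j a) , generic⇒complement (point (rotated j a))
        (point-generic (rotated j a)
          (unrotate-nonDegenerate a (coords (𝒫 j) (sampleOf j)) (nonDegenerate (𝒫 j) (sampleOf j))))

      index : Fin K → Fin (suc n) → Fin R
      index j a = proj₁ (ℛ.surjective (chamberOf j a))

      index-≈ : ∀ j a → ℛ.to (index j a) C.≈ chamberOf j a
      index-≈ j a = proj₂ (ℛ.surjective (chamberOf j a)) refl

      index-≡⇒≈ : ∀ j a k c → index j a ≡ index k c → chamberOf j a C.≈ chamberOf k c
      index-≡⇒≈ j a k c eq = C.trans {chamberOf j a} {ℛ.to (index j a)} {chamberOf k c}
        (C.sym {ℛ.to (index j a)} {chamberOf j a} (index-≈ j a))
        (subst (λ i → ℛ.to i C.≈ chamberOf k c) (sym eq) (index-≈ k c))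

      ≈⇒≼ : ∀ j a k c → chamberOf j a C.≈ chamberOf k c → point (rotated j a) ≼ point (rotated k c)
      ≈⇒≼ j a k c = component⇒≼ (point (rotated j a)) (point (rotated k c))

      index-≡⇒≼ : ∀ j a k c → index j a ≡ index k c → point (rotated j a) ≼ point (rotated k c)
      index-≡⇒≼ j a k c eq = ≈⇒≼ j a k c (index-≡⇒≈ j a k c eq)

      ≼⇒≮ : ∀ j a k c → index j a ≡ index k c → ¬ (toℕ a ℕ.< toℕ c)
      ≼⇒≮ j a k c eq = unrotate-≼-≮ a c (coords (𝒫 j) (sampleOf j)) (coords (𝒫 k) (sampleOf k))
        (nonDegenerate (𝒫 j) (sampleOf j)) (nonDegenerate (𝒫 k) (sampleOf k))
        (prefixPositive (𝒫 j) (sampleOf j)) (prefixPositive (𝒫 k) (sampleOf k)) (index-≡⇒≼ j a k c eq)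

      same-rotation : ∀ j a k c → index j a ≡ index k c → a ≡ c
      same-rotation j a k c eq = Fin.toℕ-injective (ℕ.≤-antisym
        (ℕ.≮⇒≥ (≼⇒≮ k c j a (sym eq))) (ℕ.≮⇒≥ (≼⇒≮ j a k c eq)))

      same-chamber : ∀ j k a → index j a ≡ index k a → j ≡ k
      same-chamber j k a eq = 𝒦.injective (sample-≼⇒≐ (𝒫 j) (𝒫 k)
        (proj₂ (𝒦.to j)) (proj₂ (𝒦.to k)) (sampleOf j) (sampleOf k)
        (unrotate-≼-cancel a (coords (𝒫 k) (sampleOf k)) (coords (𝒫 j) (sampleOf j)) (index-≡⇒≼ k a j a (sym eq))))

    K*suc[n]≤R : K ℕ.* suc n ℕ.≤ R
    K*suc[n]≤R = injective₂⇒≤ index same-rotation same-chamber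

-- Sums over all subsets

∑ₛ : ∀ {n} → (Subset n → ℚ) → ℚ
∑ₛ {zero}  f = f []
∑ₛ {suc n} f = ∑ₛ (f ∘ (false ∷_)) ℚ.+ ∑ₛ (f ∘ (true ∷_))

count : ∀ {n} → (Subset n → Bool) → ℕ
count {zero}  p = if p [] then 1 else 0
count {suc n} p = count (p ∘ (false ∷_)) ℕ.+ count (p ∘ (true ∷_))

∑ₛ-cong : ∀ {n} {f g : Subset n → ℚ} → f ≗ g → ∑ₛ f ≡ ∑ₛ g
∑ₛ-cong {zero}  f≗g = f≗g []
∑ₛ-cong {suc n} f≗g = cong₂ ℚ._+_ (∑ₛ-cong (f≗g ∘ (false ∷_))) (∑ₛ-cong (f≗g ∘ (true ∷_)))

∑ₛ-mono : ∀ {n} {f g : Subset n → ℚ} → (∀ A → f A ℚ.≤ g A) → ∑ₛ f ℚ.≤ ∑ₛ g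
∑ₛ-mono {zero}  f≤g = f≤g []
∑ₛ-mono {suc n} f≤g = ℚ.+-mono-≤ (∑ₛ-mono (f≤g ∘ (false ∷_))) (∑ₛ-mono (f≤g ∘ (true ∷_)))

+-≡⇒≡ : ∀ {a b c d} → a ℚ.≤ c → b ℚ.≤ d → a ℚ.+ b ≡ c ℚ.+ d → a ≡ c × b ≡ d
+-≡⇒≡ {a} {b} {c} {d} a≤c b≤d eq =
  ℚ.≤-antisym a≤c (ℚ.≮⇒≥ λ a<c → ℚ.<-irrefl eq (ℚ.+-mono-<-≤ a<c b≤d)) ,
  ℚ.≤-antisym b≤d (ℚ.≮⇒≥ λ b<d → ℚ.<-irrefl eq (ℚ.+-mono-≤-< a≤c b<d))

∑ₛ-≡⇒≗ : ∀ {n} {f g : Subset n → ℚ} → (∀ A → f A ℚ.≤ g A) → ∑ₛ f ≡ ∑ₛ g → f ≗ g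
∑ₛ-≡⇒≗ {zero}  f≤g eq []          = eq
∑ₛ-≡⇒≗ {suc n} {f} {g} f≤g eq A = go A
  (+-≡⇒≡ {∑ₛ (f ∘ (false ∷_))} {∑ₛ (f ∘ (true ∷_))} {∑ₛ (g ∘ (false ∷_))} {∑ₛ (g ∘ (true ∷_))}
    (∑ₛ-mono (f≤g ∘ (false ∷_))) (∑ₛ-mono (f≤g ∘ (true ∷_))) eq)
  where
  go : ∀ A → ∑ₛ (f ∘ (false ∷_)) ≡ ∑ₛ (g ∘ (false ∷_)) × ∑ₛ (f ∘ (true ∷_)) ≡ ∑ₛ (g ∘ (true ∷_)) →
    f A ≡ g A
  go (false ∷ A) (eq , _) = ∑ₛ-≡⇒≗ (f≤g ∘ (false ∷_)) eq A
  go (true ∷ A)  (_ , eq) = ∑ₛ-≡⇒≗ (f≤g ∘ (true ∷_)) eq A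

∑-∑ₛ : ∀ {m n} (f : Fin m → Subset n → ℚ) → ∑ (λ i → ∑ₛ (f i)) ≡ ∑ₛ (λ A → ∑ λ i → f i A)
∑-∑ₛ {n = zero}  f = refl
∑-∑ₛ {n = suc n} f = trans
  (∑-distrib-+ (λ i → ∑ₛ (f i ∘ (false ∷_))) (λ i → ∑ₛ (f i ∘ (true ∷_))))
  (cong₂ ℚ._+_ (∑-∑ₛ (λ i → f i ∘ (false ∷_))) (∑-∑ₛ (λ i → f i ∘ (true ∷_))))

count-· : ∀ {n} (p : Subset n → Bool) r → count p · r ≡ ∑ₛ (λ A → r when p A)
count-· {zero} p r = cases (p [])
  where
  cases : ∀ b → (if b then 1 else 0) · r ≡ r when b
  cases true  = ℚ.+-identityʳ r
  cases false = refl
count-· {suc n} p r = trans (×-homo-+ r (count (p ∘ (false ∷_))) (count (p ∘ (true ∷_))))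
  (cong₂ ℚ._+_ (count-· (p ∘ (false ∷_)) r) (count-· (p ∘ (true ∷_)) r))

count-none : ∀ {n} (p : Subset n → Bool) → (∀ A → p A ≡ false) → count p ≡ 0
count-none {zero}  p none = cong (if_then 1 else 0) (none [])
count-none {suc n} p none = cong₂ ℕ._+_ (count-none (p ∘ (false ∷_)) (none ∘ (false ∷_)))
  (count-none (p ∘ (true ∷_)) (none ∘ (true ∷_)))

m+m≡2*m : ∀ m → m ℕ.+ m ≡ 2 ℕ.* m
m+m≡2*m m = cong (m ℕ.+_) (sym (ℕ.+-identityʳ m))

count≤2^n : ∀ {n} (p : Subset n → Bool) → count p ℕ.≤ 2 ^ n
count≤2^n {zero} p = cases (p [])
  where
  cases : ∀ b → (if b then 1 else 0) ℕ.≤ 1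
  cases true  = ℕ.≤-refl
  cases false = ℕ.z≤n
count≤2^n {suc n} p = ℕ.≤-trans
  (ℕ.+-mono-≤ (count≤2^n (p ∘ (false ∷_))) (count≤2^n (p ∘ (true ∷_)))) (ℕ.≤-reflexive (m+m≡2*m (2 ^ n)))

count-containing : ∀ {n} i (p : Subset (suc n) → Bool) →
  (∀ A → lookup A i ≡ false → p A ≡ false) → count p ℕ.≤ 2 ^ n
count-containing zero p off = ℕ.≤-trans
  (ℕ.≤-reflexive (cong (ℕ._+ count (p ∘ (true ∷_)))
    (count-none (p ∘ (false ∷_)) λ A → off (false ∷ A) refl)))
  (count≤2^n (p ∘ (true ∷_)))
count-containing {suc n} (suc i) p off = ℕ.≤-trans
  (ℕ.+-mono-≤ (count-containing i (p ∘ (false ∷_)) (off ∘ (false ∷_)))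
              (count-containing i (p ∘ (true ∷_)) (off ∘ (true ∷_))))
  (ℕ.≤-reflexive (m+m≡2*m (2 ^ n)))

-- Chow parameters

module _ {n : ℕ} where

  chow : (Subset n → Bool) → Fin n → ℕ
  chow S i = count λ A → S A ∧ lookup A i

  chow-· : ∀ S (v : Fin n → ℚ) → ∑ (λ i → chow S i · v i) ≡ ∑ₛ (λ A → subsum (lookup A) v when S A)
  chow-· S v = trans (sum-cong-≗ λ i → count-· (λ A → S A ∧ lookup A i) (v i))
    (trans (∑-∑ₛ (λ i A → v i when (S A ∧ lookup A i))) (∑ₛ-cong λ A → cases A (S A)))
    where
    cases : ∀ A b → ∑ (λ i → v i when (b ∧ lookup A i)) ≡ subsum (lookup A) v when b
    cases A true  = refl
    cases A false = sum-replicate-zero n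

  -- The value `false` allows the sum 0, which the empty set has.
  SignOf : Bool → ℚ → Set
  SignOf b p = (b ≡ true → 0ℚ ℚ.< p) × (b ≡ false → p ℚ.≤ 0ℚ)

  when-≤-when : ∀ b c p → SignOf b p → p when c ℚ.≤ p when b
  when-≤-when true  true  p _          = ℚ.≤-refl
  when-≤-when true  false p (pos , _)  = ℚ.<⇒≤ (pos refl)
  when-≤-when false true  p (_ , nonp) = nonp refl
  when-≤-when false false p _          = ℚ.≤-refl

  when-injective : ∀ b c p → p ≢ 0ℚ → p when b ≡ p when c → b ≡ c
  when-injective true  true  p p≢0 eq = refl
  when-injective true  false p p≢0 eq = ⊥-elim (p≢0 eq)
  when-injective false true  p p≢0 eq = ⊥-elim (p≢0 (sym eq))
  when-injective false false p p≢0 eq = refl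

  -- ∑ᵢ chow T i · v i = ∑_{T A} v(A) is largest for T = S, where v(A) > 0 exactly if S A.
  chow-determines : ∀ S T (v : Fin n → ℚ) → (∀ A → SignOf (S A) (subsum (lookup A) v)) →
    chow S ≗ chow T → ∀ A → subsum (lookup A) v ≢ 0ℚ → S A ≡ T A
  chow-determines S T v signs eq A nonzero = when-injective (S A) (T A) (subsum (lookup A) v) nonzero
    -- Equal Chow parameters make `T` attain the maximum too. The comparison holds term by term, so
    -- equality of the totals forces equality of every term.
    (sym (∑ₛ-≡⇒≗ (λ A → when-≤-when (S A) (T A) (subsum (lookup A) v) (signs A)) sums≡ A))
    where
    sums≡ : ∑ₛ (λ A → subsum (lookup A) v when T A) ≡ ∑ₛ (λ A → subsum (lookup A) v when S A)
    sums≡ = trans (sym (chow-· T v)) (trans (sum-cong-≗ λ i → cong (_· v i) (sym (eq i))) (chow-· S v))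

  -- The subsets of {1, …, n} stand for all: complements of others have opposite sign.
  without0 : Subset n → Fin (suc n) → Bool
  without0 A = lookup (false ∷ A)

  signOf : ∀ {b} (x : Point n) → Dec (Mixed b) → (Mixed b → Positive x b ⊎ Positive x (not ∘ b)) → Bool
  -- For a set `without0 A` this is the case of the empty set; the default agrees with its sum 0 in
  -- `SignOf`.
  signOf x (no _)  sign = false
  signOf x (yes m) sign = [ (λ _ → true) , (λ _ → false) ]′ (sign m)

  signs : ∀ x → Generic x → Subset n → Bool
  signs x (_ , sign) A = signOf x (mixed? (without0 A)) (sign (without0 A))

  signOf-true : ∀ {b} (x : Point n) (m? : Dec (Mixed b)) sign → signOf x m? sign ≡ true → Positive x b
  signOf-true {b} x (yes m) sign = cases (sign m)
    where
    cases : (s : Positive x b ⊎ Positive x (not ∘ b)) →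
      [ (λ _ → true) , (λ _ → false) ]′ s ≡ true → Positive x b
    cases (inj₁ p) _ = p
    cases (inj₂ _) ()

  signOf-false : ∀ {b} (x : Point n) (m? : Dec (Mixed b)) sign → signOf x m? sign ≡ false →
    Mixed b → Positive x (not ∘ b)
  signOf-false {b} x (no ¬m) sign _ m = ⊥-elim (¬m m)
  signOf-false {b} x (yes m) sign eq _ = cases (sign m) eq
    where
    cases : (s : Positive x b ⊎ Positive x (not ∘ b)) →
      [ (λ _ → true) , (λ _ → false) ]′ s ≡ false → Positive x (not ∘ b)
    cases (inj₁ _) ()
    cases (inj₂ q) _ = q

  signs-true : ∀ x g A → signs x g A ≡ true → Positive x (without0 A)
  signs-true x (_ , sign) A = signOf-true x (mixed? (without0 A)) (sign (without0 A))

  signs-false : ∀ x g A → signs x g A ≡ false → Mixed (without0 A) → Positive x (not ∘ without0 A)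
  signs-false x (_ , sign) A = signOf-false x (mixed? (without0 A)) (sign (without0 A))

  signs-agree⇒≼ : ∀ x y (g : Generic x) (h : Generic y) →
    (∀ A → Mixed (without0 A) → signs x g A ≡ signs y h A) → x ≼ y
  signs-agree⇒≼ x y g h agree b mixed p = cases (b zero) refl
    where
    from : ∀ A (s : Bool) → signs x g A ≡ s → Mixed (without0 A) →
      (Positive x (without0 A) → Positive y (without0 A)) ×
      (Positive x (not ∘ without0 A) → Positive y (not ∘ without0 A))
    from A true  eq m = (λ _ → signs-true y h A (trans (sym (agree A m)) eq)) ,
      λ q → ⊥-elim (positive-asym x (without0 A) (proj₁ g) (signs-true x g A eq) q)
    from A false eq m =
      (λ q → ⊥-elim (positive-asym x (without0 A) (proj₁ g) q (signs-false x g A eq m))) ,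
      λ _ → signs-false y h A (trans (sym (agree A m)) eq) m
    mixed-≗ : ∀ {c d : Fin (suc n) → Bool} → c ≗ d → Mixed c → Mixed d
    mixed-≗ c≗d ((i , ci) , (j , cj)) = (i , trans (sym (c≗d i)) ci) , (j , trans (sym (c≗d j)) cj)
    not-involutive : ∀ c → not (not c) ≡ c
    not-involutive true  = refl
    not-involutive false = refl
    cases : ∀ c → b zero ≡ c → Positive y b
    cases false b₀ = positive-≗ y {without0 A} {b} A≗b
      (proj₁ (from A (signs x g A) refl (mixed-≗ (sym ∘ A≗b) mixed)) (positive-≗ x {b} {without0 A} (sym ∘ A≗b) p))
      where
      A = tabulate (b ∘ suc)
      A≗b : without0 A ≗ b
      A≗b zero    = sym b₀
      A≗b (suc i) = Vec.lookup∘tabulate (b ∘ suc) i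
    cases true  b₀ = positive-≗ y {not ∘ without0 A} {b} not-A≗b
      (proj₂ (from A (signs x g A) refl (mixed-≗ (sym ∘ A≗not-b) (mixed-not mixed)))
        (positive-≗ x {b} {not ∘ without0 A} (sym ∘ not-A≗b) p))
      where
      A = tabulate (not ∘ b ∘ suc)
      A≗not-b : without0 A ≗ not ∘ b
      A≗not-b zero    = sym (cong not b₀)
      A≗not-b (suc i) = Vec.lookup∘tabulate (not ∘ b ∘ suc) i
      not-A≗b : not ∘ without0 A ≗ b
      not-A≗b i = trans (cong not (A≗not-b i)) (not-involutive (b i))

  -- For the signs of a real point, `v` is its slice at an index from which all of the finitely many
  -- sums have settled signs. This brings the comparison of Chow parameters down to ℚ.
  Realizes : (Subset n → Bool) → (Fin n → ℚ) → Set
  Realizes S v = ∀ A → SignOf (S A) (subsum (lookup A) v) × (Mixed (without0 A) → subsum (lookup A) v ≢ 0ℚ)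

  ¬mixed⇒zero : ∀ A (v : Fin n → ℚ) → ¬ Mixed (without0 A) → subsum (lookup A) v ≡ 0ℚ
  ¬mixed⇒zero A v ¬m = ∑-zero _ λ i → cases i (lookup A i) refl
    where
    cases : ∀ i c → lookup A i ≡ c → v i when lookup A i ≡ 0ℚ
    cases i true  eq = ⊥-elim (¬m ((suc i , eq) , (zero , refl)))
    cases i false eq = cong (v i when_) eq

  signs-realized : ∀ x g → ∃[ v ] Realizes (signs x g) v
  signs-realized x g = let k , real = witness (ev-all-Subset λ A → at A (signs x g A) refl (mixed? (without0 A)))
    in slice x k ∘ suc , real
    where
    At : Subset n → Bool → ℕ → Set
    At A s k = SignOf s (subsum (lookup A) (slice x k ∘ suc)) ×
      (Mixed (without0 A) → subsum (lookup A) (slice x k ∘ suc) ≢ 0ℚ)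
    at : ∀ A s → signs x g A ≡ s → Dec (Mixed (without0 A)) → Eventually (At A (signs x g A))
    at A true eq _ = subst (λ s → Eventually (At A s)) (sym eq) (positive-at (signs-true x g A eq))
      where
      positive-at : Positive x (without0 A) → Eventually (At A true)
      positive-at (ε , 0<ε , p) = ev-map (λ k ε≤ → at-k k (ℚ.<-≤-trans 0<ε ε≤)) p
        where
        at-k : ∀ k → 0ℚ ℚ.< subsum (without0 A) (slice x k) → At A true k
        at-k k 0<s = ((λ _ → 0<t) , λ ()) , λ _ t≡0 → ℚ.<-irrefl (sym t≡0) 0<t
          where
          0<t = subst (0ℚ ℚ.<_) (ℚ.+-identityˡ (subsum (lookup A) (slice x k ∘ suc))) 0<s
    at A false eq (yes m) = subst (λ s → Eventually (At A s)) (sym eq)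
      (negative-at (positive-not⇒negative x (without0 A) (proj₁ g) (signs-false x g A eq m)))
      where
      negative-at : Negative x (without0 A) → Eventually (At A false)
      negative-at (ε , 0<ε , p) = ev-map (λ k le → at-k k (negative (subsum (without0 A) (slice x k)) le)) p
        where
        negative : ∀ s → s ℚ.+ ε ℚ.≤ 0ℚ → s ℚ.< 0ℚ
        negative s le = ℚ.<-≤-trans (subst (ℚ._< s ℚ.+ ε) (ℚ.+-identityʳ s) (ℚ.+-monoʳ-< s 0<ε)) le
        at-k : ∀ k → subsum (without0 A) (slice x k) ℚ.< 0ℚ → At A false k
        at-k k s<0 = ((λ ()) , λ _ → ℚ.<⇒≤ t<0) , λ _ t≡0 → ℚ.<-irrefl t≡0 t<0
          where
          t<0 = subst (ℚ._< 0ℚ) (ℚ.+-identityˡ (subsum (lookup A) (slice x k ∘ suc))) s<0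
    at A false eq (no ¬m) = subst (λ s → Eventually (At A s)) (sym eq) (ev-always λ k →
      ((λ ()) , λ _ → ℚ.≤-reflexive (¬mixed⇒zero A (slice x k ∘ suc) ¬m)) , λ m → ⊥-elim (¬m m))

  -- The coding is left abstract because n = 2 uses the signs themselves and larger n the Chow
  -- parameters. Equal codes give equal signs, and these put two representatives into the same
  -- component.
  resonance-≤ : ∀ {R M} → HasCardinality (resonanceChambers n) R → (code : (Subset n → Bool) → Fin M) →
    (∀ S T v → Realizes S v → code S ≡ code T → ∀ A → Mixed (without0 A) → S A ≡ T A) → R ℕ.≤ M
  resonance-≤ {R} resonance code determines = Fin.injective⇒≤ {f = λ i → code (S i)}
    λ {i} {j} eq → ℛ.injective (≼⇒component (x i) (x j) (g i) (proj₁ (g j))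
      (signs-agree⇒≼ (x i) (x j) (g i) (g j)
        (determines (S i) (S j) (proj₁ (signs-realized (x i) (g i))) (proj₂ (signs-realized (x i) (g i))) eq)))
    where
    module ℛ = Bijection resonance
    x : Fin R → Point n
    x i = proj₁ (ℛ.to i)
    g : ∀ i → Generic (x i)
    g i = complement⇒generic (x i) (proj₂ (ℛ.to i))
    S : Fin R → Subset n → Bool
    S i = signs (x i) (g i)

-- Counting resonance chambers

^-distribʳ-* : ∀ m n k → (m ℕ.* n) ^ k ≡ (m ^ k) ℕ.* (n ^ k)
^-distribʳ-* m n zero    = refl
^-distribʳ-* m n (suc k) = trans (cong (m ℕ.* n ℕ.*_) (^-distribʳ-* m n k))
  (ℕ.[m*n]*[o*p]≡[m*o]*[n*p] m n (m ^ k) (n ^ k))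

resonance-≤-chow : ∀ {n R} → HasCardinality (resonanceChambers (suc n)) R → R ℕ.≤ suc (2 ^ n) ^ suc n
resonance-≤-chow {n} resonance = resonance-≤ resonance code determines
  where
  -- A Chow parameter has the 2^n + 1 possible values 0, ..., 2^n, since half of the subsets of n +
  -- 1 elements contain `i`.
  bound : ∀ S i → chow S i ℕ.< suc (2 ^ n)
  bound S i = ℕ.s≤s (count-containing i (λ A → S A ∧ lookup A i)
    λ A eq → trans (cong (S A ∧_) eq) (Bool.∧-zeroʳ (S A)))
  digits : (Subset (suc n) → Bool) → Fin (suc n) → Fin (suc (2 ^ n))
  digits S i = Fin.fromℕ< (bound S i)
  code : (Subset (suc n) → Bool) → Fin (suc (2 ^ n) ^ suc n)
  code S = Fin.funToFin (digits S)
  chow-≡ : ∀ S T → code S ≡ code T → chow S ≗ chow T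
  chow-≡ S T eq i = trans (sym (Fin.toℕ-fromℕ< (bound S i)))
    (trans (cong toℕ digit≡) (Fin.toℕ-fromℕ< (bound T i)))
    where
    digit≡ : digits S i ≡ digits T i
    digit≡ = trans (sym (Fin.finToFun-funToFin (digits S) i))
      (trans (cong (λ c → Fin.finToFun c i) eq) (Fin.finToFun-funToFin (digits T) i))
  determines : ∀ S T v → Realizes S v → code S ≡ code T → ∀ A → Mixed (without0 A) → S A ≡ T A
  determines S T v real eq A mixed =
    chow-determines S T v (proj₁ ∘ real) (chow-≡ S T eq) A (proj₂ (real A) mixed)

-- For n = 2 the bound by Chow parameters, 9, is too weak.
resonance₂-≤ : ∀ {R} → HasCardinality (resonanceChambers 2) R → R ℕ.≤ 8
resonance₂-≤ resonance = resonance-≤ resonance code determines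
  where
  subsets : Fin 3 → Subset 2
  subsets zero             = true ∷ false ∷ []
  subsets (suc zero)       = false ∷ true ∷ []
  subsets (suc (suc zero)) = true ∷ true ∷ []
  bit : Bool → Fin 2
  bit true  = zero
  bit false = suc zero
  bit-injective : ∀ b c → bit b ≡ bit c → b ≡ c
  bit-injective true  true  _ = refl
  bit-injective false false _ = refl
  -- The three nonempty subsets have 2^3 sign patterns, and 3 = 2² - 1.
  code : (Subset 2 → Bool) → Fin 8
  code S = Fin.funToFin (bit ∘ S ∘ subsets)
  agree : ∀ S T → code S ≡ code T → ∀ i → S (subsets i) ≡ T (subsets i)
  agree S T eq i = bit-injective (S (subsets i)) (T (subsets i))
    (trans (sym (Fin.finToFun-funToFin (bit ∘ S ∘ subsets) i))
      (trans (cong (λ c → Fin.finToFun c i) eq) (Fin.finToFun-funToFin (bit ∘ T ∘ subsets) i)))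
  determines : ∀ S T v → Realizes S v → code S ≡ code T → ∀ A → Mixed (without0 A) → S A ≡ T A
  determines S T v _ eq (true ∷ false ∷ [])  _ = agree S T eq zero
  determines S T v _ eq (false ∷ true ∷ [])  _ = agree S T eq (suc zero)
  determines S T v _ eq (true ∷ true ∷ [])   _ = agree S T eq (suc (suc zero))
  determines S T v _ eq (false ∷ false ∷ []) ((i , bi) , _) = ⊥-elim (none i bi)
    where
    none : ∀ i → without0 (false ∷ false ∷ []) i ≢ true
    none zero             ()
    none (suc zero)       ()
    none (suc (suc zero)) ()

-- With a = 2^(n-1), bounding each of n factors 1 + a by 2a would give 2^(n²), too large by one
-- factor 2. Estimating two of the factors together saves it. At a = 2 this fails, as 9 > 8, which
-- is the exceptional case n = 2.
[1+a]²≤2a² : ∀ a → 4 ℕ.≤ a → suc a ℕ.* suc a ℕ.≤ 2 ℕ.* (a ℕ.* a)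
[1+a]²≤2a² a 4≤a = begin
  suc a ℕ.* suc a                    ≡⟨ expand a ⟩
  a ℕ.* a ℕ.+ (2 ℕ.* a ℕ.+ 1)        ≤⟨ ℕ.+-monoʳ-≤ (a ℕ.* a) small ⟩
  a ℕ.* a ℕ.+ a ℕ.* a                ≡⟨ m+m≡2*m (a ℕ.* a) ⟩
  2 ℕ.* (a ℕ.* a)                    ∎
  where
  open ℕ.≤-Reasoning
  expand : ∀ a → suc a ℕ.* suc a ≡ a ℕ.* a ℕ.+ (2 ℕ.* a ℕ.+ 1)
  expand = solve-∀
  small : 2 ℕ.* a ℕ.+ 1 ℕ.≤ a ℕ.* a
  small = begin
    2 ℕ.* a ℕ.+ 1            ≤⟨ ℕ.+-monoʳ-≤ (2 ℕ.* a) (ℕ.≤-trans (ℕ.s≤s ℕ.z≤n) (ℕ.≤-trans 4≤a (ℕ.m≤m+n a (1 ℕ.* a)))) ⟩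
    2 ℕ.* a ℕ.+ 2 ℕ.* a      ≡⟨ ℕ.*-distribʳ-+ a 2 2 ⟨
    4 ℕ.* a                  ≤⟨ ℕ.*-monoˡ-≤ a 4≤a ⟩
    a ℕ.* a                  ∎

-- The exponent is n² - 1 for n = k + 3.
chow-bound : ∀ k → suc (2 ^ (2 ℕ.+ k)) ^ (3 ℕ.+ k) ℕ.≤ 2 ^ ((2 ℕ.+ k) ℕ.* (4 ℕ.+ k))
chow-bound k = begin
  suc a ^ (2 ℕ.+ suc k)                                       ≡⟨ ℕ.^-distribˡ-+-* (suc a) 2 (suc k) ⟩
  suc a ^ 2 ℕ.* suc a ^ suc k                                 ≤⟨ ℕ.*-mono-≤ square (ℕ.^-monoˡ-≤ (suc k) 1+a≤2a) ⟩
  2 ^ (1 ℕ.+ (m ℕ.+ m)) ℕ.* (2 ^ (1 ℕ.+ m)) ^ suc k           ≡⟨ cong (2 ^ (1 ℕ.+ (m ℕ.+ m)) ℕ.*_) (ℕ.^-*-assoc 2 (1 ℕ.+ m) (suc k)) ⟩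
  2 ^ (1 ℕ.+ (m ℕ.+ m)) ℕ.* 2 ^ ((1 ℕ.+ m) ℕ.* suc k)         ≡⟨ ℕ.^-distribˡ-+-* 2 (1 ℕ.+ (m ℕ.+ m)) ((1 ℕ.+ m) ℕ.* suc k) ⟨
  2 ^ (1 ℕ.+ (m ℕ.+ m) ℕ.+ (1 ℕ.+ m) ℕ.* suc k)               ≡⟨ cong (2 ^_) (exponent k) ⟩
  2 ^ ((2 ℕ.+ k) ℕ.* (4 ℕ.+ k))                               ∎
  where
  open ℕ.≤-Reasoning
  m = 2 ℕ.+ k
  a = 2 ^ m
  4≤a : 4 ℕ.≤ a
  4≤a = ℕ.^-monoʳ-≤ 2 {2} {m} (ℕ.m≤m+n 2 k)
  1+a≤2a : suc a ℕ.≤ 2 ℕ.* a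
  1+a≤2a = ℕ.≤-trans (ℕ.+-monoˡ-≤ a (ℕ.≤-trans (ℕ.s≤s ℕ.z≤n) 4≤a)) (ℕ.≤-reflexive (m+m≡2*m a))
  square : suc a ^ 2 ℕ.≤ 2 ^ (1 ℕ.+ (m ℕ.+ m))
  square = begin
    suc a ^ 2                  ≡⟨ cong (suc a ℕ.*_) (ℕ.*-identityʳ (suc a)) ⟩
    suc a ℕ.* suc a            ≤⟨ [1+a]²≤2a² a 4≤a ⟩
    2 ℕ.* (a ℕ.* a)            ≡⟨ cong (2 ℕ.*_) (ℕ.^-distribˡ-+-* 2 m m) ⟨
    2 ^ (1 ℕ.+ (m ℕ.+ m))      ∎
  exponent : ∀ k → 1 ℕ.+ ((2 ℕ.+ k) ℕ.+ (2 ℕ.+ k)) ℕ.+ (1 ℕ.+ (2 ℕ.+ k)) ℕ.* suc k ≡ (2 ℕ.+ k) ℕ.* (4 ℕ.+ k)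
  exponent = solve-∀

resonance≤2^ : ∀ m {R} → HasCardinality (resonanceChambers (2 ℕ.+ m)) R → R ℕ.≤ 2 ^ ((1 ℕ.+ m) ℕ.* (3 ℕ.+ m))
resonance≤2^ zero    resonance = resonance₂-≤ resonance
resonance≤2^ (suc k) resonance = ℕ.≤-trans (resonance-≤-chow resonance) (chow-bound k)

-- Logarithms

-- Rounding down works in favour of an upper bound: 2 to the sum of the two floors is at most (K
-- m)^k. Hence every single approximation of the logarithms obeys the bound, without an error term.
log-* : ∀ K m e → K ℕ.* m ℕ.≤ 2 ^ e → .{{_ : ℕ.NonZero K}} .{{_ : ℕ.NonZero m}} → ∀ k →
  ⌊log₂ K ^ k ⌋ ℕ.+ ⌊log₂ m ^ k ⌋ ℕ.≤ e ℕ.* k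
log-* K m e Km≤2^e k = ℕ.≮⇒≥ λ lt → ℕ.<-irrefl refl
  (ℕ.≤-<-trans bound (ℕ.^-monoʳ-< 2 (ℕ.s≤s (ℕ.s≤s ℕ.z≤n)) lt))
  where
  open ℕ.≤-Reasoning
  bound : 2 ^ (⌊log₂ K ^ k ⌋ ℕ.+ ⌊log₂ m ^ k ⌋) ℕ.≤ 2 ^ (e ℕ.* k)
  bound = begin
    2 ^ (⌊log₂ K ^ k ⌋ ℕ.+ ⌊log₂ m ^ k ⌋)            ≡⟨ ℕ.^-distribˡ-+-* 2 ⌊log₂ K ^ k ⌋ ⌊log₂ m ^ k ⌋ ⟩
    2 ^ ⌊log₂ K ^ k ⌋ ℕ.* 2 ^ ⌊log₂ m ^ k ⌋          ≤⟨ ℕ.*-mono-≤ (log-lower (K ^ k) {{ℕ.m^n≢0 K k}}) (log-lower (m ^ k) {{ℕ.m^n≢0 m k}}) ⟩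
    K ^ k ℕ.* m ^ k                                  ≡⟨ ^-distribʳ-* K m k ⟨
    (K ℕ.* m) ^ k                                    ≤⟨ ℕ.^-monoˡ-≤ k Km≤2^e ⟩
    (2 ^ e) ^ k                                      ≡⟨ ℕ.^-*-assoc 2 e k ⟩
    2 ^ (e ℕ.* k)                                    ∎

/-+ : ∀ a b j → + (a ℕ.+ b) ℚ./ suc j ≡ + a ℚ./ suc j ℚ.+ + b ℚ./ suc j
/-+ a b j = begin
  + (a ℕ.+ b) ℚ./ suc j                                ≡⟨ ·-/ (a ℕ.+ b) j ⟨
  (a ℕ.+ b) · (+ 1 ℚ./ suc j)                          ≡⟨ ×-homo-+ (+ 1 ℚ./ suc j) a b ⟩
  a · (+ 1 ℚ./ suc j) ℚ.+ b · (+ 1 ℚ./ suc j)          ≡⟨ cong₂ ℚ._+_ (·-/ a j) (·-/ b j) ⟩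
  + a ℚ./ suc j ℚ.+ + b ℚ./ suc j                      ∎
  where open ≡-Reasoning

log₂-approx-≤ : ∀ K m e → K ℕ.* m ℕ.≤ 2 ^ e → .{{_ : ℕ.NonZero K}} .{{_ : ℕ.NonZero m}} → ∀ k →
  log₂-approx K k ℚ.+ log₂-approx m k ℚ.≤ + e ℚ./ 1
log₂-approx-≤ K m e Km≤2^e k = subst (ℚ._≤ + e ℚ./ 1) (/-+ a b k)
  (/-mono (a ℕ.+ b) k e 0 (subst (ℕ._≤ e ℕ.* suc k) (sym (ℕ.*-identityʳ (a ℕ.+ b))) (log-* K m e Km≤2^e (suc k))))
  where
  a = ⌊log₂ K ^ suc k ⌋
  b = ⌊log₂ m ^ suc k ⌋

seq-log₂ : ∀ K m e → K ℕ.* suc m ℕ.≤ 2 ^ e → suc m ℕ.≤ 2 ^ e → ∀ k →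
  seq (log₂ K) k ℚ.+ log₂-approx (suc m) k ℚ.≤ + e ℚ./ 1
seq-log₂ (suc K) m e K≤ _  k = log₂-approx-≤ (suc K) (suc m) e K≤ k
-- The dummy value of `log₂` at 0 is 0, the logarithm of 1, so the case `K` = 1 applies; it needs n
-- + 1 ≤ 2^e separately.
seq-log₂ zero    m e _  m≤ k = ℚ.≤-trans (ℚ.+-monoˡ-≤ (log₂-approx (suc m) k) (/-mono 0 0 ⌊log₂ 1 ^ suc k ⌋ k ℕ.z≤n))
  (log₂-approx-≤ 1 (suc m) e (ℕ.≤-trans (ℕ.≤-reflexive (ℕ.*-identityˡ (suc m))) m≤) k)

log₂-≤ : ∀ K n e → n ^ 2 ≡ suc e → K ℕ.* suc n ℕ.≤ 2 ^ e → suc n ℕ.≤ 2 ^ e →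
  log₂ K ≤ fromℕ′ (n ^ 2) - 1ℝ - log₂ (suc n)
log₂-≤ K n e n²≡ K≤ n≤ (ε , 0<ε , N , p) = absurd (seq (log₂ K) N) (log₂-approx (suc n) N)
  -- The assumed strict inequality is refuted at the one index `N`. Writing n² as e + 1 lets the
  -- subtracted 1 cancel.
  (+ (n ^ 2) ℚ./ 1) (+ e ℚ./ 1) (trans (cong (λ k → + k ℚ./ 1) n²≡) (/-suc e 0))
  (p N ℕ.≤-refl) (seq-log₂ K n e K≤ n≤ N)
  where
  open +-*-Solver
  absurd : ∀ l m s r → s ≡ r ℚ.+ 1ℚ → ((s ℚ.- 1ℚ) ℚ.- m) ℚ.+ ε ℚ.≤ l → l ℚ.+ m ℚ.≤ r → ⊥
  absurd l m s r refl le le′ = ℚ.<-irrefl refl (ℚ.<-≤-trans 0<ε (≤-by (ℚ.+-mono-≤ le le′)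
    (solve 4 (λ l m r ε → ε :+ (l :+ r) := con 0ℚ :+ ((((r :+ con 1ℚ) :- con 1ℚ) :- m) :+ ε :+ (l :+ m)))
      refl l m r ε)))

n<2^n : ∀ n → n ℕ.< 2 ^ n
n<2^n zero    = ℕ.≤-refl
n<2^n (suc n) = ℕ.≤-trans (ℕ.+-mono-≤ (ℕ.≤-trans (ℕ.s≤s ℕ.z≤n) (n<2^n n)) (n<2^n n)) (ℕ.≤-reflexive (m+m≡2*m (2 ^ n)))

n²-1 : ∀ m → (2 ℕ.+ m) ^ 2 ≡ suc ((1 ℕ.+ m) ℕ.* (3 ℕ.+ m))
n²-1 m = trans (cong ((2 ℕ.+ m) ℕ.*_) (ℕ.*-identityʳ (2 ℕ.+ m))) (product m)
  where
  product : ∀ k → (2 ℕ.+ k) ℕ.* (2 ℕ.+ k) ≡ suc ((1 ℕ.+ k) ℕ.* (3 ℕ.+ k))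
  product = solve-∀

n≤n²-1 : ∀ m → 2 ℕ.+ m ℕ.≤ (1 ℕ.+ m) ℕ.* (3 ℕ.+ m)
n≤n²-1 m = ℕ.≤-trans (ℕ.m≤n+m (2 ℕ.+ m) 1) (ℕ.m≤m+n (3 ℕ.+ m) (m ℕ.* (3 ℕ.+ m)))

mainTheorem2 : ∀ n → 2 ℕ.≤ n → ∀ K R →
    HasCardinality (kostantChambers n) K →
    HasCardinality (resonanceChambers n) R →
    (+ K ℚ./ 1 ℚ.≤ + R ℚ./ suc n) ×
    (log₂ K ≤ fromℕ′ (n ^ 2) - 1ℝ - log₂ (suc n))
mainTheorem2 n@(suc (suc m)) (ℕ.s≤s (ℕ.s≤s _)) K R kostant resonance =
  /-mono K 0 R n (subst (K ℕ.* suc n ℕ.≤_) (sym (ℕ.*-identityʳ R)) K[n+1]≤R) ,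
  log₂-≤ K n e (n²-1 m) (ℕ.≤-trans K[n+1]≤R (resonance≤2^ m resonance))
    -- With e = n² - 1 this is n + 1 ≤ 2^n ≤ 2^e, as required by the dummy value of `log₂` at 0.
    (ℕ.≤-trans (n<2^n n) (ℕ.^-monoʳ-≤ 2 (n≤n²-1 m)))
  where
  K[n+1]≤R : K ℕ.* suc n ℕ.≤ R
  K[n+1]≤R = K*suc[n]≤R kostant resonance
  e = (1 ℕ.+ m) ℕ.* (3 ℕ.+ m)
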